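{- Let $\mathcal{C}$ be an $I$-cellular (freely generated) CwF. Then $\mathcal{C}$ has locally familially representable polynomial sorts: for every object $\Gamma$ of $\mathcal{C}$ and every closed polynomial sort $P$ of the slice CwF $\mathcal{C}/\Gamma$, the presheaf $\mathsf{Elem}(P)$ on $\mathcal{C}/\Gamma$ is familially representable. In particular, for every closed polynomial sort $P$ of $\mathcal{C}$, the presheaf $\mathsf{Elem}(P)$ on $\mathcal{C}$ is familially representable.
   Context: A CwF consists of a category $\mathcal{C}$ with terminal object $\diamond$, a presheaf $\mathsf{Ty}$ of types, sets $\mathsf{Tm}(\Gamma,A)$ of terms for $A\in\mathsf{Ty}(\Gamma)$, with functorial substitution, and context extensions $\Gamma.A$ with $\mathbf{p}_A:\Gamma.A\to\Gamma$, $\mathbf{q}_A\in\mathsf{Tm}(\Gamma.A,A[\mathbf{p}_A])$ such that maps $\Delta\to\Gamma.A$ correspond bijectively to pairs $(\rho:\Delta\to\Gamma,\ a\in\mathsf{Tm}(\Delta,A[\rho]))$. Morphisms of CwFs preserve all structure strictly. The slice CwF $\mathcal{C}/\Gamma$ has objects $\rho:\Delta\to\Gamma$, types $\mathsf{Ty}(\Delta)$ and terms $\mathsf{Tm}(\Delta,A)$ over $\rho$, and extension $\rho\circ\mathbf{p}_A:\Delta.A\to\Gamma$. A telescope over $\Gamma$ is a finite sequence $A_1\in\mathsf{Ty}(\Gamma)$, $A_2\in\mathsf{Ty}(\Gamma.A_1)$, \dots, and $\Gamma.\Delta$ is the iterated extension. $I$-cellular CwF: let $I^{\mathsf{ty}}$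 be the CwF morphism from the CwF freely generated by an object to the CwF freely generated by an object and a type over it, and $I^{\mathsf{tm}}$ the morphism from the latter to the CwF freely generated by an object, a type over it and a term of that type. A basic $I$-cellular map is a pushout of a coproduct of copies of $I^{\mathsf{ty}}$ and $I^{\mathsf{tm}}$ (freely adjoining new types and terms whose contexts and types already exist, with no equations); an $I$-cellular map is a countable sequential composite of basic $I$-cellular maps; $\mathcal{C}$ is $I$-cellular if the map from the initial CwF to $\mathcal{C}$ is $I$-cellular. Familial representability: a presheaf $X$ on a category is familially representable if every connected component of its category of elements has a terminal object (equivalently, $X$ is a coproduct of representables). Polynomial sorts (for any CwF $\mathcal{D}$): a monomial sort over an object $\Gamma$ is $[\Delta\vdash\mathbb{ty}]$ or $[\Delta\vdash\mathbb{tm}(A)]$ with $\Delta$ a telescope over $\Gamma$ and $A\in\mathsf{Ty}(\Gamma.\Delta)$; its elements are $\mathsf{Ty}(\Gamma.\Delta)$, resp. $\mathsf{Tm}(\Gamma.\Delta,A)$; monomial sorts are stable under substitution. Closed polynomial sorts $P$ and presheaves $\mathsf{Elem}(P)$ are defined inductively: $\diamond$ with $\mathsf{Elem}(\diamond)$ terminal; and $P.M$ where $M$ assigns naturally to each $\Gamma$ and $e\in\mathsf{Elem}(P)(\Gamma)$ a monomial sort $M(e)$ over $\Gamma$, with $\mathsf{Elem}(P.M)(\Gamma)=\{(e,m): e\in\mathsf{Elem}(P)(\Gamma),\ m \text{ an element of } M(e)\}$. -}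

module Defs where

open import Level using (Level)
open import Data.Nat using (ℕ; suc)
open import Data.Product using (Σ; _×_; _,_; proj₁; proj₂)
open import Data.Product.Properties using (Σ-≡,≡→≡)
open import Data.Unit using (⊤; tt)
open import Relation.Binary.PropositionalEquality
open import Axiom.UniquenessOfIdentityProofs using (UIP; module Constant⇒UIP)

Σ-UIP : {A : Set} {B : A → Set} → UIP A → (∀ a (x y : B a) → x ≡ y) → UIP (Σ A B)
Σ-UIP {A} {B} uA pB = Constant⇒UIP.≡-irrelevant f fc
  where
  mk : {u v : Σ A B} → proj₁ u ≡ proj₁ v → u ≡ v
  mk e = Σ-≡,≡→≡ (e , pB _ _ _)
  f : {u v : Σ A B} → u ≡ v → u ≡ v
  f r = mk (cong proj₁ r)
  fc : {u v : Σ A B} (r s : u ≡ v) → f r ≡ f s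
  fc r s = cong mk (uA _ _)

record CwF : Set₁ where
  infixl 40 _∘_
  infixl 30 _[_]T _[_]t
  infixl 20 _▹_
  field
    Con    : Set
    Sub    : Con → Con → Set
    Sub-set : ∀ {Δ Γ} → UIP (Sub Δ Γ)
    id     : ∀ {Γ} → Sub Γ Γ
    _∘_    : ∀ {Γ Δ Θ} → Sub Δ Γ → Sub Θ Δ → Sub Θ Γ
    idl    : ∀ {Γ Δ} (σ : Sub Δ Γ) → id ∘ σ ≡ σ
    idr    : ∀ {Γ Δ} (σ : Sub Δ Γ) → σ ∘ id ≡ σ
    ass    : ∀ {Γ Δ Θ Ξ} (σ : Sub Δ Γ) (δ : Sub Θ Δ) (ν : Sub Ξ Θ) →
             (σ ∘ δ) ∘ ν ≡ σ ∘ (δ ∘ ν)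
    ◇      : Con
    ε      : ∀ {Γ} → Sub Γ ◇
    ◇η     : ∀ {Γ} (σ : Sub Γ ◇) → σ ≡ ε
    Ty     : Con → Set
    Ty-set : ∀ {Γ} → UIP (Ty Γ)
    _[_]T  : ∀ {Γ Δ} → Ty Γ → Sub Δ Γ → Ty Δ
    [id]T  : ∀ {Γ} (A : Ty Γ) → A [ id ]T ≡ A
    [∘]T   : ∀ {Γ Δ Θ} (A : Ty Γ) (σ : Sub Δ Γ) (δ : Sub Θ Δ) →
             A [ σ ∘ δ ]T ≡ A [ σ ]T [ δ ]T
    Tm     : (Γ : Con) → Ty Γ → Set
    Tm-set : ∀ {Γ A} → UIP (Tm Γ A)
    _[_]t  : ∀ {Γ Δ} {A : Ty Γ} → Tm Γ A → (σ : Sub Δ Γ) → Tm Δ (A [ σ ]T)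
    [id]t  : ∀ {Γ} {A : Ty Γ} (t : Tm Γ A) →
             subst (Tm Γ) ([id]T A) (t [ id ]t) ≡ t
    [∘]t   : ∀ {Γ Δ Θ} {A : Ty Γ} (t : Tm Γ A) (σ : Sub Δ Γ) (δ : Sub Θ Δ) →
             subst (Tm Θ) ([∘]T A σ δ) (t [ σ ∘ δ ]t) ≡ t [ σ ]t [ δ ]t
    _▹_    : (Γ : Con) → Ty Γ → Con
    p      : ∀ {Γ} {A : Ty Γ} → Sub (Γ ▹ A) Γ
    q      : ∀ {Γ} {A : Ty Γ} → Tm (Γ ▹ A) (A [ p ]T)
    ⟨_,_⟩  : ∀ {Γ Δ} {A : Ty Γ} (σ : Sub Δ Γ) → Tm Δ (A [ σ ]T) → Sub Δ (Γ ▹ A)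
    p∘⟨⟩   : ∀ {Γ Δ} (A : Ty Γ) (σ : Sub Δ Γ) (t : Tm Δ (A [ σ ]T)) →
             p ∘ ⟨_,_⟩ {A = A} σ t ≡ σ
    q[⟨⟩]  : ∀ {Γ Δ} (A : Ty Γ) (σ : Sub Δ Γ) (t : Tm Δ (A [ σ ]T)) →
             subst (Tm Δ) (trans (sym ([∘]T A p (⟨_,_⟩ {A = A} σ t)))
                                 (cong (A [_]T) (p∘⟨⟩ A σ t)))
                   (q [ ⟨_,_⟩ {A = A} σ t ]t) ≡ t
    ⟨⟩η    : ∀ {Γ Δ} (A : Ty Γ) (τ : Sub Δ (Γ ▹ A)) →
             ⟨_,_⟩ {A = A} (p ∘ τ) (subst (Tm Δ) (sym ([∘]T A p τ)) (q [ τ ]t)) ≡ τ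

module _ (C : CwF) (Γ : CwF.Con C) where
  open CwF C

  private
    SCon : Set
    SCon = Σ Con (λ Δ → Sub Δ Γ)

    SSub : SCon → SCon → Set
    SSub (Δ , ρ) (Δ' , ρ') = Σ (Sub Δ Δ') (λ τ → ρ' ∘ τ ≡ ρ)

    sEq : ∀ {X Y} {u v : SSub X Y} → proj₁ u ≡ proj₁ v → u ≡ v
    sEq e = Σ-≡,≡→≡ (e , Sub-set _ _)

  Slice : CwF
  Slice .CwF.Con = SCon
  Slice .CwF.Sub = SSub
  Slice .CwF.Sub-set {Δ , ρ} {Δ' , ρ'} = Σ-UIP Sub-set (λ _ → Sub-set)
  Slice .CwF.id {Δ , ρ} = id , idr ρ
  Slice .CwF._∘_ {Δ'' , ρ''} {Δ' , ρ'} {Δ , ρ} (τ , e) (τ' , e') =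
    τ ∘ τ' , trans (sym (ass ρ'' τ τ')) (trans (cong (_∘ τ') e) e')
  Slice .CwF.idl σ = sEq (idl _)
  Slice .CwF.idr σ = sEq (idr _)
  Slice .CwF.ass σ δ ν = sEq (ass _ _ _)
  Slice .CwF.◇ = Γ , id
  Slice .CwF.ε {Δ , ρ} = ρ , idl ρ
  Slice .CwF.◇η (σ , e) = sEq (trans (sym (idl σ)) e)
  Slice .CwF.Ty (Δ , ρ) = Ty Δ
  Slice .CwF.Ty-set = Ty-set
  Slice .CwF._[_]T A (τ , e) = A [ τ ]T
  Slice .CwF.[id]T = [id]T
  Slice .CwF.[∘]T A (σ , _) (δ , _) = [∘]T A σ δ
  Slice .CwF.Tm (Δ , ρ) A = Tm Δ A
  Slice .CwF.Tm-set = Tm-set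
  Slice .CwF._[_]t t (τ , e) = t [ τ ]t
  Slice .CwF.[id]t = [id]t
  Slice .CwF.[∘]t t (σ , _) (δ , _) = [∘]t t σ δ
  Slice .CwF._▹_ (Δ , ρ) A = Δ ▹ A , ρ ∘ p
  Slice .CwF.p = p , refl
  Slice .CwF.q = q
  Slice .CwF.⟨_,_⟩ {Δ' , ρ'} {Δ , ρ} {A} (σ , e) t =
    ⟨ σ , t ⟩ , trans (ass ρ' p ⟨ σ , t ⟩) (trans (cong (ρ' ∘_) (p∘⟨⟩ A σ t)) e)
  Slice .CwF.p∘⟨⟩ A (σ , e) t = sEq (p∘⟨⟩ A σ t)
  Slice .CwF.q[⟨⟩] {Δ' , ρ'} {Δ , ρ} A (σ , e) t =
    trans (cong (λ z → subst (Tm Δ) z (q [ ⟨ σ , t ⟩ ]t)) (Ty-set _ _)) (q[⟨⟩] A σ t)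
  Slice .CwF.⟨⟩η A (τ , e) = sEq (⟨⟩η A τ)

record RawMor (C D : CwF) : Set where
  field
    F₀ : CwF.Con C → CwF.Con D
    F₁ : ∀ {Δ Γ} → CwF.Sub C Δ Γ → CwF.Sub D (F₀ Δ) (F₀ Γ)
    FT : ∀ {Γ} → CwF.Ty C Γ → CwF.Ty D (F₀ Γ)
    Ft : ∀ {Γ} {A : CwF.Ty C Γ} → CwF.Tm C Γ A → CwF.Tm D (F₀ Γ) (FT A)
open RawMor public

_⊙_ : ∀ {C D E} → RawMor C D → RawMor D E → RawMor C E
(F ⊙ G) .F₀ Γ = F₀ G (F₀ F Γ)
(F ⊙ G) .F₁ σ = F₁ G (F₁ F σ)
(F ⊙ G) .FT A = FT G (FT F A)
(F ⊙ G) .Ft t = Ft G (Ft F t)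

record MorLaws {C D : CwF} (F : RawMor C D) : Set where
  private
    module C = CwF C
    module D = CwF D
  field
    F-id  : ∀ {Γ} → F₁ F (C.id {Γ}) ≡ D.id
    F-∘   : ∀ {Γ Δ Θ} (σ : C.Sub Δ Γ) (δ : C.Sub Θ Δ) →
            F₁ F (σ C.∘ δ) ≡ (F₁ F σ D.∘ F₁ F δ)
    F-◇   : F₀ F C.◇ ≡ D.◇
    F-[]T : ∀ {Γ Δ} (A : C.Ty Γ) (σ : C.Sub Δ Γ) →
            FT F (A C.[ σ ]T) ≡ FT F A D.[ F₁ F σ ]T
    F-[]t : ∀ {Γ Δ} {A : C.Ty Γ} (t : C.Tm Γ A) (σ : C.Sub Δ Γ) →
            subst (D.Tm (F₀ F Δ)) (F-[]T A σ) (Ft F (t C.[ σ ]t)) ≡ Ft F t D.[ F₁ F σ ]t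
    F-▹   : ∀ {Γ} (A : C.Ty Γ) →
            _≡_ {A = Σ D.Con (λ X → Σ (D.Sub X (F₀ F Γ)) (λ f → D.Tm X (FT F A D.[ f ]T)))}
              (F₀ F (Γ C.▹ A) , F₁ F C.p , subst (D.Tm _) (F-[]T A C.p) (Ft F C.q))
              (F₀ F Γ D.▹ FT F A , D.p , D.q)

record Mor (C D : CwF) : Set where
  field
    raw  : RawMor C D
    laws : MorLaws raw
open Mor public

record RawEq {C D : CwF} (F G : RawMor C D) : Set where
  private
    module C = CwF C
    module D = CwF D
  field
    eq₀ : ∀ Γ → F₀ F Γ ≡ F₀ G Γ
    eq₁ : ∀ {Δ Γ} (σ : C.Sub Δ Γ) →
          _≡_ {A = Σ D.Con (λ X → Σ D.Con (λ Y → D.Sub X Y))}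
            (F₀ F Δ , F₀ F Γ , F₁ F σ) (F₀ G Δ , F₀ G Γ , F₁ G σ)
    eqT : ∀ {Γ} (A : C.Ty Γ) →
          _≡_ {A = Σ D.Con D.Ty} (F₀ F Γ , FT F A) (F₀ G Γ , FT G A)
    eqt : ∀ {Γ} {A : C.Ty Γ} (t : C.Tm Γ A) →
          _≡_ {A = Σ D.Con (λ X → Σ (D.Ty X) (D.Tm X))}
            (F₀ F Γ , FT F A , Ft F t) (F₀ G Γ , FT G A , Ft G t)

record IsInitial (C : CwF) : Set₁ where
  field
    !    : (E : CwF) → Mor C E
    uniq : (E : CwF) (F G : Mor C E) → RawEq (raw F) (raw G)

-- Basic I-cellular maps.
-- A pushout of a coproduct of copies of I^ty and I^tm along a map
-- into C, written out via the universal properties of the free CwFs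
-- (a map out of the free CwF on an object / object+type /
-- object+type+term is that data), of coproducts and of pushouts:
-- D is obtained from C by freely adjoining types newTy j over the
-- contexts ctxTy j of C and terms newTm k of the types tyTm k of C.

record BasicCellular {C D : CwF} (f : Mor C D) : Set₁ where
  private
    module C = CwF C
    module D = CwF D
  field
    Jty   : Set
    ctxTy : Jty → C.Con
    Jtm   : Set
    ctxTm : Jtm → C.Con
    tyTm  : (k : Jtm) → C.Ty (ctxTm k)
    newTy : (j : Jty) → D.Ty (F₀ (raw f) (ctxTy j))
    newTm : (k : Jtm) → D.Tm (F₀ (raw f) (ctxTm k)) (FT (raw f) (tyTm k))

  Factors : {E : CwF} (g : Mor C E)
            (T : (j : Jty) → CwF.Ty E (F₀ (raw g) (ctxTy j)))
            (u : (k : Jtm) → CwF.Tm E (F₀ (raw g) (ctxTm k)) (FT (raw g) (tyTm k)))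
            (h : Mor D E) → Set
  Factors {E} g T u h =
    RawEq (raw f ⊙ raw h) (raw g) ×
    ((j : Jty) → _≡_ {A = Σ (CwF.Con E) (CwF.Ty E)}
       (F₀ (raw h) (F₀ (raw f) (ctxTy j)) , FT (raw h) (newTy j))
       (F₀ (raw g) (ctxTy j) , T j)) ×
    ((k : Jtm) → _≡_ {A = Σ (CwF.Con E) (λ X → Σ (CwF.Ty E X) (CwF.Tm E X))}
       (F₀ (raw h) (F₀ (raw f) (ctxTm k)) , FT (raw h) (FT (raw f) (tyTm k)) , Ft (raw h) (newTm k))
       (F₀ (raw g) (ctxTm k) , FT (raw g) (tyTm k) , u k))

  field
    univ : (E : CwF) (g : Mor C E)
           (T : (j : Jty) → CwF.Ty E (F₀ (raw g) (ctxTy j)))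
           (u : (k : Jtm) → CwF.Tm E (F₀ (raw g) (ctxTm k)) (FT (raw g) (tyTm k))) →
           Σ (Mor D E) (Factors g T u)
    uniq : (E : CwF) (g : Mor C E)
           (T : (j : Jty) → CwF.Ty E (F₀ (raw g) (ctxTy j)))
           (u : (k : Jtm) → CwF.Tm E (F₀ (raw g) (ctxTm k)) (FT (raw g) (tyTm k)))
           (h h' : Mor D E) → Factors g T u h → Factors g T u h' → RawEq (raw h) (raw h')

-- I-cellular CwF: the map from the initial CwF to C is a countable
-- sequential composite of basic I-cellular maps, i.e. C is the colimit
-- of a chain Ch 0 → Ch 1 → ... of basic I-cellular maps with Ch 0 initial.

record IsCellularCwF (C : CwF) : Set₁ where
  field
    Ch     : ℕ → CwF
    step   : (n : ℕ) → Mor (Ch n) (Ch (suc n))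
    basic  : (n : ℕ) → BasicCellular (step n)
    init   : IsInitial (Ch 0)
    ι      : (n : ℕ) → Mor (Ch n) C
    ι-comm : (n : ℕ) → RawEq (raw (step n) ⊙ raw (ι (suc n))) (raw (ι n))
    colim  : (E : CwF) (g : (n : ℕ) → Mor (Ch n) E) →
             ((n : ℕ) → RawEq (raw (step n) ⊙ raw (g (suc n))) (raw (g n))) →
             Σ (Mor C E) (λ h → (n : ℕ) → RawEq (raw (ι n) ⊙ raw h) (raw (g n)))
    colim-uniq : (E : CwF) (g : (n : ℕ) → Mor (Ch n) E) →
             ((n : ℕ) → RawEq (raw (step n) ⊙ raw (g (suc n))) (raw (g n))) →
             (h h' : Mor C E) →
             ((n : ℕ) → RawEq (raw (ι n) ⊙ raw h) (raw (g n))) →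
             ((n : ℕ) → RawEq (raw (ι n) ⊙ raw h') (raw (g n))) →
             RawEq (raw h) (raw h')

module Sorts (C : CwF) where
  open CwF C

  data Tel (Γ : Con) : Set where
    []  : Tel Γ
    _∷_ : (A : Ty Γ) → Tel (Γ ▹ A) → Tel Γ

  _▹▹_ : (Γ : Con) → Tel Γ → Con
  Γ ▹▹ []      = Γ
  Γ ▹▹ (A ∷ Θ) = (Γ ▹ A) ▹▹ Θ

  _↑_ : ∀ {Γ Δ} (σ : Sub Δ Γ) (A : Ty Γ) → Sub (Δ ▹ A [ σ ]T) (Γ ▹ A)
  σ ↑ A = ⟨_,_⟩ {A = A} (σ ∘ p) (subst (Tm _) (sym ([∘]T A σ p)) q)

  subTel : ∀ {Γ Δ} (Θ : Tel Γ) (σ : Sub Δ Γ) →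
           Σ (Tel Δ) (λ Θ' → Sub (Δ ▹▹ Θ') (Γ ▹▹ Θ))
  subTel []      σ = [] , σ
  subTel (A ∷ Θ) σ = (A [ σ ]T ∷ proj₁ (subTel Θ (σ ↑ A))) , proj₂ (subTel Θ (σ ↑ A))

  data Mono (Γ : Con) : Set where
    ty : Tel Γ → Mono Γ
    tm : (Θ : Tel Γ) → Ty (Γ ▹▹ Θ) → Mono Γ

  MEl : ∀ {Γ} → Mono Γ → Set
  MEl {Γ} (ty Θ)   = Ty (Γ ▹▹ Θ)
  MEl {Γ} (tm Θ A) = Tm (Γ ▹▹ Θ) A

  _[_]M : ∀ {Γ Δ} → Mono Γ → Sub Δ Γ → Mono Δ
  ty Θ   [ σ ]M = ty (proj₁ (subTel Θ σ))
  tm Θ A [ σ ]M = tm (proj₁ (subTel Θ σ)) (A [ proj₂ (subTel Θ σ) ]T)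

  _[_]m : ∀ {Γ Δ} {M : Mono Γ} → MEl M → (σ : Sub Δ Γ) → MEl (M [ σ ]M)
  _[_]m {M = ty Θ}   B σ = B [ proj₂ (subTel Θ σ) ]T
  _[_]m {M = tm Θ A} t σ = t [ proj₂ (subTel Θ σ) ]t

  data Poly : Set
  Elem : Poly → Con → Set
  _·_  : ∀ {P : Poly} {Γ Δ} → Elem P Γ → Sub Δ Γ → Elem P Δ

  data Poly where
    ◇P  : Poly
    ext : (P : Poly) (M : ∀ {Γ} → Elem P Γ → Mono Γ) →
          (∀ {Γ Δ} (e : Elem P Γ) (σ : Sub Δ Γ) → M (e · σ) ≡ M e [ σ ]M) → Poly

  Elem ◇P            Γ = ⊤
  Elem (ext P M nat) Γ = Σ (Elem P Γ) (λ e → MEl (M e))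

  _·_ {◇P}            tt      σ = tt
  _·_ {ext P M nat}   (e , m) σ = (e · σ) , subst MEl (sym (nat e σ)) (_[_]m {M = M e} m σ)

  record FamRep (P : Poly) : Set₁ where
    field
      I    : Set
      obj  : I → Con
      φ    : ∀ {Δ} → Elem P Δ → Σ I (λ i → Sub Δ (obj i))
      ψ    : ∀ {Δ} → Σ I (λ i → Sub Δ (obj i)) → Elem P Δ
      ψφ   : ∀ {Δ} (e : Elem P Δ) → ψ (φ e) ≡ e
      φψ   : ∀ {Δ} (x : Σ I (λ i → Sub Δ (obj i))) → φ (ψ x) ≡ x
      φ-nat : ∀ {Δ Δ'} (e : Elem P Δ) (σ : Sub Δ' Δ) →
              φ (e · σ) ≡ (proj₁ (φ e) , proj₂ (φ e) ∘ σ)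

{-# OPTIONS --safe #-}
module Submission where

-- In a freely generated CwF every type is a substitution instance of a unique
-- generator and every term is either a variable or a substitution instance of a
-- unique generator.  The universal property yields this by mapping C into a
-- gluing over C in which such decompositions hold by construction; a second map,
-- into a CwF of untyped syntax trees, shows that types, terms and substitutions
-- are determined by their trees and gives access to induction on trees.
--
-- Hence C has most general unifiers: a nonempty sieve of maps Δ → Γ equating two
-- given terms is representable.  Unification also works when the variables of a
-- telescope Θ over Γ are kept rigid; eliminating a variable x := u requires moving
-- the variables on which u depends in front of x.
--
-- An element of a monomial sort over Δ → Γ is a term in Δ.Θ.  Its maximal Θ-free
-- subterms may be generalised to fresh variables, and the shape that remains is
-- invariant under substitution.  For each shape, the conditions for being well
-- typed form a unification problem, so that the elements with this shape form a
-- coproduct of representables.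

open import Defs
open import Data.Product using (_×_)
open import Data.Bool using (Bool; true; false; _∧_; if_then_else_)
open import Data.Empty using (⊥; ⊥-elim)
open import Data.Nat using (ℕ; zero; suc; _+_; _≤_; _<_; z≤n; s≤s)
open import Data.Nat.Properties
  using (suc-injective; +-suc; +-identityʳ; +-comm; +-cancelʳ-≡; ≤-refl; ≤-reflexive; ≤-trans;
         ≤-pred; ≤-irrelevant; <-irrefl; <-trans; m≤m+n; m≤n+m)
open import Data.Product using (Σ; _,_; proj₁; proj₂)
open import Data.Sum using (_⊎_; inj₁; inj₂)
open import Data.Unit using (⊤; tt)
open import Function using (case_of_)
open import Relation.Binary.PropositionalEquality hiding ([_])
open import Relation.Nullary using (¬_)

-- The two maps out of `C` complement each other. The gluing exposes only the head of a type or
-- term, so it supports no recursion; trees are finite but carry no types. Later recursions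
-- therefore run on a tree `r` given with an equation such as `rP P ≡ r`, and open `P` itself one
-- layer at a time through the gluing.
--
-- Generators bind nothing, so the syntax is first order and substitution erases nothing: a variable
-- leaves a term only by being replaced. Telescope variables are fixed by lifted substitutions,
-- hence shapes are invariant, and a variable cannot equal a term properly containing it.
--
-- What separates this from first-order unification is typing. A variable can be assigned a term
-- only if the types agree, so the components of two substitutions are unified in context order:
-- once the earlier ones are equal, the types of the next two are equal. Moreover a variable cannot
-- be deleted alone, since later types may mention it.

uip : ∀ {a} {A : Set a} {x y : A} (e e' : x ≡ y) → e ≡ e'
uip refl refl = refl

Σ≡ : {A : Set} {B : A → Set} → (∀ a (b b' : B a) → b ≡ b') →
     {u v : Σ A B} → proj₁ u ≡ proj₁ v → u ≡ v
Σ≡ prop {_ , b} {_ , b'} refl = cong (_ ,_) (prop _ b b')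

subst-const : ∀ {A B : Set} {x y : A} (e : x ≡ y) (b : B) → subst (λ _ → B) e b ≡ b
subst-const refl b = refl

-- Raw syntax

module Raw (K : Set) where
  infixl 30 _[_] _⊚_
  infixr 20 _∷_

  data RTm : Set
  data RSub : Set

  data RTm where
    var  : ℕ → RTm
    con  : K → RSub → RTm
    junk : RTm

  data RSub where
    []  : RSub
    _∷_ : RTm → RSub → RSub

  -- Variables out of range become junk, so that [⊚] and ⊚-assoc hold without any
  -- scoping condition.  Junk also marks the variables dropped by a retraction.
  lookup : ℕ → RSub → RTm
  lookup _       []      = junk
  lookup zero    (t ∷ s) = t
  lookup (suc i) (t ∷ s) = lookup i s

  _[_] : RTm → RSub → RTm
  _⊚_  : RSub → RSub → RSub
  var i   [ s ] = lookup i s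
  con k r [ s ] = con k (r ⊚ s)
  junk    [ s ] = junk
  []      ⊚ s = []
  (t ∷ r) ⊚ s = t [ s ] ∷ r ⊚ s

  length : RSub → ℕ
  length []      = 0
  length (t ∷ s) = suc (length s)

  vars : ℕ → ℕ → RSub
  vars k zero    = []
  vars k (suc d) = var k ∷ vars (suc k) d

  idR wk : ℕ → RSub
  idR = vars 0
  wk  = vars 1

  lookup-⊚ : ∀ i r s → lookup i (r ⊚ s) ≡ lookup i r [ s ]
  lookup-⊚ i       []      s = refl
  lookup-⊚ zero    (t ∷ r) s = refl
  lookup-⊚ (suc i) (t ∷ r) s = lookup-⊚ i r s

  [⊚] : ∀ t r s → t [ r ⊚ s ] ≡ t [ r ] [ s ]
  ⊚-assoc : ∀ q r s → (q ⊚ r) ⊚ s ≡ q ⊚ (r ⊚ s)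
  [⊚] (var i)   r s = lookup-⊚ i r s
  [⊚] (con k q) r s = cong (con k) (sym (⊚-assoc q r s))
  [⊚] junk      r s = refl
  ⊚-assoc []      r s = refl
  ⊚-assoc (t ∷ q) r s = cong₂ _∷_ (sym ([⊚] t r s)) (⊚-assoc q r s)

  vars-∷ : ∀ k d t s → vars (suc k) d ⊚ (t ∷ s) ≡ vars k d ⊚ s
  vars-∷ k zero    t s = refl
  vars-∷ k (suc d) t s = cong (lookup k s ∷_) (vars-∷ (suc k) d t s)

  idR-⊚ : ∀ {d} s → length s ≡ d → idR d ⊚ s ≡ s
  idR-⊚ []      refl = refl
  idR-⊚ (t ∷ s) refl = cong (t ∷_) (trans (vars-∷ 0 _ t s) (idR-⊚ s refl))

  wk-∷ : ∀ {d} t s → length s ≡ d → wk d ⊚ (t ∷ s) ≡ s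
  wk-∷ t s e = trans (vars-∷ 0 _ t s) (idR-⊚ s e)

  length-⊚ : ∀ r s → length (r ⊚ s) ≡ length r
  length-⊚ []      s = refl
  length-⊚ (t ∷ r) s = cong suc (length-⊚ r s)

  length-vars : ∀ k d → length (vars k d) ≡ d
  length-vars k zero    = refl
  length-vars k (suc d) = cong suc (length-vars (suc k) d)

  -- Well-scopedness is expressed as invariance under the identity substitution.
  ScT : ℕ → Set
  ScT d = Σ RTm λ t → t [ idR d ] ≡ t

  ScS : ℕ → ℕ → Set
  ScS d g = Σ RSub λ s → length s ≡ g × s ⊚ idR d ≡ s

  ScT≡ : ∀ {d} {x y : ScT d} → proj₁ x ≡ proj₁ y → x ≡ y
  ScT≡ = Σ≡ (λ _ → uip)

  ScS≡ : ∀ {d g} {x y : ScS d g} → proj₁ x ≡ proj₁ y → x ≡ y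
  ScS≡ = Σ≡ (λ { _ (a , b) (a' , b') → cong₂ _,_ (uip a a') (uip b b') })

  idR-sc : ∀ d → idR d ⊚ idR d ≡ idR d
  idR-sc d = idR-⊚ (idR d) (length-vars 0 d)

  _[_]S : ∀ {d g} → ScT g → ScS d g → ScT d
  (t , _) [ s , _ , e ]S = t [ s ] , trans (sym ([⊚] t s _)) (cong (t [_]) e)

  idS : ∀ {d} → ScS d d
  idS {d} = idR d , length-vars 0 d , idR-sc d

  open CwF

  private
    []-length : ∀ {s} → length s ≡ 0 → s ≡ []
    []-length {[]} _ = refl

  -- Contexts are lengths, types and terms are both well-scoped trees, and `Tm d _` ignores the
  -- type. All transports along type equations are then constant.
  RawCwF : CwF
  RawCwF .Con = ℕ
  RawCwF .Sub = ScS
  RawCwF .Sub-set = uip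
  RawCwF .id = idS
  RawCwF ._∘_ (r , l , e) (s , l' , e') =
    r ⊚ s , trans (length-⊚ r s) l , trans (⊚-assoc r s _) (cong (r ⊚_) e')
  RawCwF .idl (s , l , _) = ScS≡ (idR-⊚ s l)
  RawCwF .idr (s , _ , e) = ScS≡ e
  RawCwF .ass (q , _) (r , _) (s , _) = ScS≡ (⊚-assoc q r s)
  RawCwF .◇ = 0
  RawCwF .ε = [] , refl , refl
  RawCwF .◇η (s , l , _) = ScS≡ ([]-length l)
  RawCwF .Ty = ScT
  RawCwF .Ty-set = uip
  RawCwF ._[_]T = _[_]S
  RawCwF .[id]T (t , e) = ScT≡ e
  RawCwF .[∘]T (t , _) (r , _) (s , _) = ScT≡ ([⊚] t r s)
  RawCwF .Tm d _ = ScT d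
  RawCwF .Tm-set = uip
  RawCwF ._[_]t = _[_]S
  RawCwF .[id]t {A = A} (t , e) = trans (subst-const (RawCwF .[id]T A) _) (ScT≡ e)
  RawCwF .[∘]t {A = A} (t , _) σ@(r , _) δ@(s , _) =
    trans (subst-const (RawCwF .[∘]T A σ δ) _) (ScT≡ ([⊚] t r s))
  RawCwF ._▹_ d _ = suc d
  RawCwF .p {d} = wk d , length-vars 1 d , trans (vars-∷ 0 d _ _) (idR-⊚ (wk d) (length-vars 1 d))
  RawCwF .q = var 0 , refl
  RawCwF .⟨_,_⟩ (s , l , e) (t , e') = t ∷ s , cong suc l , cong₂ _∷_ e' e
  RawCwF .p∘⟨⟩ A (s , l , e) (t , e') = ScS≡ (wk-∷ t s l)
  RawCwF .q[⟨⟩] A (s , l , e) (t , e') = trans (subst-const (trans (sym (RawCwF .[∘]T A (RawCwF .p {A = A}) st)) (cong (A [_]S) (RawCwF .p∘⟨⟩ A (s , l , e) (t , e')))) _) (ScT≡ refl)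
    where
    st : ScS _ _
    st = t ∷ s , cong suc l , cong₂ _∷_ e' e
  RawCwF .⟨⟩η A (t ∷ s , l , e) = ScS≡ (cong₂ _∷_ (cong proj₁ (subst-const (sym (RawCwF .[∘]T A (RawCwF .p {A = A}) (t ∷ s , l , e))) _)) (wk-∷ t s (suc-injective l)))

module _ {A : Set} {B : A → Set} where
  ≡-subst : ∀ {a a'} {b : B a} {b' : B a'} (e : a ≡ a') → (a , b) ≡ (a' , b') → subst B e b ≡ b'
  ≡-subst refl refl = refl

  subst-≡ : ∀ {a a'} {b : B a} {b' : B a'} (e : a ≡ a') → subst B e b ≡ b' → (a , b) ≡ (a' , b')
  subst-≡ refl refl = refl

  subst-pair : ∀ {a a'} (e : a ≡ a') (b : B a) → (a' , subst B e b) ≡ (a , b)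
  subst-pair refl b = refl

  pair-inj : ∀ {a} {b b' : B a} → _≡_ {A = Σ A B} (a , b) (a , b') → b ≡ b'
  pair-inj refl = refl

-- Gluing

module Kit (C : CwF) where
  open CwF C public

  -- Terms are packed with their types: the substitution laws on pairs need no
  -- transport.
  PTm : Con → Set
  PTm Γ = Σ (Ty Γ) (Tm Γ)

  infixl 30 _[_]P
  _[_]P : ∀ {Γ Δ} → PTm Γ → Sub Δ Γ → PTm Δ
  (A , t) [ σ ]P = A [ σ ]T , t [ σ ]t

  [id]P : ∀ {Γ} (P : PTm Γ) → P [ id ]P ≡ P
  [id]P (A , t) = subst-≡ ([id]T A) ([id]t t)

  [∘]P : ∀ {Γ Δ Θ} (P : PTm Γ) (σ : Sub Δ Γ) (δ : Sub Θ Δ) → P [ σ ∘ δ ]P ≡ P [ σ ]P [ δ ]P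
  [∘]P (A , t) σ δ = subst-≡ ([∘]T A σ δ) ([∘]t t σ δ)

  Q : ∀ {Γ} (A : Ty Γ) → PTm (Γ ▹ A)
  Q A = A [ p ]T , q

  pairP : ∀ {Γ Δ} (A : Ty Γ) (σ : Sub Δ Γ) (P : PTm Δ) → proj₁ P ≡ A [ σ ]T → Sub Δ (Γ ▹ A)
  pairP A σ (T , t) e = ⟨ σ , subst (Tm _) e t ⟩

  p-pairP : ∀ {Γ Δ} (A : Ty Γ) (σ : Sub Δ Γ) (P : PTm Δ) e → p ∘ pairP A σ P e ≡ σ
  p-pairP A σ P e = p∘⟨⟩ A σ _

  Q-⟨⟩ : ∀ {Γ Δ} (A : Ty Γ) (σ : Sub Δ Γ) t → Q A [ ⟨_,_⟩ {A = A} σ t ]P ≡ (A [ σ ]T , t)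
  Q-⟨⟩ A σ t = subst-≡ _ (q[⟨⟩] A σ t)

  Q-pairP : ∀ {Γ Δ} (A : Ty Γ) (σ : Sub Δ Γ) (P : PTm Δ) e → Q A [ pairP A σ P e ]P ≡ P
  Q-pairP A σ P e = trans (Q-⟨⟩ A σ _) (subst-pair e (proj₂ P))

  pairP-η : ∀ {Γ Δ} (A : Ty Γ) (τ : Sub Δ (Γ ▹ A)) (P : PTm Δ) e →
            P ≡ Q A [ τ ]P → pairP A (p ∘ τ) P e ≡ τ
  pairP-η A τ _ e refl =
    trans (cong (λ z → ⟨ p ∘ τ , subst (Tm _) z (q [ τ ]t) ⟩) (uip _ _)) (⟨⟩η A τ)

  ▹-ext : ∀ {Γ Δ} (A : Ty Γ) (τ τ' : Sub Δ (Γ ▹ A)) →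
          p ∘ τ ≡ p ∘ τ' → Q A [ τ ]P ≡ Q A [ τ' ]P → τ ≡ τ'
  ▹-ext A τ τ' e e' =
    trans (sym (pairP-η A τ _ e₁ refl)) (trans (lem (p ∘ τ) (p ∘ τ') e _ _ e' e₁ e₂) (pairP-η A τ' _ e₂ refl))
    where
    e₁ : proj₁ (Q A [ τ ]P) ≡ A [ p ∘ τ ]T
    e₁ = sym ([∘]T A p τ)
    e₂ : proj₁ (Q A [ τ' ]P) ≡ A [ p ∘ τ' ]T
    e₂ = sym ([∘]T A p τ')
    lem : ∀ σ σ' → σ ≡ σ' → ∀ P P' → P ≡ P' → ∀ e e' → pairP A σ P e ≡ pairP A σ' P' e'
    lem σ _ refl P _ refl e e' = cong (pairP A σ P) (uip e e')

module Glue (C : CwF)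
  (TyG : Set) (cT : TyG → CwF.Con C) (nT : (j : TyG) → CwF.Ty C (cT j))
  (TmG : Set) (cM : TmG → CwF.Con C) (nM : (k : TmG) → Σ (CwF.Ty C (cM k)) (CwF.Tm C (cM k)))
  where
  open Kit C

  -- Types are generators with a substitution and terms are variables or generators
  -- with a substitution.  Only one layer is exposed: the substitution underneath a
  -- generator is one of C.
  data VCon : Con → Set where
    ◇ᵛ   : VCon ◇
    _▹ᵛ_ : ∀ {Γ} → VCon Γ → (A : Ty Γ) → VCon (Γ ▹ A)

  Var : ∀ {Γ} → VCon Γ → Set
  Var ◇ᵛ       = ⊥
  Var (v ▹ᵛ A) = ⊤ ⊎ Var v

  pattern new   = inj₁ tt
  pattern old x = inj₂ x

  ⟦_⟧v : ∀ {Γ} {v : VCon Γ} → Var v → PTm Γ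
  ⟦_⟧v {v = v ▹ᵛ A} new     = Q A
  ⟦_⟧v {v = v ▹ᵛ A} (old x) = ⟦ x ⟧v [ p ]P

  Cov : ∀ {Γ} → VCon Γ → Set
  Cov {Γ} v = Var v ⊎ Σ TmG (λ k → Sub Γ (cM k))

  ⟦_⟧ : ∀ {Γ} {v : VCon Γ} → Cov v → PTm Γ
  ⟦ inj₁ x ⟧       = ⟦ x ⟧v
  ⟦ inj₂ (k , τ) ⟧ = nM k [ τ ]P

  CVec : ∀ {Δ Γ} → VCon Δ → VCon Γ → Set
  CVec w ◇ᵛ       = ⊤
  CVec w (v ▹ᵛ A) = CVec w v × Cov w

  module _ {Δ : Con} {w : VCon Δ} where
    look : ∀ {Γ} {v : VCon Γ} → CVec w v → Var v → Cov w
    look {v = v ▹ᵛ A} (cs , c) new     = c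
    look {v = v ▹ᵛ A} (cs , c) (old x) = look cs x

    tabulate : ∀ {Γ} {v : VCon Γ} → (Var v → Cov w) → CVec w v
    tabulate {v = ◇ᵛ}     f = tt
    tabulate {v = v ▹ᵛ A} f = tabulate {v = v} (λ x → f (old x)) , f new

    look-tab : ∀ {Γ} {v : VCon Γ} (f : Var v → Cov w) x → look (tabulate f) x ≡ f x
    look-tab {v = v ▹ᵛ A} f new     = refl
    look-tab {v = v ▹ᵛ A} f (old x) = look-tab (λ x → f (old x)) x

    tab-look : ∀ {Γ} {v : VCon Γ} (cs : CVec w v) → tabulate (look cs) ≡ cs
    tab-look {v = ◇ᵛ}     tt       = refl
    tab-look {v = v ▹ᵛ A} (cs , c) = cong (_, c) (tab-look cs)

    -- Ties the chosen cover of each component to the actual substitution. As a proposition it drops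
    -- out of equations between substitutions of `G`, which are checked on the two pieces of data
    -- alone.
    Ok : ∀ {Γ} (v : VCon Γ) → CVec w v → Sub Δ Γ → Set
    Ok ◇ᵛ       cs       σ = ⊤
    Ok (v ▹ᵛ A) (cs , c) σ = Ok v cs (p ∘ σ) × ⟦ c ⟧ ≡ Q A [ σ ]P

    Ok-prop : ∀ {Γ} (v : VCon Γ) cs (σ : Sub Δ Γ) (o o' : Ok v cs σ) → o ≡ o'
    Ok-prop ◇ᵛ       cs       σ _       _         = refl
    Ok-prop (v ▹ᵛ A) (cs , c) σ (o , e) (o' , e') = cong₂ _,_ (Ok-prop v cs _ o o') (uip e e')

    look-ok : ∀ {Γ} (v : VCon Γ) {cs} {σ : Sub Δ Γ} → Ok v cs σ → ∀ x → ⟦ look cs x ⟧ ≡ ⟦ x ⟧v [ σ ]P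
    look-ok (v ▹ᵛ A) (o , e) new     = e
    look-ok (v ▹ᵛ A) (o , e) (old x) = trans (look-ok v o x) ([∘]P ⟦ x ⟧v p _)

    tab-ok : ∀ {Γ} (v : VCon Γ) {f : Var v → Cov w} {σ : Sub Δ Γ} →
             (∀ x → ⟦ f x ⟧ ≡ ⟦ x ⟧v [ σ ]P) → Ok v (tabulate f) σ
    tab-ok ◇ᵛ       h = tt
    tab-ok (v ▹ᵛ A) h = tab-ok v (λ x → trans (h (old x)) (sym ([∘]P ⟦ x ⟧v p _))) , h new

  module _ {Δ : Con} {w : VCon Δ} where
    infixl 30 _[_]c
    _[_]c : ∀ {Γ} {v : VCon Γ} → Cov v → Sub Δ Γ × CVec w v → Cov w
    inj₁ x       [ σ , cs ]c = look cs x
    inj₂ (k , τ) [ σ , cs ]c = inj₂ (k , τ ∘ σ)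

    []c-ok : ∀ {Γ} {v : VCon Γ} {σ : Sub Δ Γ} {cs} → Ok v cs σ → (c : Cov v) → ⟦ c [ σ , cs ]c ⟧ ≡ ⟦ c ⟧ [ σ ]P
    []c-ok {v = v} o (inj₁ x)       = look-ok v o x
    []c-ok         o (inj₂ (k , τ)) = [∘]P (nM k) τ _

    mapV : ∀ {Γ Θ} {v : VCon Γ} {u : VCon Θ} → CVec v u → Sub Δ Γ × CVec w v → CVec w u
    mapV {u = ◇ᵛ}     cs       δ = tt
    mapV {u = u ▹ᵛ A} (cs , c) δ = mapV cs δ , c [ δ ]c

    map-tab : ∀ {Γ Θ} {v : VCon Γ} {u : VCon Θ} (f : Var u → Var v) (δ : Sub Δ Γ × CVec w v) →
              mapV (tabulate (λ x → inj₁ (f x))) δ ≡ tabulate (λ x → look (proj₂ δ) (f x))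
    map-tab {u = ◇ᵛ}     f δ = refl
    map-tab {u = u ▹ᵛ A} f δ = cong (_, _) (map-tab (λ x → f (old x)) δ)

    map-ok : ∀ {Γ Θ} {v : VCon Γ} (u : VCon Θ) {cs : CVec v u} {σ : Sub Γ Θ} {ds : CVec w v} {δ : Sub Δ Γ} →
             Ok u cs σ → Ok v ds δ → Ok u (mapV cs (δ , ds)) (σ ∘ δ)
    map-ok ◇ᵛ o o' = tt
    map-ok (u ▹ᵛ A) {cs , c} {σ} {ds} {δ} (o , e) o' =
      subst (Ok u _) (ass p σ δ) (map-ok u o o') ,
      trans ([]c-ok o' c) (trans (cong (_[ δ ]P) e) (sym ([∘]P (Q A) σ δ)))

  idV : ∀ {Γ} {v : VCon Γ} → CVec v v
  idV = tabulate inj₁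

  []c-id : ∀ {Γ} {v : VCon Γ} (c : Cov v) → c [ id , idV ]c ≡ c
  []c-id (inj₁ x)       = look-tab inj₁ x
  []c-id (inj₂ (k , τ)) = cong (λ z → inj₂ (k , z)) (idr τ)

  map-id : ∀ {Γ Θ} {v : VCon Γ} {u : VCon Θ} (cs : CVec v u) → mapV cs (id , idV) ≡ cs
  map-id {u = ◇ᵛ}     tt       = refl
  map-id {u = u ▹ᵛ A} (cs , c) = cong₂ _,_ (map-id cs) ([]c-id c)

  module _ {Γ Δ Θ : Con} {v : VCon Γ} {w : VCon Δ} {u : VCon Θ}
           (σ : Sub Δ Γ) (cs : CVec w v) (δ : Sub Θ Δ) (ds : CVec u w) where
    look-map : ∀ {Ξ} {y : VCon Ξ} (bs : CVec w y) x → look (mapV bs (δ , ds)) x ≡ look bs x [ δ , ds ]c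
    look-map {y = y ▹ᵛ A} (bs , b) new     = refl
    look-map {y = y ▹ᵛ A} (bs , b) (old x) = look-map bs x

    []c-∘ : ∀ (c : Cov v) → c [ σ ∘ δ , mapV cs (δ , ds) ]c ≡ c [ σ , cs ]c [ δ , ds ]c
    []c-∘ (inj₁ x)       = look-map cs x
    []c-∘ (inj₂ (k , τ)) = cong (λ z → inj₂ (k , z)) (sym (ass τ σ δ))

    map-∘ : ∀ {Ξ} {y : VCon Ξ} (bs : CVec v y) →
            mapV bs (σ ∘ δ , mapV cs (δ , ds)) ≡ mapV (mapV bs (σ , cs)) (δ , ds)
    map-∘ {y = ◇ᵛ}     bs       = refl
    map-∘ {y = y ▹ᵛ A} (bs , b) = cong₂ _,_ (map-∘ bs) ([]c-∘ b)

  GCon : Set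
  GCon = Σ Con VCon

  GSub : GCon → GCon → Set
  GSub (Δ , w) (Γ , v) = Σ (Sub Δ Γ × CVec w v) (λ { (σ , cs) → Ok v cs σ })

  GSub≡ : ∀ {X Y} {σ τ : GSub X Y} → proj₁ (proj₁ σ) ≡ proj₁ (proj₁ τ) → proj₂ (proj₁ σ) ≡ proj₂ (proj₁ τ) → σ ≡ τ
  GSub≡ {Y = _ , v} e e' = Σ≡ (λ { (σ , cs) → Ok-prop v cs σ }) (cong₂ _,_ e e')

  GTy : GCon → Set
  GTy (Γ , v) = Σ TyG (λ j → Sub Γ (cT j))

  ⌊_⌋ : ∀ {Γ} → Σ TyG (λ j → Sub Γ (cT j)) → Ty Γ
  ⌊ j , σ ⌋ = nT j [ σ ]T

  _[_]G : ∀ {X Y} → GTy X → GSub Y X → GTy Y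
  (j , τ) [ (σ , _) , _ ]G = j , τ ∘ σ

  ⌊[]⌋ : ∀ {X Y} (a : GTy X) (σ : GSub Y X) → ⌊ _[_]G {X} {Y} a σ ⌋ ≡ ⌊ a ⌋ [ proj₁ (proj₁ σ) ]T
  ⌊[]⌋ (j , τ) σ = [∘]T (nT j) τ _

  -- The term of `C` is not stored: the cover already determines it together with its type, and
  -- `tmOf` recovers it.
  GTm : (X : GCon) → GTy X → Set
  GTm (Γ , v) a = Σ (Cov v) (λ c → proj₁ ⟦ c ⟧ ≡ ⌊ a ⌋)

  GTm≡ : ∀ {X a} {t u : GTm X a} → proj₁ t ≡ proj₁ u → t ≡ u
  GTm≡ = Σ≡ (λ _ → uip)

  GTm-subst : ∀ {X a b} (e : a ≡ b) (t : GTm X a) → proj₁ (subst (GTm X) e t) ≡ proj₁ t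
  GTm-subst refl t = refl

  Gp : ∀ {X} (a : GTy X) → GSub (proj₁ X ▹ ⌊ a ⌋ , proj₂ X ▹ᵛ ⌊ a ⌋) X
  Gp {_ , v} a = (p , tabulate (λ x → inj₁ (old x))) , tab-ok v (λ x → refl)

  Gp-map : ∀ {X Y} (a : GTy X) (σ : GSub Y (proj₁ X ▹ ⌊ a ⌋ , proj₂ X ▹ᵛ ⌊ a ⌋)) →
           mapV {v = proj₂ X ▹ᵛ ⌊ a ⌋} (proj₂ (proj₁ (Gp a))) (proj₁ σ) ≡ proj₁ (proj₂ (proj₁ σ))
  Gp-map a ((σ , cs , c) , o) = trans (map-tab old _) (tab-look cs)

  G∘ : ∀ {X Y Z} → GSub Y X → GSub Z Y → GSub Z X
  G∘ {_ , v} ((σ , cs) , o) ((δ , ds) , o') = (σ ∘ δ , mapV cs (δ , ds)) , map-ok v o o'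

  Gpair : ∀ {X Y} (a : GTy X) (σ : GSub Y X) → GTm Y (_[_]G {X} {Y} a σ) → GSub Y (proj₁ X ▹ ⌊ a ⌋ , proj₂ X ▹ᵛ ⌊ a ⌋)
  Gpair {X} {Y} a ((σ , cs) , o) (c , e) =
    (pairP ⌊ a ⌋ σ ⟦ c ⟧ e' , cs , c) ,
    subst (Ok (proj₂ X) cs) (sym (p-pairP ⌊ a ⌋ σ ⟦ c ⟧ e')) o , sym (Q-pairP ⌊ a ⌋ σ ⟦ c ⟧ e')
    where
    e' : proj₁ ⟦ c ⟧ ≡ ⌊ a ⌋ [ σ ]T
    e' = trans e (⌊[]⌋ {X} {Y} a ((σ , cs) , o))

  G[]t : ∀ {X Y} {a : GTy X} → GTm X a → (σ : GSub Y X) → GTm Y (_[_]G {X} {Y} a σ)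
  G[]t {X} {Y} {a} (c , e) ((σ , cs) , o) =
    c [ σ , cs ]c , trans (cong proj₁ ([]c-ok o c)) (trans (cong (_[ σ ]T) e) (sym (⌊[]⌋ {X} {Y} a ((σ , cs) , o))))

  G[id]T : ∀ {X} (a : GTy X) → (proj₁ a , proj₂ a ∘ id) ≡ a
  G[id]T (j , τ) = cong (j ,_) (idr τ)

  G[∘]T : ∀ {X Y Z} (a : GTy X) (σ : GSub Y X) (δ : GSub Z Y) →
          _[_]G {X} {Z} a (G∘ {X} {Y} {Z} σ δ) ≡ _[_]G {Y} {Z} (_[_]G {X} {Y} a σ) δ
  G[∘]T (j , τ) ((σ , _) , _) ((δ , _) , _) = cong (j ,_) (sym (ass τ σ δ))

  Gq : ∀ {X} (a : GTy X) → GTm (proj₁ X ▹ ⌊ a ⌋ , proj₂ X ▹ᵛ ⌊ a ⌋) (_[_]G {X} {proj₁ X ▹ ⌊ a ⌋ , proj₂ X ▹ᵛ ⌊ a ⌋} a (Gp {X} a))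
  Gq {X} a = inj₁ new , sym (⌊[]⌋ {X} a (Gp {X} a))

  Gp∘ : ∀ {X Y} (a : GTy X) (σ : GSub Y X) (t : GTm Y (_[_]G {X} {Y} a σ)) →
        G∘ {X} {proj₁ X ▹ ⌊ a ⌋ , proj₂ X ▹ᵛ ⌊ a ⌋} {Y} (Gp {X} a) (Gpair {X} {Y} a σ t) ≡ σ
  Gp∘ {X} {Y} a σ t = GSub≡ (p-pairP ⌊ a ⌋ _ ⟦ proj₁ t ⟧ _) (Gp-map {X} {Y} a (Gpair {X} {Y} a σ t))

  G : CwF
  G .CwF.Con = GCon
  G .CwF.Sub = GSub
  G .CwF.Sub-set = uip
  G .CwF.id {_ , v} = (id , idV) , tab-ok v (λ x → sym ([id]P ⟦ x ⟧v))
  G .CwF._∘_ = G∘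
  G .CwF.idl {X} {Y} ((σ , cs) , o) = GSub≡ {Y} {X} (idl σ) (trans (map-tab (λ x → x) _) (tab-look cs))
  G .CwF.idr ((σ , cs) , o) = GSub≡ (idr σ) (map-id cs)
  G .CwF.ass ((σ , cs) , _) ((δ , ds) , _) ((ν , ns) , _) = GSub≡ (ass σ δ ν) (sym (map-∘ δ ds ν ns cs))
  G .CwF.◇ = ◇ , ◇ᵛ
  G .CwF.ε = (ε , tt) , tt
  G .CwF.◇η {X} ((σ , _) , _) = GSub≡ {X} {◇ , ◇ᵛ} (◇η σ) refl
  G .CwF.Ty = GTy
  G .CwF.Ty-set = uip
  G .CwF._[_]T {X} {Y} = _[_]G {X} {Y}
  G .CwF.[id]T {X} = G[id]T {X}
  G .CwF.[∘]T {X} {Y} {Z} = G[∘]T {X} {Y} {Z}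
  G .CwF.Tm = GTm
  G .CwF.Tm-set = uip
  G .CwF._[_]t {X} {Y} {a} = G[]t {X} {Y} {a}
  G .CwF.[id]t {X} {a} t@(c , _) = GTm≡ {X} {a} (trans (GTm-subst {X} (G[id]T {X} a) _) ([]c-id c))
  G .CwF.[∘]t {X} {Y} {Z} {a} (c , _) ss@((σ , cs) , _) dd@((δ , ds) , _) =
    GTm≡ {Z} (trans (GTm-subst {Z} (G[∘]T {X} {Y} {Z} a ss dd) _) ([]c-∘ σ cs δ ds c))
  G .CwF._▹_ (Γ , v) a = Γ ▹ ⌊ a ⌋ , v ▹ᵛ ⌊ a ⌋
  G .CwF.p {X} {a} = Gp {X} a
  G .CwF.q {X} {a} = Gq {X} a
  G .CwF.⟨_,_⟩ {X} {Y} {a} = Gpair {X} {Y} a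
  G .CwF.p∘⟨⟩ {X} {Y} = Gp∘ {X} {Y}
  G .CwF.q[⟨⟩] {X} {Y} a σ t = GTm≡ {Y}
    (GTm-subst {Y} (trans (sym (G[∘]T {X} {proj₁ X ▹ ⌊ a ⌋ , proj₂ X ▹ᵛ ⌊ a ⌋} {Y} a (Gp {X} a) (Gpair {X} {Y} a σ t)))
                          (cong (λ σ → _[_]G {X} {Y} a σ) (Gp∘ {X} {Y} a σ t))) _)
  G .CwF.⟨⟩η {X} {Y} a τ@((σ , cs , c) , o , e) =
    GSub≡ (pairP-η ⌊ a ⌋ σ _ _ (trans (cong ⟦_⟧ eq) e)) (cong₂ _,_ (Gp-map {X} {Y} a τ) eq)
    where
    t' : GTm Y (_[_]G {_ , _} {Y} (_[_]G {X} {_ , _} a (Gp {X} a)) τ)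
    t' = G[]t {_ , _} {Y} (Gq {X} a) τ
    eq : proj₁ (subst (GTm Y) (sym (G[∘]T {X} {_ , _} {Y} a (Gp {X} a) τ)) t') ≡ c
    eq = GTm-subst {Y} (sym (G[∘]T {X} {_ , _} {Y} a (Gp {X} a) τ)) t'

  tmOf : ∀ {X a} → GTm X a → Tm (proj₁ X) ⌊ a ⌋
  tmOf (c , e) = subst (Tm _) e (proj₂ ⟦ c ⟧)

  tmOf-≡ : ∀ {X a} (t : GTm X a) → (⌊ a ⌋ , tmOf {X} t) ≡ ⟦ proj₁ t ⟧
  tmOf-≡ (c , e) = subst-pair e _

  π : Mor G C
  π .raw .F₀ = proj₁
  π .raw .F₁ σ = proj₁ (proj₁ σ)
  π .raw .FT {X} = ⌊_⌋
  π .raw .Ft {X} = tmOf {X}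
  π .laws .MorLaws.F-id = refl
  π .laws .MorLaws.F-∘ _ _ = refl
  π .laws .MorLaws.F-◇ = refl
  π .laws .MorLaws.F-[]T {X} {Y} a σ = ⌊[]⌋ {X} {Y} a σ
  π .laws .MorLaws.F-[]t {X} {Y} {a} t@(c , e) ss@((σ , cs) , o) =
    ≡-subst (⌊[]⌋ {X} {Y} a ss)
      (trans (tmOf-≡ {Y} (G[]t {X} {Y} {a} t ss)) (trans ([]c-ok o c) (cong (_[ σ ]P) (sym (tmOf-≡ {X} t)))))
  π .laws .MorLaws.F-▹ {X} a =
    cong (λ z → _ , p , z) (≡-subst (⌊[]⌋ {X} a (Gp {X} a)) (tmOf-≡ {(_ , proj₂ X ▹ᵛ ⌊ a ⌋)} {_[_]G {X} {_ , proj₂ X ▹ᵛ ⌊ a ⌋} a (Gp {X} a)} (inj₁ new , sym (⌊[]⌋ {X} a (Gp {X} a)))))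

-- Composition and equality of morphisms of CwFs

open MorLaws
open RawEq

RawEq-trans : ∀ {C D} {F G H : RawMor C D} → RawEq F G → RawEq G H → RawEq F H
RawEq-trans e e' .eq₀ Γ = trans (eq₀ e Γ) (eq₀ e' Γ)
RawEq-trans e e' .eq₁ σ = trans (eq₁ e σ) (eq₁ e' σ)
RawEq-trans e e' .eqT A = trans (eqT e A) (eqT e' A)
RawEq-trans e e' .eqt t = trans (eqt e t) (eqt e' t)

RawEq-refl : ∀ {C D} {F : RawMor C D} → RawEq F F
RawEq-refl .eq₀ Γ = refl
RawEq-refl .eq₁ σ = refl
RawEq-refl .eqT A = refl
RawEq-refl .eqt t = refl

RawEq-sym : ∀ {C D} {F G : RawMor C D} → RawEq F G → RawEq G F
RawEq-sym e .eq₀ Γ = sym (eq₀ e Γ)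
RawEq-sym e .eq₁ σ = sym (eq₁ e σ)
RawEq-sym e .eqT A = sym (eqT e A)
RawEq-sym e .eqt t = sym (eqt e t)

⊙-congˡ : ∀ {C D E} {F G : RawMor C D} → RawEq F G → (H : RawMor D E) → RawEq (F ⊙ H) (G ⊙ H)
⊙-congˡ e H .eq₀ Γ = cong (F₀ H) (eq₀ e Γ)
⊙-congˡ e H .eq₁ σ = cong (λ { (X , Y , f) → F₀ H X , F₀ H Y , F₁ H f }) (eq₁ e σ)
⊙-congˡ e H .eqT A = cong (λ { (X , B) → F₀ H X , FT H B }) (eqT e A)
⊙-congˡ e H .eqt t = cong (λ { (X , B , b) → F₀ H X , FT H B , Ft H b }) (eqt e t)

module MorKit {C D : CwF} (F : Mor C D) where
  private
    module C = Kit C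
    module D = Kit D

  FP : ∀ {Γ} → C.PTm Γ → D.PTm (F₀ (raw F) Γ)
  FP (A , t) = FT (raw F) A , Ft (raw F) t

  FP-[] : ∀ {Γ Δ} (P : C.PTm Γ) (σ : C.Sub Δ Γ) → FP (P C.[ σ ]P) ≡ FP P D.[ F₁ (raw F) σ ]P
  FP-[] (A , t) σ = subst-≡ (F-[]T (laws F) A σ) (F-[]t (laws F) t σ)

  Ext : D.Con → Set
  Ext X = Σ D.Con (λ Y → D.Sub Y X × D.PTm Y)

  FP-▹ : ∀ {Γ} (A : C.Ty Γ) →
         _≡_ {A = Ext (F₀ (raw F) Γ)}
           (F₀ (raw F) (Γ C.▹ A) , F₁ (raw F) C.p , FP (C.Q A))
           (F₀ (raw F) Γ D.▹ FT (raw F) A , D.p , D.Q (FT (raw F) A))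
  FP-▹ {Γ} A = trans (cong (λ z → F₀ (raw F) (Γ C.▹ A) , F₁ (raw F) C.p , z) (subst-≡ (F-[]T (laws F) A C.p) refl))
                 (cong (λ { (X , f , t) → X , f , FT (raw F) A D.[ f ]T , t }) (F-▹ (laws F) A))

_⊙ᴹ_ : ∀ {C D E} → Mor C D → Mor D E → Mor C E
(F ⊙ᴹ G) .raw = raw F ⊙ raw G
_⊙ᴹ_ {C} {D} {E} F G .laws = L
  where
  module C = Kit C
  module D = Kit D
  module E = Kit E
  module MF = MorKit F
  module MG = MorKit G
  []T : ∀ {Γ Δ} (A : C.Ty Γ) (σ : C.Sub Δ Γ) → _
  []T A σ = trans (cong (FT (raw G)) (F-[]T (laws F) A σ)) (F-[]T (laws G) (FT (raw F) A) (F₁ (raw F) σ))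
  mid : ∀ {Γ} {X Y : D.Con} {f : D.Sub X Γ} {g : D.Sub Y Γ} {P : D.PTm X} {P' : D.PTm Y} →
        _≡_ {A = MF.Ext Γ} (X , f , P) (Y , g , P') →
        _≡_ {A = MG.Ext (F₀ (raw G) Γ)} (F₀ (raw G) X , F₁ (raw G) f , MG.FP P) (F₀ (raw G) Y , F₁ (raw G) g , MG.FP P')
  mid refl = refl
  fold : ∀ {X Y Z : E.Con} {f : E.Sub X Z} {g : E.Sub Y Z} {A : E.Ty Z} {T : E.Ty X} {t : E.Tm X T} {u : E.Tm Y (A E.[ g ]T)} →
         _≡_ {A = MG.Ext Z} (X , f , T , t) (Y , g , A E.[ g ]T , u) → (e : T ≡ A E.[ f ]T) →
         _≡_ {A = Σ E.Con (λ X → Σ (E.Sub X Z) (λ f → E.Tm X (A E.[ f ]T)))} (X , f , subst (E.Tm X) e t) (Y , g , u)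
  fold refl e rewrite uip e refl = refl
  L : MorLaws (raw F ⊙ raw G)
  L .F-id = trans (cong (F₁ (raw G)) (F-id (laws F))) (F-id (laws G))
  L .F-∘ σ δ = trans (cong (F₁ (raw G)) (F-∘ (laws F) σ δ)) (F-∘ (laws G) _ _)
  L .F-◇ = trans (cong (F₀ (raw G)) (F-◇ (laws F))) (F-◇ (laws G))
  L .F-[]T = []T
  L .F-[]t {A = A} t σ =
    ≡-subst ([]T A σ) (trans (cong MG.FP (MF.FP-[] (A , t) σ)) (MG.FP-[] (MF.FP (A , t)) (F₁ (raw F) σ)))
  L .F-▹ A = fold (trans (mid (MF.FP-▹ A)) (MG.FP-▹ (FT (raw F) A))) ([]T A C.p)

-- Maps out of a cellular CwF and the decompositions they give

module Induction {C : CwF} (cell : IsCellularCwF C) where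
  open IsCellularCwF cell
  private
    module B (n : ℕ) = BasicCellular (basic n)

  -- Data for defining a map C → E along the chain Ch; the invariant Inv may be used
  -- to interpret the generators of the next stage.
  record Algebra (E : CwF) : Set₁ where
    field
      Inv   : ∀ n → Mor (Ch n) E → Set
      inv₀  : Inv 0 (IsInitial.! init E)
      algT  : ∀ n (g : Mor (Ch n) E) → Inv n g → (j : B.Jty n) → CwF.Ty E (F₀ (raw g) (B.ctxTy n j))
      algt  : ∀ n (g : Mor (Ch n) E) → Inv n g → (k : B.Jtm n) → CwF.Tm E (F₀ (raw g) (B.ctxTm n k)) (FT (raw g) (B.tyTm n k))
      invˢ  : ∀ n g i h → B.Factors n g (algT n g i) (algt n g i) h → Inv (suc n) h

  module _ {E : CwF} (alg : Algebra E) where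
    open Algebra alg
    stage : ∀ n → Σ (Mor (Ch n) E) (Inv n)
    stageStep : ∀ n → Σ (Mor (Ch (suc n)) E) (B.Factors n (proj₁ (stage n)) (algT n _ (proj₂ (stage n))) (algt n _ (proj₂ (stage n))))
    stage zero    = _ , inv₀
    stage (suc n) = proj₁ (stageStep n) , invˢ n _ (proj₂ (stage n)) _ (proj₂ (stageStep n))
    stageStep n = B.univ n E (proj₁ (stage n)) _ _

    stage-comm : ∀ n → RawEq (raw (step n) ⊙ raw (proj₁ (stage (suc n)))) (raw (proj₁ (stage n)))
    stage-comm n = proj₁ (proj₂ (stageStep n))

    elim : Σ (Mor C E) (λ h → ∀ n → RawEq (raw (ι n) ⊙ raw h) (raw (proj₁ (stage n))))
    elim = colim E (λ n → proj₁ (stage n)) stage-comm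

  Name : Set
  Name = (Σ ℕ B.Jty) ⊎ (Σ ℕ B.Jtm)

  open Raw Name public

  TyG TmG : Set
  TyG = Σ ℕ B.Jty
  TmG = Σ ℕ B.Jtm

  cT : TyG → CwF.Con C
  cT (n , j) = F₀ (raw (ι (suc n))) (F₀ (raw (step n)) (B.ctxTy n j))
  nT : (j : TyG) → CwF.Ty C (cT j)
  nT (n , j) = FT (raw (ι (suc n))) (B.newTy n j)
  cM : TmG → CwF.Con C
  cM (n , k) = F₀ (raw (ι (suc n))) (F₀ (raw (step n)) (B.ctxTm n k))
  nM : (k : TmG) → Σ (CwF.Ty C (cM k)) (CwF.Tm C (cM k))
  nM (n , k) = FT (raw (ι (suc n))) (FT (raw (step n)) (B.tyTm n k)) , Ft (raw (ι (suc n))) (B.newTm n k)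

  -- A generator is interpreted as its name applied to all variables of its context, so that its
  -- instance along `σ` becomes the name applied to the tree list of `σ` (`rT-gen`, `rP-gen`).
  generic : Name → ℕ → RTm
  generic k d = con k (idR d)

  generic-sc : ∀ k d → generic k d [ idR d ] ≡ generic k d
  generic-sc k d = cong (con k) (idR-sc d)

  record InvR n (h : Mor (Ch (suc n)) RawCwF) : Set where
    field
      invT : ∀ j → proj₁ (FT (raw h) (B.newTy n j)) ≡ generic (inj₁ (n , j)) (F₀ (raw h) (F₀ (raw (step n)) (B.ctxTy n j)))
      invt : ∀ k → proj₁ (Ft (raw h) (B.newTm n k)) ≡ generic (inj₂ (n , k)) (F₀ (raw h) (F₀ (raw (step n)) (B.ctxTm n k)))

  rawAlg : Algebra RawCwF
  rawAlg .Algebra.Inv zero    _ = ⊤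
  rawAlg .Algebra.Inv (suc n) h = InvR n h
  rawAlg .Algebra.inv₀ = tt
  rawAlg .Algebra.algT n g _ j = generic (inj₁ (n , j)) _ , generic-sc _ _
  rawAlg .Algebra.algt n g _ k = generic (inj₂ (n , k)) _ , generic-sc _ _
  rawAlg .Algebra.invˢ n g _ h (_ , fT , ft) = record
    { invT = λ j → subst (λ { (X , t) → proj₁ t ≡ generic (inj₁ (n , j)) X }) (sym (fT j)) refl
    ; invt = λ k → subst (λ { (X , _ , t) → proj₁ t ≡ generic (inj₂ (n , k)) X }) (sym (ft k)) refl }

  abstract
    er : Mor C RawCwF
    er = proj₁ (elim rawAlg)

    er-nT : ∀ j → proj₁ (FT (raw er) (nT j)) ≡ generic (inj₁ j) (F₀ (raw er) (cT j))
    er-nT (n , j) = subst (λ { (X , t) → proj₁ t ≡ generic (inj₁ (n , j)) X })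
      (sym (eqT (proj₂ (elim rawAlg) (suc n)) (B.newTy n j)))
      (InvR.invT (proj₂ (stage rawAlg (suc n))) j)

    er-nM : ∀ k → proj₁ (Ft (raw er) (proj₂ (nM k))) ≡ generic (inj₂ k) (F₀ (raw er) (cM k))
    er-nM (n , k) = subst (λ { (X , _ , t) → proj₁ t ≡ generic (inj₂ (n , k)) X })
      (sym (eqt (proj₂ (elim rawAlg) (suc n)) (B.newTm n k)))
      (InvR.invt (proj₂ (stage rawAlg (suc n))) k)

  open Glue C TyG cT nT TmG cM nM public
  open Kit C

  -- The invariant, that `g` followed by `π` is `ι n`, identifies the context underneath `g` with
  -- the context of the generator in `C`, so that the generator can be presented as itself under the
  -- identity substitution. The uniqueness half of the pushout property carries the invariant to the
  -- next stage.
  glueAlg : Algebra G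
  glueAlg .Algebra.Inv n g = RawEq (raw g ⊙ raw π) (raw (ι n))
  glueAlg .Algebra.inv₀ = IsInitial.uniq init C (IsInitial.! init G ⊙ᴹ π) (ι 0)
  glueAlg .Algebra.algT n g i j = (n , j) , subst (λ X → Sub X (cT (n , j))) (sym e) id
    where
    e : proj₁ (F₀ (raw g) (B.ctxTy n j)) ≡ cT (n , j)
    e = trans (eq₀ i _) (sym (eq₀ (ι-comm n) _))
  glueAlg .Algebra.algt n g i k = inj₂ ((n , k) , subst (λ X → Sub X (cM (n , k))) (sym e) id) ,
                                  lem _ (trans (eqT (ι-comm n) _) (sym (eqT i _)))
    where
    e : proj₁ (F₀ (raw g) (B.ctxTm n k)) ≡ cM (n , k)
    e = trans (eq₀ i _) (sym (eq₀ (ι-comm n) _))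
    lem : ∀ {Γ} {B : Ty Γ} (e : Γ ≡ cM (n , k)) → (cM (n , k) , proj₁ (nM (n , k))) ≡ (Γ , B) →
          proj₁ (nM (n , k)) [ subst (λ X → Sub X (cM (n , k))) (sym e) id ]T ≡ B
    lem refl refl = [id]T _
  glueAlg .Algebra.invˢ n g i h (fac , fT , ft) =
    BasicCellular.uniq (basic n) C (step n ⊙ᴹ ι (suc n)) (λ j → nT (n , j)) (λ k → proj₂ (nM (n , k)))
      (h ⊙ᴹ π) (ι (suc n))
      ( RawEq-trans (⊙-congˡ fac (raw π)) (RawEq-trans i (RawEq-sym (ι-comm n)))
      , (λ j → trans (cong (λ { (X , a) → proj₁ X , ⌊ a ⌋ }) (fT j)) (lemT (trans (eq₀ i _) (sym (eq₀ (ι-comm n) _)))))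
      , (λ k → trans (cong (λ { (X , a , t) → proj₁ X , ⌊ a ⌋ , tmOf {X} {a} t }) (ft k))
                 (trans (cong (_ ,_) (tmOf-≡ {F₀ (raw g) (B.ctxTm n k)} (Algebra.algt glueAlg n g i k)))
                        (lemt (trans (eq₀ i _) (sym (eq₀ (ι-comm n) _)))))) )
      (RawEq-refl , (λ _ → refl) , (λ _ → refl))
    where
    lemT : ∀ {Γ j} (e : Γ ≡ cT j) → _≡_ {A = Σ Con Ty} (Γ , nT j [ subst (λ X → Sub X (cT j)) (sym e) id ]T) (cT j , nT j)
    lemT refl = cong (_ ,_) ([id]T _)
    lemt : ∀ {Γ k} (e : Γ ≡ cM k) → _≡_ {A = Σ Con PTm} (Γ , nM k [ subst (λ X → Sub X (cM k)) (sym e) id ]P) (cM k , nM k)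
    lemt refl = cong (_ ,_) ([id]P _)

  idRaw : RawMor C C
  idRaw .F₀ Γ = Γ
  idRaw .F₁ σ = σ
  idRaw .FT A = A
  idRaw .Ft t = t

  idMor : Mor C C
  idMor .raw = idRaw
  idMor .laws .F-id = refl
  idMor .laws .F-∘ σ δ = refl
  idMor .laws .F-◇ = refl
  idMor .laws .F-[]T A σ = refl
  idMor .laws .F-[]t t σ = refl
  idMor .laws .F-▹ A = refl

  abstract
    sec : Mor C G
    sec = proj₁ (elim glueAlg)

    -- `sec ⊙ᴹ π` and the identity both extend the cocone `ι`, so uniqueness of maps out of the
    -- colimit identifies them. As `sec` is a section of `π`, whatever holds of the gluing by
    -- construction descends to `C`.
    sec-π : RawEq (raw sec ⊙ raw π) idRaw
    sec-π = colim-uniq C ι ι-comm (sec ⊙ᴹ π) idMor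
      (λ n → RawEq-trans (⊙-congˡ (proj₂ (elim glueAlg) n) (raw π)) (proj₂ (stage glueAlg n)))
      (λ n → RawEq-refl)

    -- In particular every context of `C` is an iterated extension of `◇`.
    vcon : ∀ Γ → VCon Γ
    vcon Γ = subst VCon (eq₀ sec-π Γ) (proj₂ (F₀ (raw sec) Γ))

    coverT : ∀ {Γ} (A : Ty Γ) → Σ (Σ TyG (λ j → Sub Γ (cT j))) (λ a → ⌊ a ⌋ ≡ A)
    coverT A = lem _ (eqT sec-π A)
      where
      lem : ∀ {Γ Γ'} (a : Σ TyG (λ j → Sub Γ' (cT j))) {A : Ty Γ} → (Γ' , ⌊ a ⌋) ≡ (Γ , A) →
            Σ (Σ TyG (λ j → Sub Γ (cT j))) (λ a → ⌊ a ⌋ ≡ A)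
      lem a refl = a , refl

    coverP : ∀ {Γ} (P : PTm Γ) → Σ (Cov (vcon Γ)) (λ c → ⟦ c ⟧ ≡ P)
    coverP {Γ} (A , t) =
      lem (eq₀ sec-π Γ) (proj₁ (Ft (raw sec) t)) (trans (cong (_ ,_) (sym (tmOf-≡ {F₀ (raw sec) Γ} (Ft (raw sec) t)))) (eqt sec-π t))
      where
      lem : ∀ {Γ'} {v : VCon Γ'} (e : Γ' ≡ Γ) (c : Cov v) {P : PTm Γ} → _≡_ {A = Σ Con PTm} (Γ' , ⟦ c ⟧) (Γ , P) →
            Σ (Cov (subst VCon e v)) (λ c → ⟦ c ⟧ ≡ P)
      lem refl c refl = c , refl

-- Detecting occurrences of variables by junk

module RawNj (K : Set) where
  open Raw K

  -- nj t says that junk does not occur in t.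
  nj  : RTm → Bool
  njS : RSub → Bool
  nj (var i)   = true
  nj (con k s) = njS s
  nj junk      = false
  njS []      = true
  njS (t ∷ s) = nj t ∧ njS s

  ∧-true : ∀ {a b} → a ∧ b ≡ true → a ≡ true × b ≡ true
  ∧-true {true} {true} refl = refl , refl

  nj-[]  : ∀ t s → nj (t [ s ]) ≡ true → nj t ≡ true
  njS-⊚ : ∀ r s → njS (r ⊚ s) ≡ true → njS r ≡ true
  nj-[] (var i)   s e = refl
  nj-[] (con k r) s e = njS-⊚ r s e
  njS-⊚ []      s e = refl
  njS-⊚ (t ∷ r) s e = cong₂ _∧_ (nj-[] t s (proj₁ (∧-true e))) (njS-⊚ r s (proj₂ (∧-true e)))

  lookup-vars : ∀ k d i → i < d → lookup i (vars k d) ≡ var (k + i)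
  lookup-vars k (suc d) zero    _       = cong var (sym (+-identityʳ k))
  lookup-vars k (suc d) (suc i) (s≤s h) = trans (lookup-vars (suc k) d i h) (cong var (sym (+-suc k i)))

  lookup-< : ∀ d s i → length s ≡ d → nj (lookup i s) ≡ true → i < d
  lookup-< _ (t ∷ s) zero    refl h = s≤s z≤n
  lookup-< _ (t ∷ s) (suc i) refl h = s≤s (lookup-< _ s i refl h)

  var-sc : ∀ d i → var i [ idR d ] ≡ var i → i < d
  var-sc d i e = lookup-< d (idR d) i (length-vars 0 d) (cong nj e)

  nj-lookup : ∀ i s → njS s ≡ true → i < length s → nj (lookup i s) ≡ true
  nj-lookup zero    (t ∷ s) e h       = proj₁ (∧-true e)
  nj-lookup (suc i) (t ∷ s) e (s≤s h) = nj-lookup i s (proj₂ (∧-true e)) h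

  con-inj : ∀ {k k' s s'} → con k s ≡ con k' s' → k ≡ k' × s ≡ s'
  con-inj refl = refl , refl

  ∷-inj : ∀ {t t' s s'} → t ∷ s ≡ t' ∷ s' → t ≡ t' × s ≡ s'
  ∷-inj refl = refl , refl

  var-inj : ∀ {i j} → var i ≡ var j → i ≡ j
  var-inj refl = refl

  -- kill i d sends the variable i to junk and fixes the other d − 1 variables.
  kill : ℕ → ℕ → RSub
  kill _       zero    = []
  kill zero    (suc d) = junk ∷ wk d
  kill (suc i) (suc d) = var 0 ∷ kill i d ⊚ wk d

  length-kill : ∀ i d → length (kill i d) ≡ d
  length-kill i       zero    = refl
  length-kill zero    (suc d) = cong suc (length-vars 1 d)
  length-kill (suc i) (suc d) = cong suc (trans (length-⊚ (kill i d) (wk d)) (length-kill i d))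

  nj-sub  : ∀ {g} t s → njS s ≡ true → length s ≡ g → t [ idR g ] ≡ t → nj t ≡ true → nj (t [ s ]) ≡ true
  njS-sub : ∀ {g} r s → njS s ≡ true → length s ≡ g → r ⊚ idR g ≡ r → njS r ≡ true → njS (r ⊚ s) ≡ true
  nj-sub (var i)   s ns refl e n = nj-lookup i s ns (var-sc _ i e)
  nj-sub (con k r) s ns l    e n = njS-sub r s ns l (proj₂ (con-inj e)) n
  njS-sub []      s ns l e n = refl
  njS-sub (t ∷ r) s ns l e n =
    cong₂ _∧_ (nj-sub t s ns l (proj₁ (∷-inj e)) (proj₁ (∧-true n)))
              (njS-sub r s ns l (proj₂ (∷-inj e)) (proj₂ (∧-true n)))

-- Trees determine types, terms and substitutions

module Core {C : CwF} (cell : IsCellularCwF C) where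
  open Induction cell public
  open RawNj Name public
  open Kit C public

  private
    module ME = MorKit er

  len : Con → ℕ
  len = F₀ (raw er)

  rT : ∀ {Γ} → Ty Γ → RTm
  rT A = proj₁ (FT (raw er) A)

  rP : ∀ {Γ} → PTm Γ → RTm
  rP P = proj₁ (Ft (raw er) (proj₂ P))

  rS : ∀ {Δ Γ} → Sub Δ Γ → RSub
  rS σ = proj₁ (F₁ (raw er) σ)

  abstract
    rT-[] : ∀ {Γ Δ} (A : Ty Γ) (σ : Sub Δ Γ) → rT (A [ σ ]T) ≡ rT A [ rS σ ]
    rT-[] A σ = cong proj₁ (F-[]T (laws er) A σ)

    rP-[] : ∀ {Γ Δ} (P : PTm Γ) (σ : Sub Δ Γ) → rP (P [ σ ]P) ≡ rP P [ rS σ ]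
    rP-[] P σ = cong (λ z → proj₁ (proj₂ z)) (ME.FP-[] P σ)

    rS-id : ∀ {Γ} → rS (id {Γ}) ≡ idR (len Γ)
    rS-id = cong proj₁ (F-id (laws er))

    rS-∘ : ∀ {Γ Δ Θ} (σ : Sub Δ Γ) (δ : Sub Θ Δ) → rS (σ ∘ δ) ≡ rS σ ⊚ rS δ
    rS-∘ σ δ = cong proj₁ (F-∘ (laws er) σ δ)

    len-◇ : len ◇ ≡ 0
    len-◇ = F-◇ (laws er)

    len-▹ : ∀ {Γ} (A : Ty Γ) → len (Γ ▹ A) ≡ suc (len Γ)
    len-▹ A = cong proj₁ (ME.FP-▹ A)

    rS-p : ∀ {Γ} (A : Ty Γ) → rS (p {Γ} {A}) ≡ wk (len Γ)
    rS-p A = cong (λ z → proj₁ (proj₁ (proj₂ z))) (ME.FP-▹ A)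

    rP-Q : ∀ {Γ} (A : Ty Γ) → rP (Q A) ≡ var 0
    rP-Q A = cong (λ z → proj₁ (proj₂ (proj₂ (proj₂ z)))) (ME.FP-▹ A)

    rS-length : ∀ {Δ Γ} (σ : Sub Δ Γ) → length (rS σ) ≡ len Γ
    rS-length σ = proj₁ (proj₂ (F₁ (raw er) σ))

    rS-sc : ∀ {Δ Γ} (σ : Sub Δ Γ) → rS σ ⊚ idR (len Δ) ≡ rS σ
    rS-sc σ = proj₂ (proj₂ (F₁ (raw er) σ))

    rP-sc : ∀ {Γ} (P : PTm Γ) → rP P [ idR (len Γ) ] ≡ rP P
    rP-sc P = proj₂ (Ft (raw er) (proj₂ P))

    rT-sc : ∀ {Γ} (A : Ty Γ) → rT A [ idR (len Γ) ] ≡ rT A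
    rT-sc A = proj₂ (FT (raw er) A)

    rT-gen : ∀ {Γ} j (σ : Sub Γ (cT j)) → rT (nT j [ σ ]T) ≡ con (inj₁ j) (rS σ)
    rT-gen j σ = trans (rT-[] (nT j) σ) (trans (cong (_[ rS σ ]) (er-nT j)) (cong (con (inj₁ j)) (idR-⊚ (rS σ) (rS-length σ))))

    rP-gen : ∀ {Γ} k (σ : Sub Γ (cM k)) → rP (nM k [ σ ]P) ≡ con (inj₂ k) (rS σ)
    rP-gen k σ = trans (rP-[] (nM k) σ) (trans (cong (_[ rS σ ]) (er-nM k)) (cong (con (inj₂ k)) (idR-⊚ (rS σ) (rS-length σ))))

  rS-▹ : ∀ {Γ Δ} (A : Ty Γ) (τ : Sub Δ (Γ ▹ A)) → rS τ ≡ rP (Q A [ τ ]P) ∷ rS (p ∘ τ)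
  rS-▹ {Γ} A τ = trans (go (rS τ) (trans (rS-length τ) (len-▹ A))) (sym (cong₂ _∷_ e₁ e₂))
    where
    e₁ : rP (Q A [ τ ]P) ≡ var 0 [ rS τ ]
    e₁ = trans (rP-[] (Q A) τ) (cong (_[ rS τ ]) (rP-Q A))
    e₂ : rS (p ∘ τ) ≡ wk (len Γ) ⊚ rS τ
    e₂ = trans (rS-∘ p τ) (cong (_⊚ rS τ) (rS-p A))
    go : ∀ s → length s ≡ suc (len Γ) → s ≡ lookup 0 s ∷ (wk (len Γ) ⊚ s)
    go (t ∷ s) l = cong (t ∷_) (sym (wk-∷ t s (suc-injective l)))

  rS-pairP : ∀ {Γ Δ} (A : Ty Γ) (σ : Sub Δ Γ) P e → rS (pairP A σ P e) ≡ rP P ∷ rS σ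
  rS-pairP A σ P e = trans (rS-▹ A (pairP A σ P e)) (cong₂ _∷_ (cong rP (Q-pairP A σ P e)) (cong rS (p-pairP A σ P e)))

  ⌜_⌝ : ∀ {Γ} {v : VCon Γ} → Var v → ℕ
  ⌜_⌝ {v = v ▹ᵛ A} new     = 0
  ⌜_⌝ {v = v ▹ᵛ A} (old x) = suc ⌜ x ⌝

  ⌜⌝-< : ∀ {Γ} (v : VCon Γ) (x : Var v) → ⌜ x ⌝ < len Γ
  ⌜⌝-< (v ▹ᵛ A) new     = subst (0 <_) (sym (len-▹ A)) (s≤s z≤n)
  ⌜⌝-< (v ▹ᵛ A) (old x) = subst (suc ⌜ x ⌝ <_) (sym (len-▹ A)) (s≤s (⌜⌝-< v x))

  ⌜⌝-inj : ∀ {Γ} (v : VCon Γ) (x y : Var v) → ⌜ x ⌝ ≡ ⌜ y ⌝ → x ≡ y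
  ⌜⌝-inj (v ▹ᵛ A) new     new     e = refl
  ⌜⌝-inj (v ▹ᵛ A) (old x) (old y) e = cong old (⌜⌝-inj v x y (suc-injective e))

  ⌜⌝-surj : ∀ {Γ} (v : VCon Γ) i → i < len Γ → Σ (Var v) (λ x → ⌜ x ⌝ ≡ i)
  ⌜⌝-surj ◇ᵛ i h with subst (i <_) len-◇ h
  ... | ()
  ⌜⌝-surj (v ▹ᵛ A) zero    h = new , refl
  ⌜⌝-surj (v ▹ᵛ A) (suc i) h with ⌜⌝-surj v i (≤-pred (subst (suc i <_) (len-▹ A) h))
  ... | x , e = old x , cong suc e

  rP-var : ∀ {Γ} (v : VCon Γ) (x : Var v) → rP ⟦ x ⟧v ≡ var ⌜ x ⌝
  rP-var (v ▹ᵛ A) new     = rP-Q A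
  rP-var (v ▹ᵛ A) (old x) =
    trans (rP-[] ⟦ x ⟧v p) (trans (cong₂ _[_] (rP-var v x) (rS-p A)) (lookup-vars 1 _ ⌜ x ⌝ (⌜⌝-< v x)))

  -- Trees forget types, but a variable carries its type and a generator with its arguments
  -- determines one. So the head of the tree, and recursively its arguments, recover the term
  -- together with its type.
  injP : ∀ r {Γ} (P P' : PTm Γ) → rP P ≡ r → rP P' ≡ r → P ≡ P'
  injC : ∀ r {Γ} (c c' : Cov (vcon Γ)) → rP ⟦ c ⟧ ≡ r → rP ⟦ c' ⟧ ≡ r → c ≡ c'
  injS : ∀ s {Γ Φ} (v : VCon Φ) (σ σ' : Sub Γ Φ) → rS σ ≡ s → rS σ' ≡ s → σ ≡ σ'
  injP r P P' e e' with coverP P | coverP P'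
  ... | c , refl | c' , refl = cong ⟦_⟧ (injC r c c' e e')
  injC r (inj₁ x) (inj₁ x') e e' =
    cong inj₁ (⌜⌝-inj (vcon _) x x' (var-inj (trans (sym (rP-var _ x)) (trans e (trans (sym e') (rP-var _ x'))))))
  injC r (inj₁ x) (inj₂ (k , τ)) e e' with trans (sym (rP-var _ x)) (trans e (trans (sym e') (rP-gen k τ)))
  ... | ()
  injC r (inj₂ (k , τ)) (inj₁ x) e e' with trans (sym (rP-var _ x)) (trans e' (trans (sym e) (rP-gen k τ)))
  ... | ()
  injC (con _ s) (inj₂ (k , τ)) (inj₂ (k' , τ')) e e'
    with con-inj (trans (sym (rP-gen k τ)) e) | con-inj (trans (sym (rP-gen k' τ')) e')
  ... | refl , h | refl , h' = cong (λ z → inj₂ (k , z)) (injS s (vcon _) τ τ' h h')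
  injC (var _) (inj₂ (k , τ)) (inj₂ (k' , τ')) e e' with trans (sym (rP-gen k τ)) e
  ... | ()
  injC junk (inj₂ (k , τ)) (inj₂ (k' , τ')) e e' with trans (sym (rP-gen k τ)) e
  ... | ()
  injS s ◇ᵛ σ σ' e e' = trans (◇η σ) (sym (◇η σ'))
  injS (t ∷ s) (v ▹ᵛ A) σ σ' e e'
    with ∷-inj (trans (sym (rS-▹ A σ)) e) | ∷-inj (trans (sym (rS-▹ A σ')) e')
  ... | h , i | h' , i' = ▹-ext A σ σ' (injS s v _ _ i i') (injP t _ _ h h')
  injS [] (v ▹ᵛ A) σ σ' e e' with trans (sym (rS-▹ A σ)) e
  ... | ()

  P-inj : ∀ {Γ} {P P' : PTm Γ} → rP P ≡ rP P' → P ≡ P'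
  P-inj {P' = P'} e = injP _ _ P' e refl

  S-inj : ∀ {Γ Φ} {σ σ' : Sub Γ Φ} → rS σ ≡ rS σ' → σ ≡ σ'
  S-inj {σ' = σ'} e = injS _ (vcon _) _ σ' e refl

  T-inj : ∀ {Γ} {A A' : Ty Γ} → rT A ≡ rT A' → A ≡ A'
  T-inj {A = A} {A'} e with coverT A | coverT A'
  ... | (j , σ) , refl | (j' , σ') , refl with con-inj (trans (sym (rT-gen j σ)) (trans e (rT-gen j' σ')))
  ... | refl , h = cong (nT j [_]T) (S-inj h)

  -- `coverP` speaks only of the presentation `vcon Γ`, and two presentations of the same context
  -- are not known to coincide. Variables are carried over by their index, which by `P-inj` names
  -- the same term.
  view : ∀ {Γ} (v : VCon Γ) (P : PTm Γ) → Σ (Cov v) (λ c → ⟦ c ⟧ ≡ P)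
  view v P with coverP P
  ... | inj₂ kτ , e = inj₂ kτ , e
  ... | inj₁ x  , e with ⌜⌝-surj v ⌜ x ⌝ (⌜⌝-< (vcon _) x)
  ...   | y , h = inj₁ y , trans (P-inj (trans (rP-var v y) (trans (cong var h) (sym (rP-var (vcon _) x))))) e

  -- Genuine terms contain no junk. Hence junk that appears after substituting `kill` or `V`
  -- witnesses an occurrence of a removed variable, and `nj` serves as the free-variable test.
  njP  : ∀ r {Γ} (P : PTm Γ) → rP P ≡ r → nj r ≡ true
  njSu : ∀ s {Γ Φ} (v : VCon Φ) (σ : Sub Γ Φ) → rS σ ≡ s → njS s ≡ true
  njP (var i) P e = refl
  njP (con k s) P e with coverP P
  ... | inj₁ x , refl with trans (sym (rP-var _ x)) e
  ...   | ()
  njP (con k s) P e | inj₂ (k' , τ) , refl = njSu s (vcon _) τ (proj₂ (con-inj (trans (sym (rP-gen k' τ)) e)))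
  njP junk P e with coverP P
  ... | inj₁ x , refl with trans (sym (rP-var _ x)) e
  ...   | ()
  njP junk P e | inj₂ (k' , τ) , refl with trans (sym (rP-gen k' τ)) e
  ... | ()
  njSu [] v σ e = refl
  njSu (t ∷ s) ◇ᵛ σ e with trans (sym (cong length e)) (trans (rS-length σ) len-◇)
  ... | ()
  njSu (t ∷ s) (v ▹ᵛ A) σ e with ∷-inj (trans (sym (rS-▹ A σ)) e)
  ... | h , i = cong₂ _∧_ (njP t _ h) (njSu s v _ i)

  nj-P : ∀ {Γ} (P : PTm Γ) → nj (rP P) ≡ true
  nj-P P = njP _ P refl

  nj-S : ∀ {Γ Φ} (σ : Sub Γ Φ) → njS (rS σ) ≡ true
  nj-S σ = njSu _ (vcon _) σ refl

  nj-T : ∀ {Γ} (A : Ty Γ) → nj (rT A) ≡ true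
  nj-T A with coverT A
  ... | (j , σ) , refl = trans (cong nj (rT-gen j σ)) (nj-S σ)

-- Elimination of a variable

module Elim {C : CwF} (cell : IsCellularCwF C) where
  open Core cell public

  Q-type : ∀ {Γ Δ} (B : Ty Γ) (τ : Sub Δ (Γ ▹ B)) → proj₁ (Q B [ τ ]P) ≡ B [ p ∘ τ ]T
  Q-type B τ = sym ([∘]T B p τ)

  -- f tests whether a term of Γ lives over Γ⁻, and ρ is a raw retraction of w.
  module Strengthen {Γ Γ⁻ : Con} (v : VCon Γ) (w : Sub Γ Γ⁻) (f ρ : RSub)
    (w-ρ : rS w ⊚ ρ ≡ idR (len Γ⁻))
    (w-f : ∀ (T : Ty Γ⁻) → nj (rT (T [ w ]T) [ f ]) ≡ true)
    (strV : ∀ (x : Var v) → nj (rP ⟦ x ⟧v [ f ]) ≡ true → nj (rT (proj₁ ⟦ x ⟧v) [ f ]) ≡ true →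
            Σ (PTm Γ⁻) (λ P → P [ w ]P ≡ ⟦ x ⟧v))
    where

    -- A one-sided inverse of `w` need not exist in `C`, as the removed variables may have
    -- uninhabited types. The raw one, which may use junk for them, suffices because trees determine
    -- types.
    wT-inj : ∀ {T T' : Ty Γ⁻} → T [ w ]T ≡ T' [ w ]T → T ≡ T'
    wT-inj {T} {T'} e = T-inj (trans (sym (back T)) (trans (cong (λ A → rT A [ ρ ]) e) (back T')))
      where
      back : ∀ T → rT (T [ w ]T) [ ρ ] ≡ rT T
      back T = trans (cong (_[ ρ ]) (rT-[] T w)) (trans (sym ([⊚] (rT T) (rS w) ρ)) (trans (cong (rT T [_]) w-ρ) (rT-sc T)))

    -- The test on the type matters for variables: one whose type mentions what is removed is itself
    -- removed, although its own tree passes the test. In `strS` the test follows from `w-f`, since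
    -- the earlier components, and with them the type of the next one, already live over `Γ⁻`.
    str  : ∀ r (P : PTm Γ) → rP P ≡ r → nj (r [ f ]) ≡ true → nj (rT (proj₁ P) [ f ]) ≡ true →
           Σ (PTm Γ⁻) (λ P⁻ → P⁻ [ w ]P ≡ P)
    strS : ∀ s {Φ} (u : VCon Φ) (τ : Sub Γ Φ) → rS τ ≡ s → njS (s ⊚ f) ≡ true →
           Σ (Sub Γ⁻ Φ) (λ τ⁻ → τ⁻ ∘ w ≡ τ)
    str r P e n n' with view v P
    ... | inj₁ x , refl = strV x (trans (cong (λ r → nj (r [ f ])) e) n) n'
    str (con k s) P e n n' | inj₂ (k' , τ) , refl
      with strS s (vcon _) τ (proj₂ (con-inj (trans (sym (rP-gen k' τ)) e))) n
    ... | τ⁻ , refl = nM k' [ τ⁻ ]P , sym ([∘]P (nM k') τ⁻ w)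
    str (var i) P e n n' | inj₂ (k' , τ) , refl with trans (sym (rP-gen k' τ)) e
    ... | ()
    strS s ◇ᵛ τ e n = ε , trans (◇η _) (sym (◇η τ))
    strS [] (u ▹ᵛ B) τ e n with trans (sym (rS-▹ B τ)) e
    ... | ()
    strS (t ∷ s) (u ▹ᵛ B) τ e n with ∷-inj (trans (sym (rS-▹ B τ)) e)
    ... | h , i with strS s u (p ∘ τ) i (proj₂ (∧-true n))
    ... | σ , j with str t (Q B [ τ ]P) h (proj₁ (∧-true n))
                       (trans (cong (λ A → nj (rT A [ f ])) (trans (Q-type B τ) (trans (cong (B [_]T) (sym j)) ([∘]T B σ w)))) (w-f (B [ σ ]T)))
    ... | P , k = pairP B σ P ty , ▹-ext B _ _ (trans (sym (ass p _ w)) (trans (cong (_∘ w) (p-pairP B σ P ty)) j))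
                                   (trans ([∘]P (Q B) _ w) (trans (cong (_[ w ]P) (Q-pairP B σ P ty)) k))
      where
      ty : proj₁ P ≡ B [ σ ]T
      ty = wT-inj (trans (cong proj₁ k) (trans (Q-type B τ) (trans (cong (B [_]T) (sym j)) ([∘]T B σ w))))

    strT : ∀ (A : Ty Γ) → nj (rT A [ f ]) ≡ true → Σ (Ty Γ⁻) (λ A⁻ → A⁻ [ w ]T ≡ A)
    strT A n with coverT A
    ... | (j , τ) , refl with strS (rS τ) (vcon _) τ refl (trans (sym (cong (λ r → nj (r [ f ])) (rT-gen j τ))) n)
    ... | τ⁻ , refl = nT j [ τ⁻ ]T , sym ([∘]T (nT j) τ⁻ w)

  -- The pullback of `⟨ w , X ⟩ : Γ → Γ⁻ ▹ A⁻` along `⟨ ν , u ⟩ : Ψ → Γ⁻ ▹ A⁻`. The field `count`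
  -- says that `Γ′` has as many variables over `Ψ` as `Γ` has over `Γ⁻ ▹ A⁻`, written without
  -- subtraction.
  record Pullback {Γ Γ⁻ Ψ : Con} (w : Sub Γ Γ⁻) (X : PTm Γ) (ν : Sub Ψ Γ⁻) (u : PTm Ψ) : Set where
    field
      Γ′    : Con
      to    : Sub Γ′ Γ
      ω     : Sub Γ′ Ψ
      comm  : w ∘ to ≡ ν ∘ ω
      hit   : X [ to ]P ≡ u [ ω ]P
      count : suc (len Γ′ + len Γ⁻) ≡ len Ψ + len Γ
      fac   : ∀ {Δ} (σ : Sub Δ Γ) (θ : Sub Δ Ψ) → w ∘ σ ≡ ν ∘ θ → X [ σ ]P ≡ u [ θ ]P →
              Σ (Sub Δ Γ′) (λ ρ → to ∘ ρ ≡ σ × ω ∘ ρ ≡ θ)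
      mono  : ∀ {Δ} (ρ ρ' : Sub Δ Γ′) → to ∘ ρ ≡ to ∘ ρ' → ω ∘ ρ ≡ ω ∘ ρ' → ρ ≡ ρ'

  -- Γ⁻ is Γ without x and the variables whose types depend on x.  The context
  -- obtained by giving x a value u over some Ψ → Γ⁻ is constructed for all Ψ
  -- at once, which is what makes the induction on Γ go through.
  record Removal {Γ : Con} (v : VCon Γ) (x : Var v) : Set where
    field
      Γ⁻   : Con
      w    : Sub Γ Γ⁻
      A⁻   : Ty Γ⁻
      typ  : A⁻ [ w ]T ≡ proj₁ ⟦ x ⟧v
      ρ    : RSub
      ρ-length : length ρ ≡ len Γ
      w-ρ  : rS w ⊚ ρ ≡ idR (len Γ⁻)
      w-kill : rS w ⊚ kill ⌜ x ⌝ (len Γ) ≡ rS w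
      strV : ∀ (z : Var v) → nj (rP ⟦ z ⟧v [ kill ⌜ x ⌝ (len Γ) ]) ≡ true →
             nj (rT (proj₁ ⟦ z ⟧v) [ kill ⌜ x ⌝ (len Γ) ]) ≡ true →
             Σ (PTm Γ⁻) (λ P → P [ w ]P ≡ ⟦ z ⟧v)
      pull : ∀ {Ψ} (ν : Sub Ψ Γ⁻) (u : PTm Ψ) → proj₁ u ≡ A⁻ [ ν ]T → Pullback w ⟦ x ⟧v ν u

    w-f : ∀ (T : Ty Γ⁻) → nj (rT (T [ w ]T) [ kill ⌜ x ⌝ (len Γ) ]) ≡ true
    w-f T = trans (cong nj (trans (cong (_[ f ]) (rT-[] T w)) (trans (sym ([⊚] (rT T) (rS w) f)) (trans (cong (rT T [_]) w-kill) (sym (rT-[] T w))))))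
                  (nj-T (T [ w ]T))
      where f = kill ⌜ x ⌝ (len Γ)

    open Strengthen v w (kill ⌜ x ⌝ (len Γ)) ρ w-ρ w-f strV public using (str; strS; strT; wT-inj)

  open Pullback

  module RemoveNew {Γ : Con} (v : VCon Γ) (A : Ty Γ) where
    private
      l : len (Γ ▹ A) ≡ suc (len Γ)
      l = len-▹ A

    -- For the last variable `Γ⁻` is `Γ`, and the map being pulled back is the identity of `Γ ▹ A`.
    pullback : ∀ {Ψ} (ν : Sub Ψ Γ) (u : PTm Ψ) → proj₁ u ≡ A [ ν ]T → Pullback p (Q A) ν u
    pullback {Ψ} ν u e .Γ′ = Ψ
    pullback ν u e .to = pairP A ν u e
    pullback ν u e .ω = id
    pullback ν u e .comm = trans (p-pairP A ν u e) (sym (idr ν))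
    pullback ν u e .hit = trans (Q-pairP A ν u e) (sym ([id]P u))
    pullback {Ψ} ν u e .count = trans (sym (+-suc (len Ψ) (len Γ))) (cong (len Ψ +_) (sym l))
    pullback ν u e .fac σ θ c h =
      θ , ▹-ext A _ _ (trans (sym (ass p _ θ)) (trans (cong (_∘ θ) (p-pairP A ν u e)) (sym c)))
                      (trans ([∘]P (Q A) _ θ) (trans (cong (_[ θ ]P) (Q-pairP A ν u e)) (sym h)))
        , idl θ
    pullback ν u e .mono ρ ρ' _ h = trans (sym (idl ρ)) (trans h (idl ρ'))

    removal : Removal (v ▹ᵛ A) new
    removal = record
      { Γ⁻ = Γ ; w = p ; A⁻ = A ; typ = refl
      ; ρ = junk ∷ idR (len Γ)
      ; ρ-length = trans (cong suc (length-vars 0 _)) (sym l)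
      ; w-ρ = trans (cong (_⊚ _) (rS-p A)) (wk-∷ junk _ (length-vars 0 _))
      ; w-kill = trans (cong₂ _⊚_ (rS-p A) (cong (kill 0) l)) (trans (wk-∷ junk _ (length-vars 1 _)) (sym (rS-p A)))
      ; strV = λ { new n _ → ⊥-elim (impossible (trans (sym (cong nj (cong₂ _[_] (rP-Q A) (cong (kill 0) l)))) n))
                 ; (old z) _ _ → ⟦ z ⟧v , refl }
      ; pull = pullback }
      where
      impossible : false ≡ true → ⊥
      impossible ()

  module RemoveOld {Γ : Con} (v : VCon Γ) (x : Var v) (B : Ty Γ) (R : Removal v x) where
    private
      module R = Removal R
      d = len Γ
      k = kill ⌜ x ⌝ d
      k⁺ = kill (suc ⌜ x ⌝) (len (Γ ▹ B))
      l : len (Γ ▹ B) ≡ suc d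
      l = len-▹ B
      wk-k⁺ : wk d ⊚ k⁺ ≡ k ⊚ wk d
      wk-k⁺ = trans (cong (λ n → wk d ⊚ kill (suc ⌜ x ⌝) n) l) (wk-∷ (var 0) _ (trans (length-⊚ k (wk d)) (length-kill ⌜ x ⌝ d)))

      []-k⁺ : ∀ t → t [ wk d ] [ k⁺ ] ≡ t [ k ] [ wk d ]
      []-k⁺ t = trans (sym ([⊚] t (wk d) k⁺)) (trans (cong (t [_]) wk-k⁺) ([⊚] t k (wk d)))

      rT-p-k : ∀ T → rT (T [ p {Γ} {B} ]T) [ k⁺ ] ≡ rT T [ k ] [ wk d ]
      rT-p-k T = trans (cong (_[ k⁺ ]) (trans (rT-[] T p) (cong (rT T [_]) (rS-p B)))) ([]-k⁺ (rT T))

      rP-p-k : ∀ P → rP (P [ p {Γ} {B} ]P) [ k⁺ ] ≡ rP P [ k ] [ wk d ]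
      rP-p-k P = trans (cong (_[ k⁺ ]) (trans (rP-[] P p) (cong (rP P [_]) (rS-p B)))) ([]-k⁺ (rP P))

      oldV : ∀ (z : Var v) → nj (rP (⟦ z ⟧v [ p {Γ} {B} ]P) [ k⁺ ]) ≡ true →
             nj (rT (proj₁ (⟦ z ⟧v [ p {Γ} {B} ]P)) [ k⁺ ]) ≡ true →
             Σ (PTm R.Γ⁻) (λ P → P [ R.w ]P ≡ ⟦ z ⟧v)
      oldV z n n' = R.strV z (nj-[] (rP ⟦ z ⟧v [ k ]) (wk d) (trans (sym (cong nj (rP-p-k ⟦ z ⟧v))) n))
                             (nj-[] (rT (proj₁ ⟦ z ⟧v) [ k ]) (wk d) (trans (sym (cong nj (rT-p-k (proj₁ ⟦ z ⟧v)))) n'))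

    module Dependent (dep : nj (rT B [ k ]) ≡ false) where
      -- As `B` mentions `x`, the last variable is absent from `Γ⁻`; it is put back on top of the
      -- pullback for `Γ`, at the type obtained by substituting the value of `x`.
      pullback : ∀ {Ψ} (ν : Sub Ψ R.Γ⁻) (u : PTm Ψ) → proj₁ u ≡ R.A⁻ [ ν ]T →
                 Pullback (R.w ∘ p {Γ} {B}) (⟦ x ⟧v [ p ]P) ν u
      pullback {Ψ} ν u e = record
        { Γ′ = R₀.Γ′ ▹ B [ R₀.to ]T
        ; to = to₁
        ; ω = R₀.ω ∘ p
        ; comm = trans (ass R.w p _) (trans (cong (R.w ∘_) p-to) (trans (sym (ass R.w R₀.to p)) (trans (cong (_∘ p) R₀.comm) (ass ν R₀.ω p))))
        ; hit = trans (sym ([∘]P ⟦ x ⟧v p _)) (trans (cong (⟦ x ⟧v [_]P) p-to)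
                  (trans ([∘]P ⟦ x ⟧v R₀.to p) (trans (cong (_[ p ]P) R₀.hit) (sym ([∘]P u R₀.ω p)))))
        ; count = trans (cong (λ n → suc (n + len R.Γ⁻)) (len-▹ (B [ R₀.to ]T)))
                    (trans (cong suc R₀.count) (trans (sym (+-suc (len Ψ) d)) (cong (len Ψ +_) (sym l))))
        ; fac = fac₁
        ; mono = λ ρ ρ' h h' → ▹-ext (B [ R₀.to ]T) ρ ρ'
            (R₀.mono _ _ (trans (sym (p-to-∘ ρ)) (trans (cong (p ∘_) h) (p-to-∘ ρ')))
                         (trans (sym (ass R₀.ω p ρ)) (trans h' (ass R₀.ω p ρ'))))
            (trans (sym (Q-to-∘ ρ)) (trans (cong (Q B [_]P) h) (Q-to-∘ ρ'))) }
        where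
        module R₀ = Pullback (R.pull ν u e)
        ty : proj₁ (Q (B [ R₀.to ]T)) ≡ B [ R₀.to ∘ p ]T
        ty = sym ([∘]T B R₀.to p)
        to₁ : Sub (R₀.Γ′ ▹ B [ R₀.to ]T) (Γ ▹ B)
        to₁ = pairP B (R₀.to ∘ p) (Q (B [ R₀.to ]T)) ty
        p-to : p ∘ to₁ ≡ R₀.to ∘ p
        p-to = p-pairP B (R₀.to ∘ p) (Q (B [ R₀.to ]T)) ty
        Q-to : Q B [ to₁ ]P ≡ Q (B [ R₀.to ]T)
        Q-to = Q-pairP B (R₀.to ∘ p) (Q (B [ R₀.to ]T)) ty
        p-to-∘ : ∀ {Δ} (ρ : Sub Δ (R₀.Γ′ ▹ B [ R₀.to ]T)) → p ∘ (to₁ ∘ ρ) ≡ R₀.to ∘ (p ∘ ρ)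
        p-to-∘ ρ = trans (sym (ass p to₁ ρ)) (trans (cong (_∘ ρ) p-to) (ass R₀.to p ρ))
        Q-to-∘ : ∀ {Δ} (ρ : Sub Δ (R₀.Γ′ ▹ B [ R₀.to ]T)) → Q B [ to₁ ∘ ρ ]P ≡ Q (B [ R₀.to ]T) [ ρ ]P
        Q-to-∘ ρ = trans ([∘]P (Q B) to₁ ρ) (cong (_[ ρ ]P) Q-to)
        fac₁ : ∀ {Δ} (σ : Sub Δ (Γ ▹ B)) (θ : Sub Δ Ψ) → (R.w ∘ p) ∘ σ ≡ ν ∘ θ → ⟦ x ⟧v [ p ]P [ σ ]P ≡ u [ θ ]P →
               Σ (Sub Δ (R₀.Γ′ ▹ B [ R₀.to ]T)) (λ ρ → to₁ ∘ ρ ≡ σ × (R₀.ω ∘ p) ∘ ρ ≡ θ)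
        fac₁ σ θ c h with R₀.fac (p ∘ σ) θ (trans (sym (ass R.w p σ)) c) (trans ([∘]P ⟦ x ⟧v p σ) h)
        ... | ρ₀ , i , j = ρ₁ , ▹-ext B _ _ (trans (p-to-∘ ρ₁) (trans (cong (R₀.to ∘_) p-ρ₁) i))
                                           (trans (Q-to-∘ ρ₁) (Q-pairP (B [ R₀.to ]T) ρ₀ (Q B [ σ ]P) tyρ))
                              , trans (ass R₀.ω p ρ₁) (trans (cong (R₀.ω ∘_) p-ρ₁) j)
          where
          tyρ : proj₁ (Q B [ σ ]P) ≡ B [ R₀.to ]T [ ρ₀ ]T
          tyρ = trans (Q-type B σ) (trans (cong (B [_]T) (sym i)) ([∘]T B R₀.to ρ₀))
          ρ₁ : Sub _ (R₀.Γ′ ▹ B [ R₀.to ]T)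
          ρ₁ = pairP (B [ R₀.to ]T) ρ₀ (Q B [ σ ]P) tyρ
          p-ρ₁ : p ∘ ρ₁ ≡ ρ₀
          p-ρ₁ = p-pairP (B [ R₀.to ]T) ρ₀ (Q B [ σ ]P) tyρ

      removal : Removal (v ▹ᵛ B) (old x)
      removal = record
        { Γ⁻ = R.Γ⁻ ; w = R.w ∘ p ; A⁻ = R.A⁻
        ; typ = trans ([∘]T R.A⁻ R.w p) (cong (_[ p ]T) R.typ)
        ; ρ = junk ∷ R.ρ
        ; ρ-length = trans (cong suc R.ρ-length) (sym l)
        ; w-ρ = trans (cong (_⊚ _) rw) (trans (⊚-assoc (rS R.w) (wk d) _) (trans (cong (rS R.w ⊚_) (wk-∷ junk R.ρ R.ρ-length)) R.w-ρ))
        ; w-kill = trans (cong (_⊚ k⁺) rw) (trans (⊚-assoc (rS R.w) (wk d) k⁺) (trans (cong (rS R.w ⊚_) wk-k⁺)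
                     (trans (sym (⊚-assoc (rS R.w) k (wk d))) (trans (cong (_⊚ wk d) R.w-kill) (sym rw)))))
        ; strV = λ { new _ n → ⊥-elim (impossible (trans (sym dep) (nj-[] (rT B [ k ]) (wk d) (trans (sym (cong nj (rT-p-k B))) n))))
                   ; (old z) n n' → let P , e = oldV z n n' in P , trans ([∘]P P R.w p) (cong (_[ p ]P) e) }
        ; pull = pullback }
        where
        rw : rS (R.w ∘ p {Γ} {B}) ≡ rS R.w ⊚ wk d
        rw = trans (rS-∘ R.w p) (cong (rS R.w ⊚_) (rS-p B))
        impossible : false ≡ true → ⊥
        impossible ()

    module Independent (B⁻ : Ty R.Γ⁻) (eB : B⁻ [ R.w ]T ≡ B) where
      tyw : proj₁ (Q B) ≡ B⁻ [ R.w ∘ p ]T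
      tyw = trans (cong (_[ p ]T) (sym eB)) (sym ([∘]T B⁻ R.w p))
      w₁ : Sub (Γ ▹ B) (R.Γ⁻ ▹ B⁻)
      w₁ = pairP B⁻ (R.w ∘ p) (Q B) tyw
      p-w : p ∘ w₁ ≡ R.w ∘ p
      p-w = p-pairP B⁻ (R.w ∘ p) (Q B) tyw
      Q-w : Q B⁻ [ w₁ ]P ≡ Q B
      Q-w = Q-pairP B⁻ (R.w ∘ p) (Q B) tyw
      p-w-∘ : ∀ {Δ} (σ : Sub Δ (Γ ▹ B)) → p ∘ (w₁ ∘ σ) ≡ R.w ∘ (p ∘ σ)
      p-w-∘ σ = trans (sym (ass p w₁ σ)) (trans (cong (_∘ σ) p-w) (ass R.w p σ))
      Q-w-∘ : ∀ {Δ} (σ : Sub Δ (Γ ▹ B)) → Q B⁻ [ w₁ ∘ σ ]P ≡ Q B [ σ ]P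
      Q-w-∘ σ = trans ([∘]P (Q B⁻) w₁ σ) (cong (_[ σ ]P) Q-w)

      -- As `B` avoids `x`, the last variable moves in front of `x` and `ν` already supplies its
      -- value, so `Γ′` does not grow. The recursive call is at `p ∘ ν`, which is not an identity
      -- even if `ν` is; this is where all `Ψ` are needed.
      pullback : ∀ {Ψ} (ν : Sub Ψ (R.Γ⁻ ▹ B⁻)) (u : PTm Ψ) → proj₁ u ≡ R.A⁻ [ p ]T [ ν ]T →
                 Pullback w₁ (⟦ x ⟧v [ p ]P) ν u
      pullback {Ψ} ν u e = record
        { Γ′ = R₀.Γ′
        ; to = to₁
        ; ω = R₀.ω
        ; comm = ▹-ext B⁻ _ _ (trans (p-w-∘ to₁) (trans (cong (R.w ∘_) p-to) (trans R₀.comm (ass p ν R₀.ω))))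
                              (trans (Q-w-∘ to₁) Q-to)
        ; hit = trans (sym ([∘]P ⟦ x ⟧v p to₁)) (trans (cong (⟦ x ⟧v [_]P) p-to) R₀.hit)
        ; count = trans (cong (λ n → suc (len R₀.Γ′ + n)) (len-▹ B⁻)) (trans (cong suc (+-suc _ _))
                    (trans (cong suc R₀.count) (trans (sym (+-suc (len Ψ) d)) (cong (len Ψ +_) (sym l)))))
        ; fac = fac₁
        ; mono = λ ρ ρ' h h' → R₀.mono ρ ρ' (trans (sym (p-to-∘ ρ)) (trans (cong (p ∘_) h) (p-to-∘ ρ'))) h' }
        where
        module R₀ = Pullback (R.pull (p ∘ ν) u (trans e (sym ([∘]T R.A⁻ p ν))))
        ty : proj₁ (Q B⁻ [ ν ∘ R₀.ω ]P) ≡ B [ R₀.to ]T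
        ty = trans (Q-type B⁻ _) (trans (cong (B⁻ [_]T) (trans (sym (ass p ν R₀.ω)) (sym R₀.comm)))
               (trans ([∘]T B⁻ R.w R₀.to) (cong (_[ R₀.to ]T) eB)))
        to₁ : Sub R₀.Γ′ (Γ ▹ B)
        to₁ = pairP B R₀.to (Q B⁻ [ ν ∘ R₀.ω ]P) ty
        p-to : p ∘ to₁ ≡ R₀.to
        p-to = p-pairP B R₀.to _ ty
        Q-to : Q B [ to₁ ]P ≡ Q B⁻ [ ν ∘ R₀.ω ]P
        Q-to = Q-pairP B R₀.to _ ty
        p-to-∘ : ∀ {Δ} (ρ : Sub Δ R₀.Γ′) → p ∘ (to₁ ∘ ρ) ≡ R₀.to ∘ ρ
        p-to-∘ ρ = trans (sym (ass p to₁ ρ)) (cong (_∘ ρ) p-to)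
        fac₁ : ∀ {Δ} (σ : Sub Δ (Γ ▹ B)) (θ : Sub Δ Ψ) → w₁ ∘ σ ≡ ν ∘ θ → ⟦ x ⟧v [ p ]P [ σ ]P ≡ u [ θ ]P →
               Σ (Sub Δ R₀.Γ′) (λ ρ → to₁ ∘ ρ ≡ σ × R₀.ω ∘ ρ ≡ θ)
        fac₁ σ θ c h with R₀.fac (p ∘ σ) θ (trans (sym (p-w-∘ σ)) (trans (cong (p ∘_) c) (sym (ass p ν θ))))
                                 (trans ([∘]P ⟦ x ⟧v p σ) h)
        ... | ρ , i , j = ρ , ▹-ext B _ _ (trans (p-to-∘ ρ) i)
                (trans ([∘]P (Q B) to₁ ρ) (trans (cong (_[ ρ ]P) Q-to) (trans (sym ([∘]P (Q B⁻) (ν ∘ R₀.ω) ρ))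
                  (trans (cong (Q B⁻ [_]P) (trans (ass ν R₀.ω ρ) (trans (cong (ν ∘_) j) (sym c)))) (Q-w-∘ σ)))))
                , j

      removal : Removal (v ▹ᵛ B) (old x)
      removal = record
        { Γ⁻ = R.Γ⁻ ▹ B⁻ ; w = w₁ ; A⁻ = R.A⁻ [ p ]T
        ; typ = trans (sym ([∘]T R.A⁻ p w₁)) (trans (cong (R.A⁻ [_]T) p-w) (trans ([∘]T R.A⁻ R.w p) (cong (_[ p ]T) R.typ)))
        ; ρ = var 0 ∷ R.ρ ⊚ wk d⁻
        ; ρ-length = trans (cong suc lρ) (sym l)
        ; w-ρ = trans (cong (_⊚ (var 0 ∷ R.ρ ⊚ wk d⁻)) rw) (trans (cong (var 0 ∷_) (trans (⊚-assoc (rS R.w) (wk d) _)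
                  (trans (cong (rS R.w ⊚_) (wk-∷ (var 0) _ lρ)) (trans (sym (⊚-assoc (rS R.w) R.ρ (wk d⁻)))
                    (trans (cong (_⊚ wk d⁻) R.w-ρ) (idR-⊚ (wk d⁻) (length-vars 1 d⁻)))))))
                  (cong idR (sym (len-▹ B⁻))))
        ; w-kill = trans (cong (_⊚ k⁺) rw) (trans (cong₂ _∷_ (cong (λ n → lookup 0 (kill (suc ⌜ x ⌝) n)) l)
                     (trans (⊚-assoc (rS R.w) (wk d) k⁺) (trans (cong (rS R.w ⊚_) wk-k⁺)
                       (trans (sym (⊚-assoc (rS R.w) k (wk d))) (cong (_⊚ wk d) R.w-kill))))) (sym rw))
        ; strV = λ { new _ _ → Q B⁻ , Q-w
                   ; (old z) n n' → let P , e = oldV z n n' in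
                       P [ p ]P , trans (sym ([∘]P P p w₁)) (trans (cong (P [_]P) p-w) (trans ([∘]P P R.w p) (cong (_[ p ]P) e))) }
        ; pull = pullback }
        where
        d⁻ = len R.Γ⁻
        lρ : length (R.ρ ⊚ wk d⁻) ≡ d
        lρ = trans (length-⊚ R.ρ (wk d⁻)) R.ρ-length
        rw : rS w₁ ≡ var 0 ∷ rS R.w ⊚ wk d
        rw = trans (rS-pairP B⁻ _ _ tyw) (cong₂ _∷_ (rP-Q B) (trans (rS-∘ R.w p) (cong (rS R.w ⊚_) (rS-p B))))

  remove : ∀ {Γ} (v : VCon Γ) (x : Var v) → Removal v x
  remove (v ▹ᵛ A) new = RemoveNew.removal v A
  remove (_▹ᵛ_ {Γ} v B) (old x) with remove v x
  ... | R = go _ refl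
    where
    go : ∀ b → nj (rT B [ kill ⌜ x ⌝ (len Γ) ]) ≡ b → Removal (v ▹ᵛ B) (old x)
    go false e = RemoveOld.Dependent.removal v x B R e
    go true  e = let B⁻ , eB = Removal.strT R B e in RemoveOld.Independent.removal v x B R B⁻ eB

-- Unification

module Telescopes (C : CwF) where
  open Kit C
  open Sorts C public

  up : ∀ {Γ Δ} (Θ : Tel Γ) (σ : Sub Δ Γ) → Sub (Δ ▹▹ proj₁ (subTel Θ σ)) (Γ ▹▹ Θ)
  up Θ σ = proj₂ (subTel Θ σ)

  p-↑ : ∀ {Γ Δ} (σ : Sub Δ Γ) A → p ∘ (σ ↑ A) ≡ σ ∘ p
  p-↑ σ A = p-pairP A (σ ∘ p) (Q (A [ σ ]T)) _

  Q-↑ : ∀ {Γ Δ} (σ : Sub Δ Γ) A → Q A [ σ ↑ A ]P ≡ Q (A [ σ ]T)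
  Q-↑ σ A = Q-pairP A (σ ∘ p) (Q (A [ σ ]T)) _

  subTel-∘ : ∀ {Γ Δ Ξ} (Θ : Tel Γ) (σ : Sub Δ Γ) (δ : Sub Ξ Δ) →
             _≡_ {A = Σ (Tel Ξ) (λ Θ' → Sub (Ξ ▹▹ Θ') (Γ ▹▹ Θ))}
               (subTel Θ (σ ∘ δ)) (proj₁ (subTel (proj₁ (subTel Θ σ)) δ) , up Θ σ ∘ up (proj₁ (subTel Θ σ)) δ)
  subTel-∘ [] σ δ = refl
  subTel-∘ {Ξ = Ξ} (A ∷ Θ) σ δ =
    trans (cong (λ { (T , τ) → T ∷ proj₁ (subTel Θ τ) , up Θ τ }) ↑-∘)
          (cong (λ { (Θ' , τ) → A [ σ ]T [ δ ]T ∷ Θ' , τ }) (subTel-∘ Θ (σ ↑ A) (δ ↑ (A [ σ ]T))))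
    where
    δ↑ = δ ↑ (A [ σ ]T)
    -- The two sides extend `Ξ` by types that are only propositionally equal, so the lift is
    -- generalised over that type before the equation is eliminated.
    lift : ∀ T → T ≡ A [ σ ∘ δ ]T → Sub (Ξ ▹ T) (_ ▹ A)
    lift T e = pairP A ((σ ∘ δ) ∘ p) (Q T) (trans (cong (_[ p ]T) e) (sym ([∘]T A (σ ∘ δ) p)))
    lift-≡ : ∀ {T T'} (h : T ≡ T') e e' → _≡_ {A = Σ (Ty Ξ) (λ T → Sub (Ξ ▹ T) (_ ▹ A))} (T , lift T e) (T' , lift T' e')
    lift-≡ refl e e' rewrite uip e e' = refl
    ↑-∘ : _≡_ {A = Σ (Ty Ξ) (λ T → Sub (Ξ ▹ T) (_ ▹ A))}
            (A [ σ ∘ δ ]T , (σ ∘ δ) ↑ A) (A [ σ ]T [ δ ]T , (σ ↑ A) ∘ (δ ↑ (A [ σ ]T)))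
    ↑-∘ = trans (lift-≡ ([∘]T A σ δ) refl (sym ([∘]T A σ δ))) (cong (_ ,_)
      (▹-ext A _ _
        (trans (p-pairP A _ (Q _) _) (trans (ass σ δ p) (trans (cong (σ ∘_) (sym (p-↑ δ (A [ σ ]T))))
          (trans (sym (ass σ p δ↑)) (trans (cong (_∘ δ↑) (sym (p-↑ σ A))) (ass p (σ ↑ A) δ↑))))))
        (trans (Q-pairP A _ (Q _) _) (trans (sym (Q-↑ δ (A [ σ ]T))) (trans (cong (_[ δ↑ ]P) (sym (Q-↑ σ A))) (sym ([∘]P (Q A) (σ ↑ A) δ↑)))))))

  pTel : ∀ {Γ} (Θ : Tel Γ) → Sub (Γ ▹▹ Θ) Γ
  pTel []      = id
  pTel (A ∷ Θ) = p ∘ pTel Θ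

  pTel-up : ∀ {Γ Δ} (Θ : Tel Γ) (σ : Sub Δ Γ) → pTel Θ ∘ up Θ σ ≡ σ ∘ pTel (proj₁ (subTel Θ σ))
  pTel-up []      σ = trans (idl σ) (sym (idr σ))
  pTel-up (A ∷ Θ) σ = trans (ass p _ _) (trans (cong (p ∘_) (pTel-up Θ (σ ↑ A))) (trans (sym (ass p _ _))
                        (trans (cong (_∘ pTel (proj₁ (subTel Θ (σ ↑ A)))) (p-↑ σ A)) (ass σ p _))))

  size : ∀ {Γ} → Tel Γ → ℕ
  size []      = 0
  size (A ∷ Θ) = suc (size Θ)

  size-sub : ∀ {Γ Δ} (Θ : Tel Γ) (σ : Sub Δ Γ) → size (proj₁ (subTel Θ σ)) ≡ size Θ
  size-sub []      σ = refl
  size-sub (A ∷ Θ) σ = cong suc (size-sub Θ (σ ↑ A))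

-- Raw telescopes: lifting, freeness and shapes

module RawTel (K : Set) where
  open Raw K
  open RawNj K

  infixl 20 _⊕_
  -- The accumulating form follows the recursion of `_▹▹_`, which extends the base context by the
  -- first type of the telescope.
  _⊕_ : ℕ → ℕ → ℕ
  d ⊕ zero  = d
  d ⊕ suc n = suc d ⊕ n

  lift : ℕ → RSub → RSub
  lift d s = var 0 ∷ s ⊚ wk d

  -- For a telescope of length n over a context of length d: L lifts a
  -- substitution through it, W is the weakening, and V is the retraction of W
  -- sending the n telescope variables to junk.
  L : ℕ → ℕ → RSub → RSub
  L zero    d s = s
  L (suc n) d s = L n (suc d) (lift d s)

  W V : ℕ → ℕ → RSub
  W zero    d = idR d
  W (suc n) d = wk d ⊚ W n (suc d)
  V zero    d = idR d
  V (suc n) d = V n (suc d) ⊚ (junk ∷ idR d)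

  wk-junk : ∀ d → wk d ⊚ (junk ∷ idR d) ≡ idR d
  wk-junk d = wk-∷ junk (idR d) (length-vars 0 d)

  wk-sc : ∀ d → wk d ⊚ idR (suc d) ≡ wk d
  wk-sc d = wk-∷ (var 0) (wk d) (length-vars 1 d)

  lift-sc : ∀ d s → lift d s ⊚ idR (suc d) ≡ lift d s
  lift-sc d s = cong (var 0 ∷_) (trans (⊚-assoc s (wk d) _) (cong (s ⊚_) (wk-sc d)))

  length-lift : ∀ {g} d s → length s ≡ g → length (lift d s) ≡ suc g
  length-lift d s e = cong suc (trans (length-⊚ s (wk d)) e)

  lift-∘ : ∀ {e} d s u → length u ≡ e → lift e s ⊚ lift d u ≡ lift d (s ⊚ u)
  lift-∘ {e} d s u l = cong (var 0 ∷_) (trans (⊚-assoc s (wk e) (lift d u))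
    (trans (cong (s ⊚_) (wk-∷ (var 0) (u ⊚ wk d) (trans (length-⊚ u (wk d)) l))) (sym (⊚-assoc s u (wk d)))))

  L-∘ : ∀ n {e} d s u → length u ≡ e → L n d (s ⊚ u) ≡ L n e s ⊚ L n d u
  L-∘ zero    d s u l = refl
  L-∘ (suc n) d s u l = trans (cong (L n (suc d)) (sym (lift-∘ d s u l))) (L-∘ n (suc d) (lift _ s) (lift d u) (length-lift d u l))

  L-idR : ∀ n d → L n d (idR d) ≡ idR (d ⊕ n)
  L-idR zero    d = refl
  L-idR (suc n) d = trans (cong (λ s → L n (suc d) (var 0 ∷ s)) (idR-⊚ (wk d) (length-vars 1 d))) (L-idR n (suc d))

  W-V : ∀ n d → W n d ⊚ V n d ≡ idR d
  W-V zero    d = idR-sc d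
  W-V (suc n) d = trans (⊚-assoc (wk d) (W n (suc d)) _) (trans (cong (wk d ⊚_) (sym (⊚-assoc (W n (suc d)) (V n (suc d)) _)))
    (trans (cong (λ z → wk d ⊚ (z ⊚ _)) (W-V n (suc d))) (trans (sym (⊚-assoc (wk d) (idR (suc d)) _))
      (trans (cong (_⊚ (junk ∷ idR d)) (wk-sc d)) (wk-junk d)))))

  -- This naturality of `V` is what carries freeness from the telescope across a substitution, in
  -- both directions.
  L-V : ∀ n {g} d s → length s ≡ g → s ⊚ idR d ≡ s → L n d s ⊚ V n d ≡ V n g ⊚ s
  L-V zero    d s l e = trans e (sym (idR-⊚ s l))
  L-V (suc n) {g} d s l e =
    trans (sym (⊚-assoc (L n (suc d) (lift d s)) (V n (suc d)) _))
      (trans (cong (_⊚ _) (L-V n (suc d) (lift d s) (length-lift d s l) (lift-sc d s)))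
        (trans (⊚-assoc (V n (suc g)) (lift d s) _)
          (trans (cong (V n (suc g) ⊚_) (trans (cong (junk ∷_) (trans (⊚-assoc s (wk d) _) (trans (cong (s ⊚_) (wk-junk d)) e)))
                                               (cong (junk ∷_) (sym (idR-⊚ s l)))))
                 (sym (⊚-assoc (V n (suc g)) _ s)))))

  lookup-W : ∀ n d y → y < d → lookup y (W n d) ≡ var (n + y)
  lookup-W zero    d y h = lookup-vars 0 d y h
  lookup-W (suc n) d y h = trans (lookup-⊚ y (wk d) (W n (suc d))) (trans (cong (_[ W n (suc d) ]) (lookup-vars 1 d y h))
    (trans (lookup-W n (suc d) (suc y) (s≤s h)) (cong var (+-suc n y))))

  data Split (n g z : ℕ) : Set where
    outer : ∀ y → y < g → z ≡ n + y → lookup z (V n g) ≡ var y → Split n g z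
    rigid : z < n → lookup z (V n g) ≡ junk → (∀ d s → s ⊚ idR d ≡ s → lookup z (L n d s) ≡ var z) → Split n g z

  lookup-L : ∀ n d s y → s ⊚ idR d ≡ s → lookup (n + y) (L n d s) ≡ lookup y s [ W n d ]
  lookup-L zero    d s y e = trans (cong (lookup y) (sym e)) (lookup-⊚ y s (idR d))
  lookup-L (suc n) d s y e = trans (cong (λ z → lookup z (L n (suc d) (lift d s))) (sym (+-suc n y)))
    (trans (lookup-L n (suc d) (lift d s) (suc y) (lift-sc d s))
      (trans (cong (_[ W n (suc d) ]) (lookup-⊚ y s (wk d))) (sym ([⊚] (lookup y s) (wk d) (W n (suc d))))))

  split : ∀ n g z → z < g ⊕ n → Split n g z
  split zero    g z h = outer z h refl (lookup-vars 0 g z h)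
  split (suc n) g z h with split n (suc g) z h
  ... | rigid k e f = rigid (≤-trans k (m≤n+m n 1)) (trans (lookup-⊚ z (V n (suc g)) _) (cong (_[ _ ]) e)) (λ d s _ → f (suc d) (lift d s) (lift-sc d s))
  ... | outer zero h' refl e =
    rigid (s≤s (≤-reflexive (+-identityʳ n))) (trans (lookup-⊚ z (V n (suc g)) _) (cong (_[ _ ]) e))
          (λ d s _ → trans (lookup-L n (suc d) (lift d s) 0 (lift-sc d s)) (lookup-W n (suc d) 0 (s≤s z≤n)))
  ... | outer (suc y) (s≤s h') refl e =
    outer y h' (+-suc n y) (trans (lookup-⊚ z (V n (suc g)) _) (trans (cong (_[ _ ]) e) (lookup-vars 0 g y h')))

  kill-nj : ∀ i d j → j < d → nj (lookup j (kill i d)) ≡ false → j ≡ i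
  kill-nj zero    (suc d) zero    h e = refl
  kill-nj zero    (suc d) (suc j) (s≤s h) e with trans (sym e) (cong nj (lookup-vars 1 d j h))
  ... | ()
  kill-nj (suc i) (suc d) (suc j) (s≤s h) e = cong suc (kill-nj i d j h (shift e))
    where
    shift : nj (lookup j (kill i d ⊚ wk d)) ≡ false → nj (lookup j (kill i d)) ≡ false
    shift e with nj (lookup j (kill i d)) in eq
    ... | false = refl
    ... | true  = trans (sym (go (lookup j (kill i d)) eq (sc i d j))) (trans (cong nj (sym (lookup-⊚ j (kill i d) (wk d)))) e)
      where
      go : ∀ t → nj t ≡ true → t [ idR d ] ≡ t → nj (t [ wk d ]) ≡ true
      go t n e = nj-sub t (wk d) (njv 1 d) (length-vars 1 d) e n
        where
        njv : ∀ k d → njS (vars k d) ≡ true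
        njv k zero    = refl
        njv k (suc d) = njv (suc k) d
      killsc : ∀ i d → kill i d ⊚ idR d ≡ kill i d
      killsc i zero = refl
      killsc zero (suc d) = cong (junk ∷_) (wk-sc d)
      killsc (suc i) (suc d) = lift-sc d (kill i d)
      sc : ∀ i d j → lookup j (kill i d) [ idR d ] ≡ lookup j (kill i d)
      sc i d j = trans (sym (lookup-⊚ j (kill i d) (idR d))) (cong (lookup j) (killsc i d))

  ⊕-< : ∀ n g z → z < n → z < g ⊕ n
  ⊕-< n g z h = ≤-trans h (n≤⊕ n g)
    where
    n≤⊕ : ∀ n g → n ≤ g ⊕ n
    n≤⊕ zero    g = z≤n
    n≤⊕ (suc n) g = ≤-trans (m≤n+m (suc n) g) (≤-reflexive (sym (⊕≡+ (suc n) g)))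
      where
      ⊕≡+ : ∀ n g → g ⊕ n ≡ g + n
      ⊕≡+ zero    g = sym (+-identityʳ g)
      ⊕≡+ (suc n) g = trans (⊕≡+ n (suc g)) (sym (+-suc g n))

  inner : ∀ n g z → z < n → lookup z (V n g) ≡ junk × (∀ d s → s ⊚ idR d ≡ s → lookup z (L n d s) ≡ var z)
  inner n g z h with split n g z (⊕-< n g z h)
  ... | rigid _ e f = e , f
  ... | outer y _ refl _ = ⊥-elim (<-irrefl refl (≤-trans h (m≤m+n n y)))

  V-sc : ∀ n g → V n g ⊚ idR g ≡ V n g
  V-sc zero    g = idR-sc g
  V-sc (suc n) g = trans (⊚-assoc (V n (suc g)) _ _) (cong (V n (suc g) ⊚_) (cong (junk ∷_) (idR-sc g)))

  -- sk n d t replaces the maximal subterms of t which avoid the n telescope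
  -- variables by junk; this is invariant under lifted substitutions.
  sk sk′ : ℕ → ℕ → RTm → RTm
  skS    : ℕ → ℕ → RSub → RSub
  sk n d t = if nj (t [ V n d ]) then junk else sk′ n d t
  sk′ n d (var z)   = var z
  sk′ n d (con k s) = con k (skS n d s)
  sk′ n d junk      = junk
  skS n d []      = []
  skS n d (t ∷ s) = sk n d t ∷ skS n d s

  module _ (n : ℕ) {d g : ℕ} (s : RSub) (l : length s ≡ g) (e : s ⊚ idR d ≡ s) (ns : njS s ≡ true) where
    -- Substitution never removes junk, so a term meeting the telescope still meets it afterwards;
    -- and `s`, being free of junk, creates no new occurrence.
    free-L : ∀ t → nj (t [ L n d s ] [ V n d ]) ≡ nj (t [ V n g ])
    free-L t = trans (cong nj (trans (sym ([⊚] t (L n d s) (V n d))) (trans (cong (t [_]) (L-V n d s l e)) ([⊚] t (V n g) s)))) (go (nj (t [ V n g ])) refl)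
      where
      go : ∀ b → nj (t [ V n g ]) ≡ b → nj (t [ V n g ] [ s ]) ≡ b
      go true  h = nj-sub (t [ V n g ]) s ns l (trans (sym ([⊚] t (V n g) (idR g))) (cong (t [_]) (V-sc n g))) h
      go false h with nj (t [ V n g ] [ s ]) in eq
      ... | false = refl
      ... | true  = trans (sym (nj-[] (t [ V n g ]) s eq)) h

    -- A shape stops at the maximal subterms free of the telescope, and substitution acts only
    -- inside these. A variable still visible in the shape is a telescope variable, which the lift
    -- fixes.
    sk-L  : ∀ t → t [ idR (g ⊕ n) ] ≡ t → nj t ≡ true → sk n d (t [ L n d s ]) ≡ sk n g t
    sk′-L : ∀ t → t [ idR (g ⊕ n) ] ≡ t → nj t ≡ true → nj (t [ V n g ]) ≡ false → sk′ n d (t [ L n d s ]) ≡ sk′ n g t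
    skS-L : ∀ r → r ⊚ idR (g ⊕ n) ≡ r → njS r ≡ true → skS n d (r ⊚ L n d s) ≡ skS n g r
    sk-L t sc m rewrite free-L t with nj (t [ V n g ]) in eq
    ... | true  = refl
    ... | false = sk′-L t sc m eq
    sk′-L (var z) sc m f with split n g z (var-sc (g ⊕ n) z sc)
    ... | outer y _ _ h = case trans (sym f) (cong nj h) of λ ()
    ... | rigid _ _ h   = cong (sk′ n d) (h d s e)
    sk′-L (con k r) sc m f = cong (con k) (skS-L r (proj₂ (con-inj sc)) m)
    skS-L [] sc m = refl
    skS-L (t ∷ r) sc m = cong₂ _∷_ (sk-L t (proj₁ (∷-inj sc)) (proj₁ (∧-true m))) (skS-L r (proj₂ (∷-inj sc)) (proj₂ (∧-true m)))

  weight  : RTm → ℕ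
  weightS : RSub → ℕ
  weight (var i)   = 0
  weight (con k s) = suc (weightS s)
  weight junk      = 0
  weightS []      = 0
  weightS (t ∷ s) = weight t + weightS s

  -- The failed test says that the variable `i` occurs in `t`, so a copy of its value sits inside
  -- `t [ s ]`. Beneath a generator the inequality becomes strict, which is the occurs check.
  occ-weight  : ∀ i d t s → t [ idR d ] ≡ t → nj t ≡ true → nj (t [ kill i d ]) ≡ false → weight (lookup i s) ≤ weight (t [ s ])
  occ-weightS : ∀ i d r s → r ⊚ idR d ≡ r → njS r ≡ true → njS (r ⊚ kill i d) ≡ false → weight (lookup i s) ≤ weightS (r ⊚ s)
  occ-weight i d (var j) s e n k with kill-nj i d j (var-sc d j e) k
  ... | refl = ≤-refl
  occ-weight i d (con _ r) s e n k = ≤-trans (occ-weightS i d r s (proj₂ (con-inj e)) n k) (m≤n+m _ 1)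
  occ-weightS i d (t ∷ r) s e n k with nj (t [ kill i d ]) in eq
  ... | false = ≤-trans (occ-weight i d t s (proj₁ (∷-inj e)) (proj₁ (∧-true n)) eq) (m≤m+n _ _)
  ... | true  = ≤-trans (occ-weightS i d r s (proj₂ (∷-inj e)) (proj₂ (∧-true n)) k) (m≤n+m _ _)

-- Most general unifiers with rigid telescope variables

module Unify {C : CwF} (cell : IsCellularCwF C) where
  open Elim cell public
  open Telescopes C public
  open RawTel Name public

  len-▹▹ : ∀ {Γ} (Θ : Tel Γ) → len (Γ ▹▹ Θ) ≡ len Γ ⊕ size Θ
  len-▹▹ []      = refl
  len-▹▹ (A ∷ Θ) = trans (len-▹▹ Θ) (cong (_⊕ size Θ) (len-▹ A))

  rS-up : ∀ {Γ Δ} (Θ : Tel Γ) (σ : Sub Δ Γ) → rS (up Θ σ) ≡ L (size Θ) (len Δ) (rS σ)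
  rS-up []      σ = refl
  rS-up (A ∷ Θ) σ = trans (rS-up Θ (σ ↑ A)) (cong₂ (L (size Θ)) (len-▹ (A [ σ ]T))
    (trans (rS-pairP A (σ ∘ p) (Q (A [ σ ]T)) _) (cong₂ _∷_ (rP-Q (A [ σ ]T)) (trans (rS-∘ σ p) (cong (rS σ ⊚_) (rS-p _))))))

  rS-pTel : ∀ {Γ} (Θ : Tel Γ) → rS (pTel Θ) ≡ W (size Θ) (len Γ)
  rS-pTel []      = rS-id
  rS-pTel (A ∷ Θ) = trans (rS-∘ p (pTel Θ)) (cong₂ _⊚_ (rS-p A) (trans (rS-pTel Θ) (cong (W (size Θ)) (len-▹ A))))

  Lσ : ∀ n {Γ Δ} → Sub Δ Γ → RSub
  Lσ n {Δ = Δ} σ = L n (len Δ) (rS σ)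

  Lσ-∘ : ∀ n {Γ Δ Ξ} (σ : Sub Δ Γ) (δ : Sub Ξ Δ) → Lσ n (σ ∘ δ) ≡ Lσ n σ ⊚ Lσ n δ
  Lσ-∘ n σ δ = trans (cong (L n _) (rS-∘ σ δ)) (L-∘ n _ (rS σ) (rS δ) (rS-length δ))

  Lσ-id : ∀ {Γ} (Θ : Tel Γ) → Lσ (size Θ) (id {Γ}) ≡ idR (len (Γ ▹▹ Θ))
  Lσ-id {Γ} Θ = trans (cong (L (size Θ) (len Γ)) rS-id) (trans (L-idR (size Θ) (len Γ)) (cong idR (sym (len-▹▹ Θ))))

  rP-up : ∀ {Γ Δ} (Θ : Tel Γ) (σ : Sub Δ Γ) (P : PTm (Γ ▹▹ Θ)) → rP (P [ up Θ σ ]P) ≡ rP P [ Lσ (size Θ) σ ]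
  rP-up Θ σ P = trans (rP-[] P _) (cong (rP P [_]) (rS-up Θ σ))

  rS-∘up : ∀ {Γ Δ Φ} (Θ : Tel Γ) (σ : Sub Δ Γ) (τ : Sub (Γ ▹▹ Θ) Φ) → rS (τ ∘ up Θ σ) ≡ rS τ ⊚ Lσ (size Θ) σ
  rS-∘up Θ σ τ = trans (rS-∘ τ _) (cong (rS τ ⊚_) (rS-up Θ σ))

  Pred : Con → Set₁
  Pred Γ = ∀ {Δ} → Sub Δ Γ → Set

  -- Equations are between trees: they make sense where the types of the two sides are not known to
  -- agree, and composing lifts requires no transport along `subTel-∘`.
  EqP : ∀ n → RTm → RTm → ∀ {Γ} → Pred Γ
  EqP n r r' σ = r [ Lσ n σ ] ≡ r' [ Lσ n σ ]

  EqS : ∀ n → RSub → RSub → ∀ {Γ} → Pred Γ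
  EqS n r r' σ = r ⊚ Lσ n σ ≡ r' ⊚ Lσ n σ

  []-Lσ-∘ : ∀ n r {Γ Δ Ξ} (σ : Sub Δ Γ) (δ : Sub Ξ Δ) → r [ Lσ n (σ ∘ δ) ] ≡ r [ Lσ n σ ] [ Lσ n δ ]
  []-Lσ-∘ n r σ δ = trans (cong (r [_]) (Lσ-∘ n σ δ)) ([⊚] r (Lσ n σ) (Lσ n δ))

  ⊚-Lσ-∘ : ∀ n r {Γ Δ Ξ} (σ : Sub Δ Γ) (δ : Sub Ξ Δ) → r ⊚ Lσ n (σ ∘ δ) ≡ (r ⊚ Lσ n σ) ⊚ Lσ n δ
  ⊚-Lσ-∘ n r σ δ = trans (cong (r ⊚_) (Lσ-∘ n σ δ)) (sym (⊚-assoc r (Lσ n σ) (Lσ n δ)))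

  EqS-[] : ∀ n {r r'} {Γ Δ Ξ} (σ : Sub Δ Γ) (δ : Sub Ξ Δ) → EqS n r r' σ → EqS n r r' (σ ∘ δ)
  EqS-[] n {r} {r'} σ δ e = trans (⊚-Lσ-∘ n r σ δ) (trans (cong (_⊚ Lσ n δ) e) (sym (⊚-Lσ-∘ n r' σ δ)))

  record Smaller (Γ : Con) (S : Pred Γ) : Set where
    field
      Γ′    : Con
      to    : Sub Γ′ Γ
      less  : len Γ′ < len Γ
      sound : S to
      fac   : ∀ {Δ} (σ : Sub Δ Γ) → S σ → Σ (Sub Δ Γ′) (λ ρ → to ∘ ρ ≡ σ)
      mono  : ∀ {Δ} (ρ ρ' : Sub Δ Γ′) → to ∘ ρ ≡ to ∘ ρ' → ρ ≡ ρ'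

  data Out (Γ : Con) (S : Pred Γ) : Set where
    always  : (∀ {Δ} (σ : Sub Δ Γ) → S σ) → Out Γ S
    smaller : Smaller Γ S → Out Γ S

  -- The sieve S is empty or representable, the index being a proposition
  -- because the names of the generators need not have decidable equality.
  record Sol (Γ : Con) (S : Pred Γ) : Set₁ where
    field
      I      : Set
      I-prop : (i i' : I) → i ≡ i'
      out    : I → Out Γ S
      index  : ∀ {Δ} (σ : Sub Δ Γ) → S σ → I

  open Smaller
  open Sol

  Out-map : ∀ {Γ} {S T : Pred Γ} → (∀ {Δ} (σ : Sub Δ Γ) → S σ → T σ) → (∀ {Δ} (σ : Sub Δ Γ) → T σ → S σ) → Out Γ S → Out Γ T
  Out-map f g (always h) = always (λ σ → f σ (h σ))
  Out-map f g (smaller s) = smaller record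
    { Γ′ = Γ′ s ; to = to s ; less = less s ; sound = f _ (sound s) ; fac = λ σ t → fac s σ (g σ t) ; mono = mono s }

  Sol-map : ∀ {Γ} {S T : Pred Γ} → (∀ {Δ} (σ : Sub Δ Γ) → S σ → T σ) → (∀ {Δ} (σ : Sub Δ Γ) → T σ → S σ) → Sol Γ S → Sol Γ T
  Sol-map f g s .I = I s
  Sol-map f g s .I-prop = I-prop s
  Sol-map f g s .out i = Out-map f g (out s i)
  Sol-map f g s .index σ t = index s σ (g σ t)

  Sol-always : ∀ {Γ} {S : Pred Γ} → (∀ {Δ} (σ : Sub Δ Γ) → S σ) → Sol Γ S
  Sol-always h .I = ⊤
  Sol-always h .I-prop _ _ = refl
  Sol-always h .out _ = always h
  Sol-always h .index _ _ = tt

  Sol-never : ∀ {Γ} {S : Pred Γ} → (∀ {Δ} (σ : Sub Δ Γ) → ¬ S σ) → Sol Γ S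
  Sol-never h .I = ⊥
  Sol-never h .I-prop ()
  Sol-never h .out ()
  Sol-never h .index σ s = h σ s

  -- Whether two generators coincide is not decided; their equality becomes part of the index, which
  -- is then empty in case of a clash.
  Sol-when : ∀ {Γ} {S : Pred Γ} {A : Set} {a b : A} → (a ≡ b → Sol Γ S) → (∀ {Δ} (σ : Sub Δ Γ) → S σ → a ≡ b) → Sol Γ S
  Sol-when {a = a} {b} f g .I = Σ (a ≡ b) (λ e → I (f e))
  Sol-when f g .I-prop (e , i) (e' , i') with uip e e'
  ... | refl = cong (e ,_) (I-prop (f e) i i')
  Sol-when f g .out (e , i) = out (f e) i
  Sol-when f g .index σ s = g σ s , index (f (g σ s)) σ s

  module _ {Γ : Con} {S T : Pred Γ} where
    both : (∀ {Δ Ξ} (σ : Sub Δ Γ) (δ : Sub Ξ Δ) → S σ → S (σ ∘ δ)) →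
           (s : Smaller Γ S) → Out (Γ′ s) (λ ρ → T (to s ∘ ρ)) → Out Γ (λ σ → S σ × T σ)
    both S-[] s (always h) = smaller record
      { Γ′ = Γ′ s ; to = to s ; less = less s
      ; sound = sound s , subst T (idr (to s)) (h id)
      ; fac = λ σ x → fac s σ (proj₁ x) ; mono = mono s }
    both S-[] s (smaller t) = smaller record
      { Γ′ = Γ′ t ; to = to s ∘ to t ; less = <-trans (less t) (less s)
      ; sound = S-[] (to s) (to t) (sound s) , sound t
      ; fac = λ { σ (x , y) → let ρ , e = fac s σ x
                                  ρ' , e' = fac t ρ (subst T (sym e) y)
                              in ρ' , trans (ass _ _ ρ') (trans (cong (to s ∘_) e') e) }
      ; mono = λ ρ ρ' e → mono t ρ ρ' (mono s _ _ (trans (sym (ass _ _ ρ)) (trans e (ass _ _ ρ')))) }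

    -- If S holds everywhere one stays over Γ, so that T may be solved by structural
    -- recursion; otherwise the context has become shorter.
    Sol-× : (∀ {Δ Ξ} (σ : Sub Δ Γ) (δ : Sub Ξ Δ) → S σ → S (σ ∘ δ)) → Sol Γ S →
            ((∀ {Δ} (σ : Sub Δ Γ) → S σ) → Sol Γ T) →
            ((s : Smaller Γ S) → Sol (Γ′ s) (λ ρ → T (to s ∘ ρ))) →
            Sol Γ (λ σ → S σ × T σ)
    Sol-× S-[] sol f g = record
      { I = Σ (I sol) (λ i → Rest (out sol i))
      ; I-prop = λ { (i , j) (i' , j') → lem i i' (I-prop sol i i') j j' }
      ; out = λ { (i , j) → outRest (out sol i) j }
      ; index = λ { σ (x , y) → let i = index sol σ x in i , indexRest (out sol i) σ x y } }
      where
      Rest : Out Γ S → Set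
      Rest (always h)  = I (f h)
      Rest (smaller s) = I (g s)
      Rest-prop : ∀ o (j j' : Rest o) → j ≡ j'
      Rest-prop (always h)  = I-prop (f h)
      Rest-prop (smaller s) = I-prop (g s)
      lem : ∀ i i' → i ≡ i' → ∀ j j' → _≡_ {A = Σ (I sol) (λ i → Rest (out sol i))} (i , j) (i' , j')
      lem i _ refl j j' = cong (i ,_) (Rest-prop (out sol i) j j')
      outRest : ∀ o → Rest o → Out Γ (λ σ → S σ × T σ)
      outRest (always h)  j = Out-map (λ σ t → h σ , t) (λ σ → proj₂) (out (f h) j)
      outRest (smaller s) j = both S-[] s (out (g s) j)
      indexRest : ∀ o {Δ} (σ : Sub Δ Γ) → S σ → T σ → Rest o
      indexRest (always h)  σ x y = index (f h) σ y
      indexRest (smaller s) σ x y = let ρ , e = fac s σ x in index (g s) ρ (subst T (sym e) y)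

  false≢true : false ≡ true → ⊥
  false≢true ()

  module _ {Γ : Con} (v : VCon Γ) (x : Var v) where
    private module R = Removal (remove v x)

    Hits : PTm Γ → Pred Γ
    Hits u σ = ⟦ x ⟧v [ σ ]P ≡ u [ σ ]P

    -- With `u⁻` the strengthening of `u` past `x`, the pullback along the section `⟨ id , u⁻ ⟩` of
    -- `Γ⁻ ▹ A⁻` is the equaliser of `x` and `u`. Its second projection is determined by `to`, so
    -- `to` is mono; and for `Ψ` equal to `Γ⁻` the field `count` says that exactly one variable is
    -- lost.
    assign : (u : PTm Γ) → proj₁ u ≡ proj₁ ⟦ x ⟧v → nj (rP u [ kill ⌜ x ⌝ (len Γ) ]) ≡ true → Smaller Γ (Hits u)
    assign u same n with R.str (rP u) u refl n (trans (cong (λ T → nj (rT T [ kill ⌜ x ⌝ (len Γ) ])) (trans same (sym R.typ))) (R.w-f R.A⁻))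
    ... | u⁻ , refl = record
      { Γ′ = P.Γ′ ; to = P.to
      ; less = ≤-trans (s≤s (m≤m+n (len P.Γ′) 0))
                 (≤-reflexive (trans (cong suc (+-identityʳ _)) (+-cancelʳ-≡ (len R.Γ⁻) _ _ (trans P.count (+-comm (len R.Γ⁻) (len Γ))))))
      ; sound = trans P.hit (trans (cong (u⁻ [_]P) (trans (sym (idl P.ω)) (sym P.comm))) ([∘]P u⁻ R.w P.to))
      ; fac = λ σ h → let ρ , e , _ = P.fac σ (R.w ∘ σ) (sym (idl _)) (trans h (sym ([∘]P u⁻ R.w σ))) in ρ , e
      ; mono = λ ρ ρ' e → P.mono ρ ρ' e (trans (ω-∘ ρ) (trans (cong (R.w ∘_) e) (sym (ω-∘ ρ')))) }
      where
      module P = Pullback (R.pull id u⁻ (R.wT-inj (trans same (trans (sym R.typ) (cong (_[ R.w ]T) (sym ([id]T R.A⁻)))))))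
      ω-∘ : ∀ {Δ} (ρ : Sub Δ P.Γ′) → P.ω ∘ ρ ≡ R.w ∘ (P.to ∘ ρ)
      ω-∘ ρ = trans (cong (_∘ ρ) (trans (sym (idl P.ω)) (sym P.comm))) (ass R.w P.to ρ)

    solveHits : (u : PTm Γ) → proj₁ u ≡ proj₁ ⟦ x ⟧v → Sol Γ (Hits u)
    solveHits u same = go (nj (rP u [ k ])) refl (view v u)
      where
      k = kill ⌜ x ⌝ (len Γ)
      go : ∀ b → nj (rP u [ k ]) ≡ b → Σ (Cov v) (λ c → ⟦ c ⟧ ≡ u) → Sol Γ (Hits u)
      go true n _ = record { I = ⊤ ; I-prop = λ _ _ → refl ; out = λ _ → smaller (assign u same n) ; index = λ _ _ → tt }
      go false n (inj₁ y , refl)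
        with ⌜⌝-inj v y x (kill-nj ⌜ x ⌝ (len Γ) ⌜ y ⌝ (⌜⌝-< v y) (trans (cong (λ r → nj (r [ k ])) (sym (rP-var v y))) n))
      ... | refl = Sol-always (λ σ → refl)
      -- Occurs check: u[σ] would be strictly heavier than x[σ].
      go false n (inj₂ (c , τ) , refl) = Sol-never λ σ h → <-irrefl (cong weight (trans (sym (rP-[] ⟦ x ⟧v σ)) (trans (cong rP h) (rP-[] _ σ)))) (heavy σ)
        where
        heavy : ∀ {Δ} (σ : Sub Δ Γ) → weight (rP ⟦ x ⟧v [ rS σ ]) < weight (rP (nM c [ τ ]P) [ rS σ ])
        heavy σ rewrite rP-gen c τ | rP-var v x =
          s≤s (occ-weightS ⌜ x ⌝ (len Γ) (rS τ) (rS σ) (rS-sc τ) (nj-S τ) n)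

  module _ {Γ : Con} (Θ : Tel Γ) where
    private
      n = size Θ
      v = vcon Γ

    V-back : ∀ {Δ} (σ : Sub Δ Γ) → Lσ n σ ⊚ V n (len Δ) ≡ V n (len Γ) ⊚ rS σ
    V-back {Δ} σ = L-V n (len Δ) (rS σ) (rS-length σ) (rS-sc σ)

    pTel-V : rS (pTel Θ) ⊚ V n (len Γ) ≡ idR (len Γ)
    pTel-V = trans (cong (_⊚ V n (len Γ)) (rS-pTel Θ)) (W-V n (len Γ))

    rP-pTel-V : ∀ (P : PTm Γ) → rP (P [ pTel Θ ]P) [ V n (len Γ) ] ≡ rP P
    rP-pTel-V P = trans (cong (_[ V n (len Γ) ]) (rP-[] P (pTel Θ))) (trans (sym ([⊚] (rP P) _ _)) (trans (cong (rP P [_]) pTel-V) (rP-sc P)))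

    rT-pTel-V : ∀ (A : Ty Γ) → rT (A [ pTel Θ ]T) [ V n (len Γ) ] ≡ rT A
    rT-pTel-V A = trans (cong (_[ V n (len Γ) ]) (rT-[] A (pTel Θ))) (trans (sym ([⊚] (rT A) _ _)) (trans (cong (rT A [_]) pTel-V) (rT-sc A)))

    data VarSplit (z : Var (vcon (Γ ▹▹ Θ))) : Set where
      outer : (y : Var v) → ⟦ y ⟧v [ pTel Θ ]P ≡ ⟦ z ⟧v → VarSplit z
      rigid : lookup ⌜ z ⌝ (V n (len Γ)) ≡ junk → (∀ {Δ} (σ : Sub Δ Γ) → lookup ⌜ z ⌝ (Lσ n σ) ≡ var ⌜ z ⌝) → VarSplit z

    varSplit : ∀ z → VarSplit z
    varSplit z with split n (len Γ) ⌜ z ⌝ (subst (⌜ z ⌝ <_) (len-▹▹ Θ) (⌜⌝-< (vcon _) z))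
    ... | rigid _ e f = rigid e (λ σ → f _ (rS σ) (rS-sc σ))
    ... | outer y h e f with ⌜⌝-surj v y h
    ... | y' , refl = outer y' (P-inj (trans (rP-[] ⟦ y' ⟧v (pTel Θ)) (trans (cong₂ _[_] (rP-var v y') (rS-pTel Θ))
                                 (trans (lookup-W n (len Γ) ⌜ y' ⌝ h) (trans (cong var (sym e)) (sym (rP-var _ z)))))))

    strVarΘ : ∀ z → nj (rP ⟦ z ⟧v [ V n (len Γ) ]) ≡ true → nj (rT (proj₁ ⟦ z ⟧v) [ V n (len Γ) ]) ≡ true →
              Σ (PTm Γ) (λ P → P [ pTel Θ ]P ≡ ⟦ z ⟧v)
    strVarΘ z m _ with varSplit z
    ... | outer y e = ⟦ y ⟧v , e
    ... | rigid e _ = ⊥-elim (false≢true (trans (sym (cong nj (trans (cong (_[ V n (len Γ) ]) (rP-var _ z)) e))) m))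

    module StrΘ = Strengthen (vcon (Γ ▹▹ Θ)) (pTel Θ) (V n (len Γ)) (V n (len Γ)) pTel-V
                    (λ T → trans (cong nj (rT-pTel-V T)) (nj-T T)) strVarΘ

    up-pTel : ∀ {Δ} (P : PTm Γ) (σ : Sub Δ Γ) → P [ pTel Θ ]P [ up Θ σ ]P ≡ P [ σ ]P [ pTel (proj₁ (subTel Θ σ)) ]P
    up-pTel P σ = trans (sym ([∘]P P _ _)) (trans (cong (P [_]P) (pTel-up Θ σ)) ([∘]P P σ _))

    -- The equation x = P with x a variable of Γ forces P to avoid Θ.
    solveVar : (x : Var v) (P : PTm (Γ ▹▹ Θ)) → proj₁ P ≡ proj₁ ⟦ x ⟧v [ pTel Θ ]T → Sol Γ (EqP n (rP (⟦ x ⟧v [ pTel Θ ]P)) (rP P))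
    solveVar x P same = go (nj (rP P [ V n (len Γ) ])) refl
      where
      X = ⟦ x ⟧v [ pTel Θ ]P
      X-V : ∀ {Δ} (σ : Sub Δ Γ) → nj (rP X [ Lσ n σ ] [ V n (len Δ) ]) ≡ true
      X-V {Δ} σ = trans (cong nj (trans (sym ([⊚] (rP X) (Lσ n σ) (V n (len Δ)))) (trans (cong (rP X [_]) (V-back σ))
        (trans ([⊚] (rP X) (V n (len Γ)) (rS σ)) (trans (cong (_[ rS σ ]) (rP-pTel-V ⟦ x ⟧v)) (sym (rP-[] ⟦ x ⟧v σ)))))))
        (nj-P (⟦ x ⟧v [ σ ]P))
      free : ∀ {Δ} (σ : Sub Δ Γ) → EqP n (rP X) (rP P) σ → nj (rP P [ V n (len Γ) ]) ≡ true
      free {Δ} σ e = nj-[] (rP P [ V n (len Γ) ]) (rS σ) (trans (cong nj (trans (sym ([⊚] (rP P) (V n (len Γ)) (rS σ)))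
        (trans (cong (rP P [_]) (sym (V-back σ))) (trans ([⊚] (rP P) (Lσ n σ) (V n (len Δ))) (cong (_[ V n (len Δ) ]) (sym e)))))) (X-V σ))
      go : ∀ b → nj (rP P [ V n (len Γ) ]) ≡ b → Sol Γ (EqP n (rP X) (rP P))
      go false m = Sol-never (λ σ e → false≢true (trans (sym m) (free σ e)))
      go true m with StrΘ.str (rP P) P refl m (trans (cong (λ T → nj (rT T [ V n (len Γ) ])) same) (trans (cong nj (rT-pTel-V (proj₁ ⟦ x ⟧v))) (nj-T _)))
      ... | u , refl = Sol-map
        (λ σ h → trans (sym (rP-up Θ σ X)) (trans (cong rP (trans (up-pTel ⟦ x ⟧v σ) (trans (cong (_[ pTel (proj₁ (subTel Θ σ)) ]P) h) (sym (up-pTel u σ))))) (rP-up Θ σ (u [ pTel Θ ]P))))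
        (λ {Δ} σ e → P-inj (trans (back ⟦ x ⟧v σ) (trans (cong (_[ V n (len Δ) ]) e) (sym (back u σ)))))
        (solveHits v x u (StrΘ.wT-inj same))
        where
        back : ∀ (P : PTm Γ) {Δ} (σ : Sub Δ Γ) → rP (P [ σ ]P) ≡ rP (P [ pTel Θ ]P) [ Lσ n σ ] [ V n (len Δ) ]
        back P {Δ} σ = trans (rP-[] P σ) (trans (cong (_[ rS σ ]) (sym (rP-pTel-V P))) (trans (sym ([⊚] (rP (P [ pTel Θ ]P)) (V n (len Γ)) (rS σ)))
          (trans (cong (rP (P [ pTel Θ ]P) [_]) (sym (V-back σ))) ([⊚] (rP (P [ pTel Θ ]P)) (Lσ n σ) (V n (len Δ))))))

    -- Every lifted substitution fixes a rigid variable, so it can equal only itself among rigid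
    -- variables and never an instance of a generator. Against an outer variable the sides are
    -- swapped and `solveVar` decides.
    unifyVar : (z : Var (vcon (Γ ▹▹ Θ))) (c : Cov (vcon (Γ ▹▹ Θ))) → proj₁ ⟦ z ⟧v ≡ proj₁ ⟦ c ⟧ → Sol Γ (EqP n (rP ⟦ z ⟧v) (rP ⟦ c ⟧))
    unifyVar z c same with varSplit z
    ... | outer y e = Sol-map (λ σ h → trans (cong (_[ _ ]) (cong rP (sym e))) h) (λ σ h → trans (cong (_[ _ ]) (cong rP e)) h)
                        (solveVar y ⟦ c ⟧ (trans (sym same) (cong proj₁ (sym e))))
    unifyVar z (inj₁ z') same | rigid j f with varSplit z'
    ... | outer y e = Sol-map (λ σ h → trans (sym h) (cong (_[ _ ]) (cong rP e))) (λ σ h → trans (cong (_[ _ ]) (cong rP e)) (sym h))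
                        (solveVar y ⟦ z ⟧v (trans same (cong proj₁ (sym e))))
    ... | rigid _ f' = Sol-when {a = z} {z'} (λ { refl → Sol-always (λ σ → refl) })
      (λ σ h → ⌜⌝-inj (vcon _) z z' (var-inj (trans (sym (fix z f σ)) (trans h (fix z' f' σ)))))
      where
      fix : ∀ z → (∀ {Δ} (σ : Sub Δ Γ) → lookup ⌜ z ⌝ (Lσ n σ) ≡ var ⌜ z ⌝) → ∀ {Δ} (σ : Sub Δ Γ) → rP ⟦ z ⟧v [ Lσ n σ ] ≡ var ⌜ z ⌝
      fix z f σ = trans (cong (_[ _ ]) (rP-var _ z)) (f σ)
    unifyVar z (inj₂ (k , τ)) same | rigid j f = Sol-never λ σ h → absurd (trans (sym (trans (cong (_[ _ ]) (rP-var _ z)) (f σ))) (trans h (cong (_[ _ ]) (rP-gen k τ))))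
      where
      absurd : ∀ {i k s} → var i ≡ con k s → ⊥
      absurd ()

  -- The recursion is lexicographic: `N` bounds the number of flexible variables and drops whenever
  -- a variable has been eliminated, which may enlarge the trees; otherwise the left tree `r` gets
  -- smaller.
  unifyP : ∀ N r {Γ} → len Γ ≤ N → (Θ : Tel Γ) (P P' : PTm (Γ ▹▹ Θ)) → proj₁ P ≡ proj₁ P' → rP P ≡ r →
           Sol Γ (EqP (size Θ) (rP P) (rP P'))
  unifyC : ∀ N r {Γ} → len Γ ≤ N → (Θ : Tel Γ) (c c' : Cov (vcon (Γ ▹▹ Θ))) → proj₁ ⟦ c ⟧ ≡ proj₁ ⟦ c' ⟧ → rP ⟦ c ⟧ ≡ r →
           Sol Γ (EqP (size Θ) (rP ⟦ c ⟧) (rP ⟦ c' ⟧))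
  unifyS : ∀ N s {Γ} → len Γ ≤ N → (Θ : Tel Γ) {Φ : Con} (u : VCon Φ) (τ τ' : Sub (Γ ▹▹ Θ) Φ) → rS τ ≡ s →
           Sol Γ (EqS (size Θ) (rS τ) (rS τ'))
  -- The last components may have different types until the solution `s` for the earlier ones is
  -- applied, so recursion is on the substituted terms and telescope.
  unifySmaller : ∀ N {Γ} → len Γ ≤ N → (Θ : Tel Γ) {Φ : Con} (A : Ty Φ) (τ τ' : Sub (Γ ▹▹ Θ) (Φ ▹ A)) →
           (s : Smaller Γ (EqS (size Θ) (rS (p ∘ τ)) (rS (p ∘ τ')))) →
           Sol (Γ′ s) (λ ρ → EqP (size Θ) (rP (Q A [ τ ]P)) (rP (Q A [ τ' ]P)) (to s ∘ ρ))
  unifyP N r le Θ P P' same e with coverP P | coverP P'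
  ... | c , refl | c' , refl = unifyC N r le Θ c c' same e
  unifyC N r le Θ (inj₁ z) c' same e = unifyVar Θ z c' same
  unifyC N r le Θ (inj₂ kτ) (inj₁ z) same e = Sol-map (λ σ → sym) (λ σ → sym) (unifyVar Θ z (inj₂ kτ) (sym same))
  unifyC N (var i) le Θ (inj₂ (k , τ)) (inj₂ (k' , τ')) same e with trans (sym (rP-gen k τ)) e
  ... | ()
  unifyC N junk le Θ (inj₂ (k , τ)) (inj₂ (k' , τ')) same e with trans (sym (rP-gen k τ)) e
  ... | ()
  unifyC N (con _ s) le Θ (inj₂ (k , τ)) (inj₂ (k' , τ')) same e = Sol-when {a = k} {k'}
    (λ { refl → Sol-map
      (λ σ h → trans (cong (_[ _ ]) (rP-gen k τ)) (trans (cong (con _) h) (cong (_[ _ ]) (sym (rP-gen k τ')))))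
      (λ σ h → proj₂ (con-inj (trans (sym (cong (_[ _ ]) (rP-gen k τ))) (trans h (cong (_[ _ ]) (rP-gen k τ'))))))
      (unifyS N s le Θ (vcon _) τ τ' (proj₂ (con-inj (trans (sym (rP-gen k τ)) e)))) })
    (λ σ h → name-inj (proj₁ (con-inj (trans (sym (cong (_[ _ ]) (rP-gen k τ))) (trans h (cong (_[ _ ]) (rP-gen k' τ')))))))
    where
    name-inj : ∀ {k k' : TmG} → _≡_ {A = Name} (inj₂ k) (inj₂ k') → k ≡ k'
    name-inj refl = refl
  unifyS N s le Θ ◇ᵛ τ τ' e = Sol-always (λ σ → cong (λ τ → rS τ ⊚ Lσ (size Θ) σ) (trans (◇η τ) (sym (◇η τ'))))
  unifyS N [] le Θ (u ▹ᵛ A) τ τ' e with trans (sym (rS-▹ A τ)) e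
  ... | ()
  unifyS N (t ∷ s) {Γ} le Θ (u ▹ᵛ A) τ τ' e = Sol-map
    (λ σ h → trans (cong (_⊚ Lσ n σ) (rS-▹ A τ)) (trans (cong₂ _∷_ (proj₂ h) (proj₁ h)) (cong (_⊚ Lσ n σ) (sym (rS-▹ A τ')))))
    (λ σ h → let h' = ∷-inj (trans (cong (_⊚ Lσ n σ) (sym (rS-▹ A τ))) (trans h (cong (_⊚ Lσ n σ) (rS-▹ A τ')))) in proj₂ h' , proj₁ h')
    (Sol-× {S = EqS n (rS (p ∘ τ)) (rS (p ∘ τ'))} {T = EqP n (rP (Q A [ τ ]P)) (rP (Q A [ τ' ]P))}
      (EqS-[] n {rS (p ∘ τ)} {rS (p ∘ τ')})
      (unifyS N s le Θ u (p ∘ τ) (p ∘ τ') (proj₂ (∷-inj (trans (sym (rS-▹ A τ)) e))))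
      -- Earlier components that agree under every substitution agree under `id`, hence are equal;
      -- so the last components have the same type.
      (λ h → unifyP N t le Θ (Q A [ τ ]P) (Q A [ τ' ]P)
               (trans (Q-type A τ) (trans (cong (A [_]T) (S-inj (trans (sym (unit (p ∘ τ))) (trans (h id) (unit (p ∘ τ')))))) (sym (Q-type A τ'))))
               (proj₁ (∷-inj (trans (sym (rS-▹ A τ)) e))))
      (unifySmaller N le Θ A τ τ'))
    where
    n = size Θ
    unit : ∀ {Φ} (τ : Sub (Γ ▹▹ Θ) Φ) → rS τ ⊚ Lσ n (id {Γ}) ≡ rS τ
    unit τ = trans (cong (rS τ ⊚_) (Lσ-id Θ)) (rS-sc τ)
  unifySmaller zero le Θ A τ τ' s with ≤-trans (less s) le
  ... | ()
  unifySmaller (suc N) le Θ A τ τ' s = subst (λ m → Sol (Γ′ s) (λ ρ → EqP m (rP (Q A [ τ ]P)) (rP (Q A [ τ' ]P)) (to s ∘ ρ))) (size-sub Θ (to s)) (Sol-map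
    (λ ρ h → trans (move (Q A [ τ ]P) ρ) (trans h (sym (move (Q A [ τ' ]P) ρ))))
    (λ ρ h → trans (sym (move (Q A [ τ ]P) ρ)) (trans h (move (Q A [ τ' ]P) ρ)))
    (unifyP N _ (≤-pred (≤-trans (less s) le)) Θ' (Q A [ τ ]P [ u ]P) (Q A [ τ' ]P [ u ]P)
      (trans (same τ) (trans (cong (A [_]T) (S-inj (trans (rS-∘up Θ (to s) (p ∘ τ)) (trans (sound s) (sym (rS-∘up Θ (to s) (p ∘ τ'))))))) (sym (same τ')))) refl))
    where
    Θ' = proj₁ (subTel Θ (to s))
    u = up Θ (to s)
    same : ∀ τ → proj₁ (Q A [ τ ]P [ u ]P) ≡ A [ (p ∘ τ) ∘ u ]T
    same τ = trans (cong (_[ u ]T) (Q-type A τ)) (sym ([∘]T A (p ∘ τ) u))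
    move : ∀ (P : PTm (_ ▹▹ Θ)) {Δ} (ρ : Sub Δ (Γ′ s)) → rP P [ Lσ (size Θ') (to s ∘ ρ) ] ≡ rP (P [ u ]P) [ Lσ (size Θ') ρ ]
    move P ρ = trans ([]-Lσ-∘ (size Θ') (rP P) (to s) ρ)
      (cong (_[ Lσ (size Θ') ρ ]) (trans (cong (λ m → rP P [ Lσ m (to s) ]) (size-sub Θ (to s))) (sym (rP-up Θ (to s) P))))

  unifyT : ∀ {Γ} (Θ : Tel Γ) (A A' : Ty (Γ ▹▹ Θ)) → Sol Γ (EqP (size Θ) (rT A) (rT A'))
  unifyT {Γ} Θ A A' with coverT A | coverT A'
  ... | (j , τ) , refl | (j' , τ') , refl = Sol-when {a = j} {j'}
    (λ { refl → Sol-map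
      (λ σ h → trans (cong (_[ _ ]) (rT-gen j τ)) (trans (cong (con _) h) (cong (_[ _ ]) (sym (rT-gen j τ')))))
      (λ σ h → proj₂ (con-inj (trans (sym (cong (_[ _ ]) (rT-gen j τ))) (trans h (cong (_[ _ ]) (rT-gen j τ'))))))
      (unifyS (len Γ) _ ≤-refl Θ (vcon _) τ τ' refl) })
    (λ σ h → name-inj (proj₁ (con-inj (trans (sym (cong (_[ _ ]) (rT-gen j τ))) (trans h (cong (_[ _ ]) (rT-gen j' τ')))))))
    where
    name-inj : ∀ {k k' : TyG} → _≡_ {A = Name} (inj₁ k) (inj₁ k') → k ≡ k'
    name-inj refl = refl

-- Generic terms of a given shape

module Families {C : CwF} (cell : IsCellularCwF C) where
  open Unify cell public

  -- The carrier does not depend on the context. Elements are trees on which substitutions act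
  -- through their lifts, and typing is left to the predicate of `Fam`, so elements over different
  -- telescopes compare without transport.
  record RawAct : Set₁ where
    field
      Car   : Set
      act   : Car → ∀ {Δ Ξ} → Sub Ξ Δ → Car
      act-∘ : ∀ x {Γ Δ Ξ} (σ : Sub Δ Γ) (δ : Sub Ξ Δ) → act x (σ ∘ δ) ≡ act (act x σ) δ
  open RawAct

  Tms Subs : ℕ → RawAct
  Tms n .Car = RTm
  Tms n .act r σ = r [ Lσ n σ ]
  Tms n .act-∘ r = []-Lσ-∘ n r
  Subs n .Car = RSub
  Subs n .act r σ = r ⊚ Lσ n σ
  Subs n .act-∘ r = ⊚-Lσ-∘ n r

  One : RawAct
  One .Car = ⊤
  One .act _ _ = tt
  One .act-∘ _ _ _ = refl

  _⊗_ : RawAct → RawAct → RawAct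
  (X ⊗ Y) .Car = Car X × Car Y
  (X ⊗ Y) .act (x , y) σ = act X x σ , act Y y σ
  (X ⊗ Y) .act-∘ (x , y) σ δ = cong₂ _,_ (act-∘ X x σ δ) (act-∘ Y y σ δ)

  -- The presheaf on C/Γ whose elements over σ are the x satisfying Q σ x is a
  -- coproduct of representables.
  record Fam (Γ : Con) (X : RawAct) (Q : ∀ {Δ} → Sub Δ Γ → Car X → Set) : Set₁ where
    field
      I    : Set
      obj  : I → Con
      to   : ∀ i → Sub (obj i) Γ
      gen  : I → Car X
      good : ∀ i → Q (to i) (gen i)
      fac  : ∀ {Δ} (σ : Sub Δ Γ) x → Q σ x → Σ I (λ i → Σ (Sub Δ (obj i)) (λ ρ → to i ∘ ρ ≡ σ × act X (gen i) ρ ≡ x))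
      uniq : ∀ {Δ i i'} (ρ : Sub Δ (obj i)) (ρ' : Sub Δ (obj i')) → to i ∘ ρ ≡ to i' ∘ ρ' →
             act X (gen i) ρ ≡ act X (gen i') ρ' → _≡_ {A = Σ I (λ i → Sub Δ (obj i))} (i , ρ) (i' , ρ')
  open Fam

  module _ {Γ : Con} {S : Pred Γ} where
    private
      obj′ : Out Γ S → Con
      obj′ (always h)  = Γ
      obj′ (smaller s) = Smaller.Γ′ s
      to′ : ∀ o → Sub (obj′ o) Γ
      to′ (always h)  = id
      to′ (smaller s) = Smaller.to s
      good′ : ∀ o → S (to′ o)
      good′ (always h)  = h id
      good′ (smaller s) = Smaller.sound s
      fac′ : ∀ o {Δ} (σ : Sub Δ Γ) → S σ → Σ (Sub Δ (obj′ o)) (λ ρ → to′ o ∘ ρ ≡ σ)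
      fac′ (always h)  σ x = σ , idl σ
      fac′ (smaller s) σ x = Smaller.fac s σ x
      mono′ : ∀ o {Δ} (ρ ρ' : Sub Δ (obj′ o)) → to′ o ∘ ρ ≡ to′ o ∘ ρ' → ρ ≡ ρ'
      mono′ (always h)  ρ ρ' e = trans (sym (idl ρ)) (trans e (idl ρ'))
      mono′ (smaller s) = Smaller.mono s

    Fam-Sol : Sol Γ S → Fam Γ One (λ σ _ → S σ)
    Fam-Sol sol = record
      { I = Sol.I sol ; obj = λ i → obj′ (Sol.out sol i) ; to = λ i → to′ (Sol.out sol i) ; gen = λ _ → tt
      ; good = λ i → good′ (Sol.out sol i)
      ; fac = λ σ _ x → let i = Sol.index sol σ x
                            ρ , e = fac′ (Sol.out sol i) σ x in i , ρ , e , refl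
      ; uniq = λ {_} {i} {i'} ρ ρ' e _ → lem (Sol.I-prop sol i i') ρ ρ' e }
      where
      lem : ∀ {i i'} → i ≡ i' → ∀ {Δ} (ρ : Sub Δ (obj′ (Sol.out sol i))) (ρ' : Sub Δ (obj′ (Sol.out sol i'))) →
            to′ (Sol.out sol i) ∘ ρ ≡ to′ (Sol.out sol i') ∘ ρ' →
            _≡_ {A = Σ (Sol.I sol) (λ i → Sub Δ (obj′ (Sol.out sol i)))} (i , ρ) (i' , ρ')
      lem {i} refl ρ ρ' e = cong (i ,_) (mono′ (Sol.out sol i) ρ ρ' e)

  Fam-never : ∀ {Γ X} {Q : ∀ {Δ} → Sub Δ Γ → Car X → Set} → (∀ {Δ} (σ : Sub Δ Γ) x → ¬ Q σ x) → Fam Γ X Q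
  Fam-never h = record
    { I = ⊥ ; obj = λ () ; to = λ () ; gen = λ () ; good = λ () ; fac = λ σ x q → ⊥-elim (h σ x q) ; uniq = λ { {_} {()} } }

  module _ {Γ : Con} {X Y : RawAct} {Q : ∀ {Δ} → Sub Δ Γ → Car X → Set} {Q' : ∀ {Δ} → Sub Δ Γ → Car Y → Set} where
    Fam-map : (f : Car X → Car Y) → (∀ x {Δ Ξ} (δ : Sub Ξ Δ) → f (act X x δ) ≡ act Y (f x) δ) → (∀ {x x'} → f x ≡ f x' → x ≡ x') →
              (∀ {Δ} (σ : Sub Δ Γ) x → Q σ x → Q' σ (f x)) →
              (∀ {Δ} (σ : Sub Δ Γ) y → Q' σ y → Σ (Car X) (λ x → f x ≡ y × Q σ x)) →
              Fam Γ X Q → Fam Γ Y Q'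
    Fam-map f f-act f-inj sound cover F = record
      { I = I F ; obj = obj F ; to = to F ; gen = λ i → f (gen F i) ; good = λ i → sound _ _ (good F i)
      ; fac = λ { σ y q' → let x , e , q = cover σ y q'
                               i , ρ , h , h' = fac F σ x q
                           in i , ρ , h , trans (sym (f-act (gen F i) ρ)) (trans (cong f h') e) }
      ; uniq = λ {_} {i} {i'} ρ ρ' e e' → uniq F ρ ρ' e (f-inj (trans (f-act (gen F i) ρ) (trans e' (sym (f-act (gen F i') ρ'))))) }

  module _ {Γ : Con} {X : RawAct} {Q : ∀ {Δ} → Sub Δ Γ → Car X → Set} where
    Fam-when : {A : Set} → ((a a' : A) → a ≡ a') → (A → Fam Γ X Q) → (∀ {Δ} (σ : Sub Δ Γ) x → Q σ x → A) → Fam Γ X Q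
    Fam-when {A} A-prop F a = record
      { I = Σ A (λ a → I (F a)) ; obj = λ { (a , i) → obj (F a) i } ; to = λ { (a , i) → to (F a) i }
      ; gen = λ { (a , i) → gen (F a) i } ; good = λ { (a , i) → good (F a) i }
      ; fac = λ σ x q → let i , rest = fac (F (a σ x q)) σ x q in (a σ x q , i) , rest
      ; uniq = λ { {_} {a , i} {a' , i'} ρ ρ' e e' → lem (A-prop a a') i i' ρ ρ' e e' } }
      where
      lem : ∀ {a a'} → a ≡ a' → ∀ i i' {Δ} (ρ : Sub Δ (obj (F a) i)) (ρ' : Sub Δ (obj (F a') i')) → to (F a) i ∘ ρ ≡ to (F a') i' ∘ ρ' →
            act X (gen (F a) i) ρ ≡ act X (gen (F a') i') ρ' →
            _≡_ {A = Σ (Σ A (λ a → I (F a))) (λ { (a , i) → Sub Δ (obj (F a) i) })} ((a , i) , ρ) ((a' , i') , ρ')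
      lem {a} refl i i' ρ ρ' e e' with uniq (F a) ρ ρ' e e'
      ... | refl = refl

    module _ {K : Set} {Qᵏ : K → ∀ {Δ} → Sub Δ Γ → Car X → Set}
             (F : ∀ k → Fam Γ X (Qᵏ k))
             (stable : ∀ k {Δ Ξ} (σ : Sub Δ Γ) (δ : Sub Ξ Δ) x → Qᵏ k σ x → Qᵏ k (σ ∘ δ) (act X x δ))
             (disjoint : ∀ {k k' Δ} (σ : Sub Δ Γ) x → Qᵏ k σ x → Qᵏ k' σ x → k ≡ k')
             (sound : ∀ k {Δ} (σ : Sub Δ Γ) x → Qᵏ k σ x → Q σ x)
             (cover : ∀ {Δ} (σ : Sub Δ Γ) x → Q σ x → Σ K (λ k → Qᵏ k σ x)) where
      -- Splitting along an invariant of elements, such as the shape: stability passes the invariant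
      -- of a generic element to all its instances, so instances with different invariants never
      -- coincide.
      Fam-⨿ : Fam Γ X Q
      Fam-⨿ = record
        { I = Σ K (λ k → I (F k)) ; obj = λ { (k , i) → obj (F k) i } ; to = λ { (k , i) → to (F k) i }
        ; gen = λ { (k , i) → gen (F k) i } ; good = λ { (k , i) → sound k _ _ (good (F k) i) }
        ; fac = λ σ x q → let k , q' = cover σ x q
                              i , rest = fac (F k) σ x q' in (k , i) , rest
        ; uniq = λ { {_} {k , i} {k' , i'} ρ ρ' e e' →
            lem (disjoint _ _ (stable k (to (F k) i) ρ _ (good (F k) i))
                  (subst₂ (Qᵏ k') (sym e) (sym e') (stable k' (to (F k') i') ρ' _ (good (F k') i')))) i i' ρ ρ' e e' } }
        where
        lem : ∀ {a a'} → a ≡ a' → ∀ i i' {Δ} (ρ : Sub Δ (obj (F a) i)) (ρ' : Sub Δ (obj (F a') i')) → to (F a) i ∘ ρ ≡ to (F a') i' ∘ ρ' →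
              act X (gen (F a) i) ρ ≡ act X (gen (F a') i') ρ' →
              _≡_ {A = Σ (Σ K (λ a → I (F a))) (λ { (a , i) → Sub Δ (obj (F a) i) })} ((a , i) , ρ) ((a' , i') , ρ')
        lem {a} refl i i' ρ ρ' e e' with uniq (F a) ρ ρ' e e'
        ... | refl = refl

  module _ {Γ : Con} {X Y : RawAct} {Q₁ : ∀ {Δ} → Sub Δ Γ → Car X → Set} {Q : ∀ {Δ} → Sub Δ Γ → Car X × Car Y → Set}
           (F : Fam Γ X Q₁) {Q₂ : ∀ i {Δ} → Sub Δ (obj F i) → Car Y → Set}
           (G : ∀ i → Fam (obj F i) Y (Q₂ i))
           (sound : ∀ i {Δ} (δ : Sub Δ (obj F i)) y → Q₂ i δ y → Q (to F i ∘ δ) (act X (gen F i) δ , y))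
           (elim₁ : ∀ {Δ} (σ : Sub Δ Γ) x y → Q σ (x , y) → Q₁ σ x)
           (elim₂ : ∀ i {Δ} (δ : Sub Δ (obj F i)) y → Q (to F i ∘ δ) (act X (gen F i) δ , y) → Q₂ i δ y) where
    -- The second component needs to be analysed only over the generic first components, because the
    -- first component of any pair factors through one of them.
    Fam-Σ : Fam Γ (X ⊗ Y) Q
    Fam-Σ = record
      { I = Σ (I F) (λ i → I (G i)) ; obj = λ { (i , j) → obj (G i) j } ; to = λ { (i , j) → to F i ∘ to (G i) j }
      ; gen = λ { (i , j) → act X (gen F i) (to (G i) j) , gen (G i) j }
      ; good = λ { (i , j) → sound i _ _ (good (G i) j) }
      ; fac = λ { σ (x , y) q → fac₁ σ x y q (fac F σ x (elim₁ σ x y q)) }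
      ; uniq = λ { {_} {i , j} {i' , j'} ρ ρ' e e' →
          lem (uniq F (to (G i) j ∘ ρ) (to (G i') j' ∘ ρ') (trans (sym (ass _ _ ρ)) (trans e (ass _ _ ρ')))
                (trans (act-∘ X (gen F i) _ ρ) (trans (cong proj₁ e') (sym (act-∘ X (gen F i') _ ρ')))))
              j j' ρ ρ' refl refl (cong proj₂ e') } }
      where
      fac₁ : ∀ {Δ} (σ : Sub Δ Γ) x y → Q σ (x , y) → Σ (I F) (λ i → Σ (Sub Δ (obj F i)) (λ ρ → to F i ∘ ρ ≡ σ × act X (gen F i) ρ ≡ x)) →
             Σ (Σ (I F) (λ i → I (G i))) (λ { (i , j) → Σ (Sub Δ (obj (G i) j)) (λ ρ → (to F i ∘ to (G i) j) ∘ ρ ≡ σ ×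
               (act X (act X (gen F i) (to (G i) j)) ρ , act Y (gen (G i) j) ρ) ≡ (x , y)) })
      fac₁ σ x y q (i , ρ , refl , refl) with fac (G i) ρ y (elim₂ i ρ y q)
      ... | j , ρ' , refl , refl = (i , j) , ρ' , ass _ _ ρ' , cong (_, _) (sym (act-∘ X (gen F i) _ ρ'))
      lem : ∀ {i i' Δ} {δ : Sub Δ (obj F i)} {δ' : Sub Δ (obj F i')} → _≡_ {A = Σ (I F) (λ i → Sub Δ (obj F i))} (i , δ) (i' , δ') →
            ∀ j j' (ρ : Sub Δ (obj (G i) j)) (ρ' : Sub Δ (obj (G i') j')) → to (G i) j ∘ ρ ≡ δ → to (G i') j' ∘ ρ' ≡ δ' →
            act Y (gen (G i) j) ρ ≡ act Y (gen (G i') j') ρ' →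
            _≡_ {A = Σ (Σ (I F) (λ i → I (G i))) (λ { (i , j) → Sub Δ (obj (G i) j) })} ((i , j) , ρ) ((i' , j') , ρ')
      lem {i} refl j j' ρ ρ' h h' e with uniq (G i) ρ ρ' (trans h (sym h')) e
      ... | refl = refl

  module _ {Γ : Con} (Θ : Tel Γ) where
    rP-upⁿ : ∀ {n Δ} → size Θ ≡ n → (σ : Sub Δ Γ) (P : PTm (Γ ▹▹ Θ)) → rP (P [ up Θ σ ]P) ≡ rP P [ Lσ n σ ]
    rP-upⁿ refl σ P = rP-up Θ σ P

    rT-upⁿ : ∀ {n Δ} → size Θ ≡ n → (σ : Sub Δ Γ) (A : Ty (Γ ▹▹ Θ)) → rT (A [ up Θ σ ]T) ≡ rT A [ Lσ n σ ]
    rT-upⁿ refl σ A = trans (rT-[] A _) (cong (rT A [_]) (rS-up Θ σ))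

    rS-upⁿ : ∀ {n Δ Φ} → size Θ ≡ n → (σ : Sub Δ Γ) (τ : Sub (Γ ▹▹ Θ) Φ) → rS (τ ∘ up Θ σ) ≡ rS τ ⊚ Lσ n σ
    rS-upⁿ refl σ τ = rS-∘up Θ σ τ

    rP-scⁿ : ∀ {n} → size Θ ≡ n → (P : PTm (Γ ▹▹ Θ)) → rP P [ idR (len Γ ⊕ n) ] ≡ rP P
    rP-scⁿ refl P = trans (cong (λ d → rP P [ idR d ]) (sym (len-▹▹ Θ))) (rP-sc P)

    rS-scⁿ : ∀ {n Φ} → size Θ ≡ n → (τ : Sub (Γ ▹▹ Θ) Φ) → rS τ ⊚ idR (len Γ ⊕ n) ≡ rS τ
    rS-scⁿ refl τ = trans (cong (λ d → rS τ ⊚ idR d) (sym (len-▹▹ Θ))) (rS-sc τ)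

    sk-up : ∀ {n Δ} → size Θ ≡ n → (σ : Sub Δ Γ) (P : PTm (Γ ▹▹ Θ)) → sk n (len Δ) (rP P [ Lσ n σ ]) ≡ sk n (len Γ) (rP P)
    sk-up sz σ P = sk-L _ (rS σ) (rS-length σ) (rS-sc σ) (nj-S σ) (rP P) (rP-scⁿ sz P) (nj-P P)

    skS-up : ∀ {n Δ Φ} → size Θ ≡ n → (σ : Sub Δ Γ) (τ : Sub (Γ ▹▹ Θ) Φ) → skS n (len Δ) (rS τ ⊚ Lσ n σ) ≡ skS n (len Γ) (rS τ)
    skS-up sz σ τ = skS-L _ (rS σ) (rS-length σ) (rS-sc σ) (nj-S σ) (rS τ) (rS-scⁿ sz τ) (nj-S τ)

    rP-pTelⁿ : ∀ {n} → size Θ ≡ n → (P : PTm Γ) → rP (P [ pTel Θ ]P) ≡ rP P [ W n (len Γ) ]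
    rP-pTelⁿ refl P = trans (rP-[] P (pTel Θ)) (cong (rP P [_]) (rS-pTel Θ))

  W-inj : ∀ n {Γ} (P P' : PTm Γ) → rP P [ W n (len Γ) ] ≡ rP P' [ W n (len Γ) ] → P ≡ P'
  W-inj n {Γ} P P' e = P-inj (trans (sym (back P)) (trans (cong (_[ V n (len Γ) ]) e) (back P')))
    where
    back : ∀ P → rP P [ W n (len Γ) ] [ V n (len Γ) ] ≡ rP P
    back P = trans (sym ([⊚] (rP P) (W n (len Γ)) (V n (len Γ)))) (trans (cong (rP P [_]) (W-V n (len Γ))) (rP-sc P))

  Lift : ∀ {Γ} → Tel Γ → Con → Set
  Lift {Γ} Θ Δ = Σ (Tel Δ) (λ Θ' → Sub (Δ ▹▹ Θ') (Γ ▹▹ Θ))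

  -- Stated for an arbitrary pair in `Lift Θ Δ`, so that `subTel-∘` moves telescope and lift
  -- together in one `subst`.
  TypedP : ∀ {Γ} (Θ : Tel Γ) (A : Ty (Γ ▹▹ Θ)) → RTm → ∀ {Δ} → Lift Θ Δ → Set
  TypedP Θ A r {Δ} (Θ' , υ) = Σ (PTm (Δ ▹▹ Θ')) (λ P → rP P ≡ r × proj₁ P ≡ A [ υ ]T)

  TypedS : ∀ {Γ} (Θ : Tel Γ) (Φ : Con) → RSub → ∀ {Δ} → Lift Θ Δ → Set
  TypedS Θ Φ r {Δ} (Θ' , υ) = Σ (Sub (Δ ▹▹ Θ') Φ) (λ τ → rS τ ≡ r)

  TypedT : ∀ {Γ} (Θ : Tel Γ) → RTm → ∀ {Δ} → Lift Θ Δ → Set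
  TypedT Θ r {Δ} (Θ' , υ) = Σ (Ty (Δ ▹▹ Θ')) (λ A → rT A ≡ r)

  -- The length `n` is kept apart from `size Θ` because a substituted telescope has the same size
  -- only propositionally, while the carrier `Tms n` must stay fixed.
  QP : ∀ n {Γ} (Θ : Tel Γ) (A : Ty (Γ ▹▹ Θ)) → RTm → ∀ {Δ} → Sub Δ Γ → RTm → Set
  QP n Θ A s {Δ} σ r = TypedP Θ A r (subTel Θ σ) × sk n (len Δ) r ≡ s

  QS : ∀ n {Γ} (Θ : Tel Γ) (Φ : Con) → RSub → ∀ {Δ} → Sub Δ Γ → RSub → Set
  QS n Θ Φ s {Δ} σ r = TypedS Θ Φ r (subTel Θ σ) × skS n (len Δ) r ≡ s

  module _ {Γ Δ : Con} (Θ : Tel Γ) (σ : Sub Δ Γ) where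
    private
      Θσ = proj₁ (subTel Θ σ)

    TypedP-∘ : ∀ {Ξ} (δ : Sub Ξ Δ) {A r} → TypedP Θσ (A [ up Θ σ ]T) r (subTel Θσ δ) → TypedP Θ A r (subTel Θ (σ ∘ δ))
    TypedP-∘ δ {A} {r} (P , e , h) = subst (TypedP Θ A r) (sym (subTel-∘ Θ σ δ)) (P , e , trans h (sym ([∘]T A _ _)))

    TypedP-∘⁻ : ∀ {Ξ} (δ : Sub Ξ Δ) {A r} → TypedP Θ A r (subTel Θ (σ ∘ δ)) → TypedP Θσ (A [ up Θ σ ]T) r (subTel Θσ δ)
    TypedP-∘⁻ δ {A} {r} P with subst (TypedP Θ A r) (subTel-∘ Θ σ δ) P
    ... | P' , e , h = P' , e , trans h ([∘]T A _ _)

    TypedS-∘ : ∀ {Ξ} (δ : Sub Ξ Δ) {Φ r} → TypedS Θσ Φ r (subTel Θσ δ) → TypedS Θ Φ r (subTel Θ (σ ∘ δ))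
    TypedS-∘ δ {Φ} {r} τ = subst (TypedS Θ Φ r) (sym (subTel-∘ Θ σ δ)) τ

    TypedS-∘⁻ : ∀ {Ξ} (δ : Sub Ξ Δ) {Φ r} → TypedS Θ Φ r (subTel Θ (σ ∘ δ)) → TypedS Θσ Φ r (subTel Θσ δ)
    TypedS-∘⁻ δ {Φ} {r} τ = subst (TypedS Θ Φ r) (subTel-∘ Θ σ δ) τ

    module _ {n : ℕ} (sz : size Θ ≡ n) where
      szσ : size Θσ ≡ n
      szσ = trans (size-sub Θ σ) sz

      QP-[] : ∀ {Ξ} (δ : Sub Ξ Δ) {A s} r → QP n Θ A s σ r → QP n Θ A s (σ ∘ δ) (r [ Lσ n δ ])
      QP-[] δ {A} r ((P , refl , h) , e) =
        TypedP-∘ δ {A} (P [ up Θσ δ ]P , rP-upⁿ Θσ szσ δ P , cong (_[ up Θσ δ ]T) h) , trans (sk-up Θσ szσ δ P) e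

      QS-[] : ∀ {Ξ} (δ : Sub Ξ Δ) {Φ s} r → QS n Θ Φ s σ r → QS n Θ Φ s (σ ∘ δ) (r ⊚ Lσ n δ)
      QS-[] δ {Φ} r ((τ , refl) , e) = TypedS-∘ δ (τ ∘ up Θσ δ , rS-upⁿ Θσ szσ δ τ) , trans (skS-up Θσ szσ δ τ) e

  sk-free : ∀ n d t → nj (t [ V n d ]) ≡ true → sk n d t ≡ junk
  sk-free n d t e = cong (λ b → if b then junk else sk′ n d t) e

  sk-rigid : ∀ n d t → nj (t [ V n d ]) ≡ false → sk n d t ≡ sk′ n d t
  sk-rigid n d t e = cong (λ b → if b then junk else sk′ n d t) e

  sk-junk : ∀ n d t → nj t ≡ true → sk n d t ≡ junk → nj (t [ V n d ]) ≡ true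
  sk-junk n d t m e with nj (t [ V n d ])
  ... | true = refl
  sk-junk n d (var z) m () | false
  sk-junk n d (con k s) m () | false

  sk-var : ∀ n d t z → sk n d t ≡ var z → t ≡ var z × nj (t [ V n d ]) ≡ false
  sk-var n d t z e with nj (t [ V n d ])
  sk-var n d (var _) z e | false = e , refl

  sk-con : ∀ n d t {k s} → sk n d t ≡ con k s → Σ RSub (λ r → t ≡ con k r × skS n d r ≡ s)
  sk-con n d t e with nj (t [ V n d ])
  sk-con n d (con k r) refl | false = r , refl , refl

  conView : ∀ {Γ} (P : PTm Γ) {k s} → rP P ≡ con k s →
            Σ TmG (λ c → Σ (Sub Γ (cM c)) (λ τ → inj₂ c ≡ k × rS τ ≡ s × nM c [ τ ]P ≡ P))
  conView P e with coverP P
  ... | inj₁ x , refl = case trans (sym (rP-var _ x)) e of λ ()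
  ... | inj₂ (c , τ) , refl = let h , h' = con-inj (trans (sym (rP-gen c τ)) e) in c , τ , h , h' , refl

  -- The telescope is a final segment of the context, so an outer variable has its type over `Γ` and
  -- strengthening takes the type along.
  strFree : ∀ {Γ} (Θ : Tel Γ) (P : PTm (Γ ▹▹ Θ)) → nj (rP P [ V (size Θ) (len Γ) ]) ≡ true → Σ (PTm Γ) (λ u → u [ pTel Θ ]P ≡ P)
  strFree {Γ} Θ P m with coverP P
  ... | inj₁ z , refl with varSplit Θ z
  ...   | outer y e = ⟦ y ⟧v , e
  ...   | rigid e _ = ⊥-elim (false≢true (trans (sym (cong nj (trans (cong (_[ V (size Θ) (len Γ) ]) (rP-var _ z)) e))) m))
  strFree {Γ} Θ P m | inj₂ (c , τ) , refl
    with StrΘ.strS Θ (rS τ) (vcon _) τ refl (trans (cong (λ r → nj (r [ V (size Θ) (len Γ) ])) (sym (rP-gen c τ))) m)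
  ... | τ⁻ , refl = nM c [ τ⁻ ]P , sym ([∘]P (nM c) τ⁻ (pTel Θ))

  module _ {Γ : Con} (Θ : Tel Γ) (A : Ty (Γ ▹▹ Θ)) where
    private
      n = size Θ
      ΘB : ∀ {B : Ty Γ} → Tel (Γ ▹ B)
      ΘB = proj₁ (subTel Θ p)

      freeGen : ∀ {B : Ty Γ} → PTm ((Γ ▹ B) ▹▹ ΘB {B})
      freeGen {B} = Q B [ pTel ΘB ]P

      freeGen-[] : ∀ {B : Ty Γ} {Δ} (ρ : Sub Δ (Γ ▹ B)) → rP (freeGen {B}) [ Lσ n ρ ] ≡ rP (Q B [ ρ ]P) [ W n (len Δ) ]
      freeGen-[] {B} ρ = trans (sym (rP-upⁿ ΘB (size-sub Θ p) ρ freeGen)) (trans (cong rP (up-pTel ΘB (Q B) ρ))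
        (rP-pTelⁿ (proj₁ (subTel ΘB ρ)) (trans (size-sub ΘB ρ) (size-sub Θ p)) (Q B [ ρ ]P)))

      up-type : ∀ {B : Ty Γ} → B [ pTel Θ ]T ≡ A → ∀ {Δ} (σ : Sub Δ Γ) → A [ up Θ σ ]T ≡ B [ σ ]T [ pTel (proj₁ (subTel Θ σ)) ]T
      up-type {B} refl σ = trans (sym ([∘]T B _ _)) (trans (cong (B [_]T) (pTel-up Θ σ)) ([∘]T B _ _))

    -- A Θ-free term of type A is a term over Γ, so that it is classified by an
    -- extension of Γ, provided that A is Θ-free too.
    famFree : Fam Γ (Tms n) (QP n Θ A junk)
    famFree = Fam-when uip F λ { {Δ} σ r ((P , refl , h) , e) → isFree σ P h (sk-junk n (len Δ) (rP P) (nj-P P) e) }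
      where
      strP : ∀ {Δ} (σ : Sub Δ Γ) (P : PTm (Δ ▹▹ proj₁ (subTel Θ σ))) → nj (rP P [ V n (len Δ) ]) ≡ true →
             Σ (PTm Δ) (λ u → u [ pTel (proj₁ (subTel Θ σ)) ]P ≡ P)
      strP {Δ} σ P m = strFree (proj₁ (subTel Θ σ)) P (trans (cong (λ m → nj (rP P [ V m (len Δ) ])) (size-sub Θ σ)) m)

      -- A term free of the telescope comes from `Δ` and so does its type, an instance of `A`; as
      -- substitution cannot remove junk, `A` was free already.
      isFree : ∀ {Δ} (σ : Sub Δ Γ) (P : PTm (Δ ▹▹ proj₁ (subTel Θ σ))) → proj₁ P ≡ A [ up Θ σ ]T →
               nj (rP P [ V n (len Δ) ]) ≡ true → nj (rT A [ V n (len Γ) ]) ≡ true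
      isFree {Δ} σ P h m with strP σ P m
      ... | u , refl = nj-[] (rT A [ V n (len Γ) ]) (rS σ) (trans (cong nj eq) (nj-T (proj₁ u)))
        where
        eq : rT A [ V n (len Γ) ] [ rS σ ] ≡ rT (proj₁ u)
        eq = trans (sym ([⊚] (rT A) _ _)) (trans (cong (rT A [_]) (sym (V-back Θ σ))) (trans ([⊚] (rT A) _ _)
          (trans (cong (_[ V n (len Δ) ]) (trans (sym (rT-upⁿ Θ refl σ A)) (cong rT (sym h))))
            (trans (cong (λ m → rT (proj₁ u [ pTel (proj₁ (subTel Θ σ)) ]T) [ V m (len Δ) ]) (sym (size-sub Θ σ)))
                   (rT-pTel-V (proj₁ (subTel Θ σ)) (proj₁ u))))))

      F : nj (rT A [ V n (len Γ) ]) ≡ true → Fam Γ (Tms n) (QP n Θ A junk)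
      F m with StrΘ.strT Θ A m
      ... | B , eB = record
        { I = ⊤ ; obj = λ _ → Γ ▹ B ; to = λ _ → p ; gen = λ _ → rP (freeGen {B})
        ; good = λ _ → (freeGen , refl , sym (up-type eB p)) , sk-free n (len (Γ ▹ B)) (rP (freeGen {B}))
            (trans (cong nj (trans (cong (λ m → rP (freeGen {B}) [ V m (len (Γ ▹ B)) ]) (sym (size-sub Θ p))) (rP-pTel-V ΘB (Q B)))) (nj-P (Q B)))
        ; fac = λ { {Δ} σ r ((P , refl , h) , e) → tt , fac₁ σ P h (strP σ P (sk-junk n (len Δ) (rP P) (nj-P P) e)) }
        ; uniq = λ ρ ρ' e e' → cong (tt ,_) (▹-ext B ρ ρ' e (W-inj n _ _ (trans (sym (freeGen-[] ρ)) (trans e' (freeGen-[] ρ'))))) }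
        where
        fac₁ : ∀ {Δ} (σ : Sub Δ Γ) (P : PTm (Δ ▹▹ proj₁ (subTel Θ σ))) → proj₁ P ≡ A [ up Θ σ ]T →
               Σ (PTm Δ) (λ u → u [ pTel (proj₁ (subTel Θ σ)) ]P ≡ P) →
               Σ (Sub Δ (Γ ▹ B)) (λ ρ → p ∘ ρ ≡ σ × rP (freeGen {B}) [ Lσ n ρ ] ≡ rP P)
        fac₁ {Δ} σ _ h (u , refl) = ρ , p-pairP B σ u same ,
          trans (freeGen-[] ρ) (trans (cong (λ P → rP P [ W n (len Δ) ]) (Q-pairP B σ u same)) (sym (rP-pTelⁿ (proj₁ (subTel Θ σ)) (size-sub Θ σ) u)))
          where
          same : proj₁ u ≡ B [ σ ]T
          same = StrΘ.wT-inj (proj₁ (subTel Θ σ)) (trans h (up-type eB σ))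
          ρ = pairP B σ u same

    -- A rigid variable has no parameters, so all that remains is to unify its type with `A`.
    famRigid : ∀ z → Fam Γ (Tms n) (QP n Θ A (var z))
    famRigid z = Fam-when prop F find
      where
      Inner : Set
      Inner = Σ (Var (vcon (Γ ▹▹ Θ))) (λ x → ⌜ x ⌝ ≡ z × z < n)
      prop : (a a' : Inner) → a ≡ a'
      prop (x , refl , h) (x' , e' , h') with ⌜⌝-inj (vcon _) x' x e'
      prop (x , refl , h) (x , refl , h') | refl = cong (λ h → x , refl , h) (≤-irrelevant h h')
      find : ∀ {Δ} (σ : Sub Δ Γ) r → QP n Θ A (var z) σ r → Inner
      find {Δ} σ r ((P , refl , h) , e) with sk-var n (len Δ) (rP P) z e
      ... | e' , m with split n (len Δ) z (var-sc _ z (subst (λ r → r [ _ ] ≡ r) e' (rP-scⁿ (proj₁ (subTel Θ σ)) (size-sub Θ σ) P)))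
      ...   | outer y _ _ h' = ⊥-elim (false≢true (trans (sym m) (cong nj (trans (cong (_[ V n (len Δ) ]) e') h'))))
      ...   | rigid k _ _ = let x , ex = ⌜⌝-surj (vcon _) z (subst (z <_) (sym (len-▹▹ Θ)) (⊕-< n (len Γ) z k)) in x , ex , k
      F : Inner → Fam Γ (Tms n) (QP n Θ A (var z))
      F (x , refl , k) = Fam-map (λ _ → var z) (λ _ δ → sym (fixed δ)) (λ _ → refl)
        (λ {Δ} σ _ h → (⟦ x ⟧v [ up Θ σ ]P , raw-x σ , T-inj (trans (rT-upⁿ Θ refl σ (proj₁ ⟦ x ⟧v)) (trans h (sym (rT-upⁿ Θ refl σ A)))))
                  , sk-rigid n (len Δ) (var z) (cong nj (proj₁ (inner n (len Δ) z k))))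
        (λ { {Δ} σ r ((P , refl , h) , e) → let e' = proj₁ (sk-var n (len Δ) (rP P) z e) in
             tt , sym e' , trans (sym (rT-upⁿ Θ refl σ (proj₁ ⟦ x ⟧v))) (trans (cong rT (trans (cong proj₁ (P-inj {P = ⟦ x ⟧v [ up Θ σ ]P} {P' = P} (trans (raw-x σ) (sym e')))) h)) (rT-upⁿ Θ refl σ A)) })
        (Fam-Sol (unifyT Θ (proj₁ ⟦ x ⟧v) A))
        where
        fixed : ∀ {Δ Ξ} (δ : Sub Ξ Δ) → lookup z (Lσ n δ) ≡ var z
        fixed {Δ} {Ξ} δ = proj₂ (inner n (len Δ) z k) (len Ξ) (rS δ) (rS-sc δ)
        raw-x : ∀ {Δ} (σ : Sub Δ Γ) → rP (⟦ x ⟧v [ up Θ σ ]P) ≡ var z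
        raw-x σ = trans (rP-up Θ σ ⟦ x ⟧v) (trans (cong (_[ Lσ n σ ]) (rP-var _ x)) (fixed σ))

  -- Recursion on the shape. For a generator the generic argument lists are found without reference
  -- to `A`; over each of them the resulting type is then unified with `A`.
  famP : ∀ n s {Γ} (Θ : Tel Γ) → size Θ ≡ n → (A : Ty (Γ ▹▹ Θ)) → Fam Γ (Tms n) (QP n Θ A s)
  famS : ∀ n s {Γ} (Θ : Tel Γ) → size Θ ≡ n → {Φ : Con} (u : VCon Φ) → Fam Γ (Subs n) (QS n Θ Φ s)
  famP n junk    Θ refl A = famFree Θ A
  famP n (var z) Θ refl A = famRigid Θ A z
  famP n (con (inj₁ j) s) Θ sz A = Fam-never no
    where
    no : ∀ {Δ} (σ : Sub Δ _) r → ¬ QP n Θ A (con (inj₁ j) s) σ r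
    no {Δ} σ r ((P , refl , h) , e) with sk-con n (len Δ) (rP P) e
    ... | _ , e' , _ with conView P e'
    ... | _ , _ , () , _
  famP n (con (inj₂ c) s) {Γ} Θ sz A =
    Fam-map (λ { (r , _) → con (inj₂ c) r }) (λ _ δ → refl) (λ e → cong (_, tt) (proj₂ (con-inj e)))
      (λ σ _ q → q)
      (λ { {Δ} σ r q@((P , refl , h) , e) → let r' , e' , _ = sk-con n (len Δ) (rP P) e in (r' , tt) , sym e' , subst (QP n Θ A (con (inj₂ c) s) σ) e' q })
      (Fam-Σ {Q = λ { σ (r , _) → QP n Θ A (con (inj₂ c) s) σ (con (inj₂ c) r) }} F
        -- The shape has to be tested again at the head: if all arguments avoid the telescope, so
        -- does the whole term, and its shape is `junk`.
        {λ i δ _ → (sk n (len (obj F i)) (con (inj₂ c) (gen F i)) ≡ con (inj₂ c) s) × EqP (size (Θ′ i)) (rT (proj₁ (nM c) [ τ i ]T)) (rT (A [ up Θ (to F i) ]T)) δ}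
        (λ i → Fam-Sol (Sol-when (λ e → Sol-map (λ σ h → e , h) (λ σ → proj₂) (unifyT (Θ′ i) (proj₁ (nM c) [ τ i ]T) (A [ up Θ (to F i) ]T))) (λ σ → proj₁)))
        sound elim₁ elim₂)
    where
    F : Fam Γ (Subs n) (QS n Θ (cM c) s)
    F = famS n s Θ sz (vcon (cM c))
    Θ′ : ∀ i → Tel (obj F i)
    Θ′ i = proj₁ (subTel Θ (to F i))
    τ : ∀ i → Sub (obj F i ▹▹ Θ′ i) (cM c)
    τ i = proj₁ (proj₁ (good F i))
    eτ : ∀ i → rS (τ i) ≡ gen F i
    eτ i = proj₂ (proj₁ (good F i))
    szΘ′ : ∀ i → size (Θ′ i) ≡ n
    szΘ′ i = szσ Θ (to F i) sz
    conP : ∀ i → PTm (obj F i ▹▹ Θ′ i)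
    conP i = nM c [ τ i ]P
    rP-conP : ∀ i → rP (conP i) ≡ con (inj₂ c) (gen F i)
    rP-conP i = trans (rP-gen c (τ i)) (cong (con (inj₂ c)) (eτ i))
    sk-conP : ∀ i {Δ} (δ : Sub Δ (obj F i)) → sk n (len Δ) (con (inj₂ c) (gen F i ⊚ Lσ n δ)) ≡ sk n (len (obj F i)) (con (inj₂ c) (gen F i))
    sk-conP i {Δ} δ = subst (λ r → sk n (len Δ) (r [ Lσ n δ ]) ≡ sk n (len (obj F i)) r) (rP-conP i) (sk-up (Θ′ i) (szΘ′ i) δ (conP i))

    sound : ∀ i {Δ} (δ : Sub Δ (obj F i)) (y : ⊤) → (sk n (len (obj F i)) (con (inj₂ c) (gen F i)) ≡ con (inj₂ c) s) × EqP (size (Θ′ i)) (rT (proj₁ (nM c) [ τ i ]T)) (rT (A [ up Θ (to F i) ]T)) δ →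
            QP n Θ A (con (inj₂ c) s) (to F i ∘ δ) (con (inj₂ c) (gen F i ⊚ Lσ n δ))
    sound i δ _ (e , h) =
      TypedP-∘ Θ (to F i) δ {A} (conP i [ up (Θ′ i) δ ]P , trans (rP-upⁿ (Θ′ i) (szΘ′ i) δ (conP i)) (cong (_[ Lσ n δ ]) (rP-conP i)) ,
        T-inj (trans (rT-upⁿ (Θ′ i) refl δ (proj₁ (conP i))) (trans h (sym (rT-upⁿ (Θ′ i) refl δ (A [ up Θ (to F i) ]T))))))
      , trans (sk-conP i δ) e

    elim₁ : ∀ {Δ} (σ : Sub Δ Γ) r (y : ⊤) → QP n Θ A (con (inj₂ c) s) σ (con (inj₂ c) r) → QS n Θ (cM c) s σ r
    elim₁ {Δ} σ r _ ((P , e , h) , k) with conView P e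
    ... | .c , τ , refl , e' , _ with sk-con n (len Δ) (con (inj₂ c) r) k
    ... | r' , refl , k' = (τ , e') , k'

    elim₂ : ∀ i {Δ} (δ : Sub Δ (obj F i)) (y : ⊤) → QP n Θ A (con (inj₂ c) s) (to F i ∘ δ) (con (inj₂ c) (gen F i ⊚ Lσ n δ)) →
            (sk n (len (obj F i)) (con (inj₂ c) (gen F i)) ≡ con (inj₂ c) s) × EqP (size (Θ′ i)) (rT (proj₁ (nM c) [ τ i ]T)) (rT (A [ up Θ (to F i) ]T)) δ
    elim₂ i δ _ (P , k) with TypedP-∘⁻ Θ (to F i) δ {A} P
    ... | P' , e , h = trans (sym (sk-conP i δ)) k ,
      trans (sym (rT-upⁿ (Θ′ i) refl δ (proj₁ (conP i)))) (trans (cong rT (trans (cong proj₁ conP≡P') h)) (rT-upⁿ (Θ′ i) refl δ (A [ up Θ (to F i) ]T)))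
      where
      conP≡P' : conP i [ up (Θ′ i) δ ]P ≡ P'
      conP≡P' = P-inj (trans (rP-upⁿ (Θ′ i) (szΘ′ i) δ (conP i)) (trans (cong (_[ Lσ n δ ]) (rP-conP i)) (sym e)))
  famS n [] Θ sz ◇ᵛ = record
    { I = ⊤ ; obj = λ _ → _ ; to = λ _ → id ; gen = λ _ → [] ; good = λ _ → (ε , empty ε) , refl
    ; fac = λ { σ r ((τ , refl) , e) → tt , σ , idl σ , sym (empty τ) }
    ; uniq = λ ρ ρ' e _ → cong (tt ,_) (trans (sym (idl ρ)) (trans e (idl ρ'))) }
    where
    empty : ∀ {Δ} (τ : Sub Δ ◇) → rS τ ≡ []
    empty τ = go (rS τ) (trans (rS-length τ) len-◇)
      where
      go : ∀ s → length s ≡ 0 → s ≡ []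
      go [] _ = refl
  famS n (t ∷ s) Θ sz ◇ᵛ = Fam-never λ { σ [] (_ , ()) ; σ (_ ∷ _) ((τ , e) , _) → case trans (sym (cong length e)) (trans (rS-length τ) len-◇) of λ () }
  famS n [] Θ sz (u ▹ᵛ A) = Fam-never λ { σ [] ((τ , e) , _) → case trans (sym (rS-▹ A τ)) e of λ () ; σ (_ ∷ _) (_ , ()) }
  famS n (t ∷ s) {Γ} Θ sz (_▹ᵛ_ {Φ} u A) =
    Fam-map (λ { (r , t) → t ∷ r }) (λ _ δ → refl) (λ e → let h , h' = ∷-inj e in cong₂ _,_ h' h)
      (λ σ _ q → q)
      (λ { σ [] (_ , ()) ; σ (t ∷ r) q → (r , t) , refl , q })
      (Fam-Σ {Q = λ { σ (r , y) → QS n Θ (Φ ▹ A) (t ∷ s) σ (y ∷ r) }} F (λ i → famP n t (Θ′ i) (szσ Θ (to F i) sz) (A [ τ i ]T))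
        sound elim₁ elim₂)
    where
    F : Fam Γ (Subs n) (QS n Θ Φ s)
    F = famS n s Θ sz u
    Θ′ : ∀ i → Tel (obj F i)
    Θ′ i = proj₁ (subTel Θ (to F i))
    τ : ∀ i → Sub (obj F i ▹▹ Θ′ i) Φ
    τ i = proj₁ (proj₁ (good F i))
    rτ : ∀ i {Δ} (δ : Sub Δ (obj F i)) → rS (τ i ∘ up (Θ′ i) δ) ≡ gen F i ⊚ Lσ n δ
    rτ i δ = trans (rS-upⁿ (Θ′ i) (szσ Θ (to F i) sz) δ (τ i)) (cong (_⊚ Lσ n δ) (proj₂ (proj₁ (good F i))))
    sound : ∀ i {Δ} (δ : Sub Δ (obj F i)) y → QP n (Θ′ i) (A [ τ i ]T) t δ y → QS n Θ (Φ ▹ A) (t ∷ s) (to F i ∘ δ) (y ∷ gen F i ⊚ Lσ n δ)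
    sound i δ y ((P , e , h) , k) =
      TypedS-∘ Θ (to F i) δ (pairP A (τ i ∘ up (Θ′ i) δ) P same , trans (rS-pairP A _ P same) (cong₂ _∷_ e (rτ i δ))) ,
      cong₂ _∷_ k (proj₂ (QS-[] Θ (to F i) sz δ (gen F i) (good F i)))
      where
      same : proj₁ P ≡ A [ τ i ∘ up (Θ′ i) δ ]T
      same = trans h (sym ([∘]T A _ _))
    elim₁ : ∀ {Δ} (σ : Sub Δ Γ) r y → QS n Θ (Φ ▹ A) (t ∷ s) σ (y ∷ r) → QS n Θ Φ s σ r
    elim₁ σ r y ((τ , e) , k) = (p ∘ τ , proj₂ (∷-inj (trans (sym (rS-▹ A τ)) e))) , proj₂ (∷-inj k)
    elim₂ : ∀ i {Δ} (δ : Sub Δ (obj F i)) y → QS n Θ (Φ ▹ A) (t ∷ s) (to F i ∘ δ) (y ∷ gen F i ⊚ Lσ n δ) → QP n (Θ′ i) (A [ τ i ]T) t δ y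
    elim₂ i δ y (τ' , k) with TypedS-∘⁻ Θ (to F i) δ τ'
    ... | υ , e with ∷-inj (trans (sym (rS-▹ A υ)) e)
    ... | h , h' = (Q A [ υ ]P , h , trans (Q-type A υ) (trans (cong (A [_]T) (S-inj (trans h' (sym (rτ i δ))))) ([∘]T A _ _))) , proj₁ (∷-inj k)

  -- The sum ranges over all trees as candidate shapes; those that are the shape of no term
  -- contribute empty families.
  famTm : ∀ {Γ} (Θ : Tel Γ) (A : Ty (Γ ▹▹ Θ)) → Fam Γ (Tms (size Θ)) (λ σ r → TypedP Θ A r (subTel Θ σ))
  famTm Θ A = Fam-⨿ (λ s → famP (size Θ) s Θ refl A) (λ s σ δ r → QP-[] Θ σ refl δ {A} r)
    (λ σ r q q' → trans (sym (proj₂ q)) (proj₂ q')) (λ s σ r → proj₁) (λ σ r q → _ , q , refl)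

  -- A context extension classifies the terms of a type, but nothing classifies types. So the head
  -- generator of a type remains visible even if the type avoids the telescope.
  famTy : ∀ {Γ} (Θ : Tel Γ) → Fam Γ (Tms (size Θ)) (λ σ r → TypedT Θ r (subTel Θ σ))
  famTy {Γ} Θ = Fam-⨿ F stable disjoint sound cover
    where
    n = size Θ
    Qʲ : TyG × RSub → ∀ {Δ} → Sub Δ Γ → RTm → Set
    Qʲ (j , s) σ r = Σ RSub (λ r' → con (inj₁ j) r' ≡ r × QS n Θ (cT j) s σ r')
    F : ∀ k → Fam Γ (Tms n) (Qʲ k)
    F (j , s) = Fam-map (con (inj₁ j)) (λ _ δ → refl) (λ e → proj₂ (con-inj e)) (λ σ r q → r , refl , q) (λ σ r q → q) (famS n s Θ refl (vcon (cT j)))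
    stable : ∀ k {Δ Ξ} (σ : Sub Δ Γ) (δ : Sub Ξ Δ) r → Qʲ k σ r → Qʲ k (σ ∘ δ) (r [ Lσ n δ ])
    stable (j , s) σ δ _ (r , refl , q) = r ⊚ Lσ n δ , refl , QS-[] Θ σ refl δ r q
    disjoint : ∀ {k k' Δ} (σ : Sub Δ Γ) r → Qʲ k σ r → Qʲ k' σ r → k ≡ k'
    disjoint σ _ (r , refl , _ , refl) (r' , refl , _ , refl) = refl
    sound : ∀ k {Δ} (σ : Sub Δ Γ) r → Qʲ k σ r → TypedT Θ r (subTel Θ σ)
    sound (j , s) σ _ (_ , refl , (τ , refl) , _) = nT j [ τ ]T , rT-gen j τ
    cover : ∀ {Δ} (σ : Sub Δ Γ) r → TypedT Θ r (subTel Θ σ) → Σ (TyG × RSub) (λ k → Qʲ k σ r)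
    cover σ _ (B , refl) with coverT B
    ... | (j , τ) , refl = (j , _) , rS τ , sym (rT-gen j τ) , (τ , refl) , refl

-- Polynomial sorts

module Monomials (D : CwF) where
  open Kit D
  open Telescopes D

  PMel : Con → Set
  PMel Γ = Σ (Mono Γ) MEl

  infixl 30 _[_]PM
  _[_]PM : ∀ {Γ Δ} → PMel Γ → Sub Δ Γ → PMel Δ
  (M , m) [ σ ]PM = M [ σ ]M , _[_]m {M = M} m σ

  [∘]M : ∀ {Γ Δ Ξ} (M : Mono Γ) (σ : Sub Δ Γ) (δ : Sub Ξ Δ) → M [ σ ∘ δ ]M ≡ M [ σ ]M [ δ ]M
  [∘]M (ty Θ)   σ δ = cong (λ z → ty (proj₁ z)) (subTel-∘ Θ σ δ)
  [∘]M (tm Θ A) σ δ = trans (cong (λ { (Θ' , υ) → tm Θ' (A [ υ ]T) }) (subTel-∘ Θ σ δ)) (cong (tm _) ([∘]T A _ _))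

  [∘]PM : ∀ {Γ Δ Ξ} (x : PMel Γ) (σ : Sub Δ Γ) (δ : Sub Ξ Δ) → x [ σ ∘ δ ]PM ≡ x [ σ ]PM [ δ ]PM
  [∘]PM (ty Θ , B) σ δ = trans (cong (λ { (Θ' , υ) → ty Θ' , B [ υ ]T }) (subTel-∘ Θ σ δ)) (cong (λ B → ty (proj₁ (subTel (proj₁ (subTel Θ σ)) δ)) , B) ([∘]T B (up Θ σ) (up (proj₁ (subTel Θ σ)) δ)))
  [∘]PM (tm Θ A , t) σ δ = trans (cong (λ { (Θ' , υ) → tm Θ' (A [ υ ]T) , t [ υ ]t }) (subTel-∘ Θ σ δ))
                                (cong (λ { (T , t) → tm (proj₁ (subTel (proj₁ (subTel Θ σ)) δ)) T , t }) ([∘]P (A , t) (up Θ σ) (up (proj₁ (subTel Θ σ)) δ)))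

  record MonoRep (Γ : Con) (M : Mono Γ) : Set₁ where
    field
      I    : Set
      obj  : I → Con
      to   : ∀ i → Sub (obj i) Γ
      gen  : ∀ i → MEl (M [ to i ]M)
      fac  : ∀ {Δ} (σ : Sub Δ Γ) (m : MEl (M [ σ ]M)) →
             Σ I (λ i → Σ (Sub Δ (obj i)) (λ ρ → to i ∘ ρ ≡ σ × _≡_ {A = PMel Δ} ((M [ to i ]M , gen i) [ ρ ]PM) (M [ σ ]M , m)))
      uniq : ∀ {Δ i i'} (ρ : Sub Δ (obj i)) (ρ' : Sub Δ (obj i')) → to i ∘ ρ ≡ to i' ∘ ρ' →
             _≡_ {A = PMel Δ} ((M [ to i ]M , gen i) [ ρ ]PM) ((M [ to i' ]M , gen i') [ ρ' ]PM) →
             _≡_ {A = Σ I (λ i → Sub Δ (obj i))} (i , ρ) (i' , ρ')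

  module _ (rep : ∀ Γ M → MonoRep Γ M) where
    open FamRep

    module Ext (P : Poly) (M : ∀ {Γ} → Elem P Γ → Mono Γ)
               (nat : ∀ {Γ Δ} (e : Elem P Γ) (σ : Sub Δ Γ) → M (e · σ) ≡ M e [ σ ]M) (R : FamRep P) where
      private
        module R = FamRep R
        P⁺ : Poly
        P⁺ = ext P M nat

      -- The universal element of the summand `i`, by Yoneda. Every element is a restriction of one
      -- of these, so by naturality the sorts `M (e₀ i)` determine `M`.
      e₀ : ∀ i → Elem P (R.obj i)
      e₀ i = R.ψ (i , id)

      φ-inj : ∀ {Γ} {e e' : Elem P Γ} → R.φ e ≡ R.φ e' → e ≡ e'
      φ-inj {e = e} {e'} h = trans (sym (R.ψφ e)) (trans (cong R.ψ h) (R.ψφ e'))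

      φ-e₀ : ∀ i {Δ} (σ : Sub Δ (R.obj i)) → R.φ (e₀ i · σ) ≡ (i , σ)
      φ-e₀ i σ = trans (R.φ-nat (e₀ i) σ) (trans (cong (λ { (i , τ) → i , τ ∘ σ }) (R.φψ (i , id))) (cong (i ,_) (idl σ)))

      ψ-e₀ : ∀ {Δ} (e : Elem P Δ) → e₀ (proj₁ (R.φ e)) · proj₂ (R.φ e) ≡ e
      ψ-e₀ e = φ-inj (φ-e₀ _ _)

      elem≡ : ∀ {Γ} {x y : Elem P⁺ Γ} → proj₁ x ≡ proj₁ y →
              _≡_ {A = PMel Γ} (M (proj₁ x) , proj₂ x) (M (proj₁ y) , proj₂ y) → x ≡ y
      elem≡ {x = e , m} {.e , m'} refl h = cong (e ,_) (pair-inj h)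

      pm : ∀ {Γ} → Elem P⁺ Γ → PMel Γ
      pm (e , m) = M e , m

      pm-· : ∀ {Γ Δ} (x : Elem P⁺ Γ) (σ : Sub Δ Γ) → pm (_·_ {P⁺} x σ) ≡ pm x [ σ ]PM
      pm-· (e , m) σ = subst-pair (sym (nat e σ)) _

      module G (i : R.I) = MonoRep (rep (R.obj i) (M (e₀ i)))

      Idx : Set
      Idx = Σ R.I (λ i → G.I i)

      obj⁺ : Idx → Con
      obj⁺ (i , j) = G.obj i j

      gen-type : ∀ i j {Δ} (ρ : Sub Δ (G.obj i j)) → M (e₀ i) [ G.to i j ]M [ ρ ]M ≡ M (e₀ i · (G.to i j ∘ ρ))
      gen-type i j ρ = sym (trans (nat (e₀ i) (G.to i j ∘ ρ)) ([∘]M (M (e₀ i)) (G.to i j) ρ))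

      Ψ : ∀ {Δ} → Σ Idx (λ k → Sub Δ (obj⁺ k)) → Elem P⁺ Δ
      Ψ ((i , j) , ρ) = e₀ i · (G.to i j ∘ ρ) , subst MEl (gen-type i j ρ) (_[_]m {M = M (e₀ i) [ G.to i j ]M} (G.gen i j) ρ)

      pm-Ψ : ∀ i j {Δ} (ρ : Sub Δ (G.obj i j)) → pm (Ψ ((i , j) , ρ)) ≡ (M (e₀ i) [ G.to i j ]M , G.gen i j) [ ρ ]PM
      pm-Ψ i j ρ = subst-pair (gen-type i j ρ) _

      -- `Φ-fac` provides preimages under `Ψ`; injectivity then yields the other inverse law and
      -- transfers naturality from `Ψ` to its inverse.
      Ψ-inj : ∀ {Δ} {x y : Σ Idx (λ k → Sub Δ (obj⁺ k))} → Ψ x ≡ Ψ y → x ≡ y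
      Ψ-inj {x = (i , j) , ρ} {(i' , j') , ρ'} h =
        lem (trans (sym (φ-e₀ i _)) (trans (cong (λ z → R.φ (proj₁ z)) h) (φ-e₀ i' _))) j j' ρ ρ' refl refl
            (trans (sym (pm-Ψ i j ρ)) (trans (cong pm h) (pm-Ψ i' j' ρ')))
        where
        lem : ∀ {i i' Δ} {δ : Sub Δ (R.obj i)} {δ' : Sub Δ (R.obj i')} → _≡_ {A = Σ R.I (λ i → Sub Δ (R.obj i))} (i , δ) (i' , δ') →
              ∀ j j' (ρ : Sub Δ (G.obj i j)) (ρ' : Sub Δ (G.obj i' j')) → G.to i j ∘ ρ ≡ δ → G.to i' j' ∘ ρ' ≡ δ' →
              (M (e₀ i) [ G.to i j ]M , G.gen i j) [ ρ ]PM ≡ (M (e₀ i') [ G.to i' j' ]M , G.gen i' j') [ ρ' ]PM → _≡_ {A = Σ Idx (λ k → Sub Δ (obj⁺ k))} ((i , j) , ρ) ((i' , j') , ρ')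
        lem {i} refl j j' ρ ρ' a b e with G.uniq i ρ ρ' (trans a (sym b)) e
        ... | refl = refl

      Φ-fac : ∀ {Δ} (x : Elem P⁺ Δ) → Σ (Σ Idx (λ k → Sub Δ (obj⁺ k))) (λ y → Ψ y ≡ x)
      Φ-fac {Δ} (e , m) with G.fac i σ (subst MEl type m)
        where
        i = proj₁ (R.φ e)
        σ = proj₂ (R.φ e)
        type : M e ≡ M (e₀ i) [ σ ]M
        type = trans (cong M (sym (ψ-e₀ e))) (nat (e₀ i) σ)
      ... | j , ρ , h , k = ((_ , j) , ρ) , elem≡ (trans (cong (e₀ _ ·_) h) (ψ-e₀ e)) (trans (pm-Ψ _ j ρ) (trans k (subst-pair _ m)))

      Ψ-nat : ∀ {Δ Δ'} (k : Idx) (ρ : Sub Δ (obj⁺ k)) (σ : Sub Δ' Δ) → Ψ (k , ρ ∘ σ) ≡ _·_ {P⁺} (Ψ (k , ρ)) σ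
      Ψ-nat (i , j) ρ σ = elem≡
        (φ-inj (trans (φ-e₀ i _) (trans (cong (i ,_) (sym (ass _ ρ σ)))
          (sym (trans (R.φ-nat _ σ) (cong (λ { (i , τ) → i , τ ∘ σ }) (φ-e₀ i _)))))))
        (trans (pm-Ψ i j (ρ ∘ σ)) (trans ([∘]PM (M (e₀ i) [ G.to i j ]M , G.gen i j) ρ σ)
          (trans (cong (_[ σ ]PM) (sym (pm-Ψ i j ρ))) (sym (pm-· (Ψ ((i , j) , ρ)) σ)))))

      famRep-ext : FamRep P⁺
      famRep-ext .I = Idx
      famRep-ext .obj = obj⁺
      famRep-ext .φ x = proj₁ (Φ-fac x)
      famRep-ext .ψ = Ψ
      famRep-ext .ψφ x = proj₂ (Φ-fac x)
      famRep-ext .φψ y = Ψ-inj (proj₂ (Φ-fac (Ψ y)))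
      famRep-ext .φ-nat x σ = Ψ-inj (trans (proj₂ (Φ-fac (_·_ {P⁺} x σ)))
        (sym (trans (Ψ-nat _ _ σ) (cong (λ z → _·_ {P⁺} z σ) (proj₂ (Φ-fac x))))))

    famRep : (P : Poly) → FamRep P
    famRep ◇P = record
      { I = ⊤ ; obj = λ _ → ◇ ; φ = λ _ → tt , ε ; ψ = λ _ → tt ; ψφ = λ _ → refl
      ; φψ = λ { (tt , σ) → cong (tt ,_) (sym (◇η σ)) } ; φ-nat = λ _ _ → cong (tt ,_) (sym (◇η _)) }
    famRep (ext P M nat) = Ext.famRep-ext P M nat (famRep P)

-- Monomial sorts of a cellular CwF

module CellularMonomials {C : CwF} (cell : IsCellularCwF C) where
  open Families cell
  open Monomials C
  open MonoRep

  rM : ∀ {Γ} → PMel Γ → RTm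
  rM (ty Θ , B)   = rT B
  rM (tm Θ A , t) = rP (A , t)

  sameTy : ∀ {Γ Δ} {Θ : Tel Γ} {x y : Lift Θ Δ} → x ≡ y → (B : Ty (Δ ▹▹ proj₁ x)) (B' : Ty (Δ ▹▹ proj₁ y)) → rT B ≡ rT B' →
           _≡_ {A = PMel Δ} (ty (proj₁ x) , B) (ty (proj₁ y) , B')
  sameTy refl B B' e = cong (_ ,_) (T-inj e)

  sameTm : ∀ {Γ Δ} {Θ : Tel Γ} {x y : Lift Θ Δ} → x ≡ y → (P : PTm (Δ ▹▹ proj₁ x)) (P' : PTm (Δ ▹▹ proj₁ y)) → rP P ≡ rP P' →
           _≡_ {A = PMel Δ} (tm (proj₁ x) (proj₁ P) , proj₂ P) (tm (proj₁ y) (proj₁ P') , proj₂ P')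
  sameTm {x = x} refl P P' e = cong (λ { (T , t) → tm (proj₁ x) T , t }) (P-inj e)

  telSize : ∀ {Γ} → Mono Γ → ℕ
  telSize (ty Θ)   = size Θ
  telSize (tm Θ A) = size Θ

  rM-[] : ∀ {Γ Δ} (M : Mono Γ) (m : MEl M) (σ : Sub Δ Γ) {n} → telSize M ≡ n → rM ((M , m) [ σ ]PM) ≡ rM (M , m) [ Lσ n σ ]
  rM-[] (ty Θ)   B σ e = rT-upⁿ Θ e σ B
  rM-[] (tm Θ A) t σ e = rP-upⁿ Θ e σ (A , t)

  monoRep : ∀ Γ (M : Mono Γ) → MonoRep Γ M
  monoRep Γ (ty Θ) = record
    { I = F.I ; obj = F.obj ; to = F.to ; gen = λ i → proj₁ (F.good i)
    ; fac = λ σ B → fac₁ σ B (F.fac σ (rT B) (B , refl))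
    ; uniq = λ {_} {i} {i'} ρ ρ' e h → F.uniq ρ ρ' e (trans (sym (rgen i ρ)) (trans (cong rM h) (rgen i' ρ'))) }
    where
    module F = Fam (famTy Θ)
    rgen : ∀ i {Δ} (ρ : Sub Δ (F.obj i)) → rM ((ty Θ [ F.to i ]M , proj₁ (F.good i)) [ ρ ]PM) ≡ F.gen i [ Lσ (size Θ) ρ ]
    rgen i ρ = trans (rM-[] (ty Θ [ F.to i ]M) (proj₁ (F.good i)) ρ (size-sub Θ (F.to i))) (cong (_[ Lσ (size Θ) ρ ]) (proj₂ (F.good i)))
    fac₁ : ∀ {Δ} (σ : Sub Δ Γ) B → Σ F.I (λ i → Σ (Sub Δ (F.obj i)) (λ ρ → F.to i ∘ ρ ≡ σ × F.gen i [ Lσ (size Θ) ρ ] ≡ rT B)) →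
           Σ F.I (λ i → Σ (Sub Δ (F.obj i)) (λ ρ → F.to i ∘ ρ ≡ σ × _≡_ {A = PMel Δ} ((ty Θ [ F.to i ]M , proj₁ (F.good i)) [ ρ ]PM) (ty Θ [ σ ]M , B)))
    fac₁ σ B (i , ρ , refl , e) = i , ρ , refl , sameTy {Θ = Θ} (sym (subTel-∘ Θ (F.to i) ρ)) _ B (trans (rgen i ρ) e)
  monoRep Γ (tm Θ A) = record
    { I = F.I ; obj = F.obj ; to = F.to ; gen = gen₁
    ; fac = λ σ t → fac₁ σ t (F.fac σ (rP (_ , t)) ((_ , t) , refl , refl))
    ; uniq = λ {_} {i} {i'} ρ ρ' e h → F.uniq ρ ρ' e (trans (sym (rgen i ρ)) (trans (cong rM h) (rgen i' ρ'))) }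
    where
    module F = Fam (famTm Θ A)
    gen₁ : ∀ i → MEl (tm Θ A [ F.to i ]M)
    gen₁ i = subst (Tm _) (proj₂ (proj₂ (F.good i))) (proj₂ (proj₁ (F.good i)))
    rgen₁ : ∀ i → rM (tm Θ A [ F.to i ]M , gen₁ i) ≡ F.gen i
    rgen₁ i = trans (cong rP (subst-pair (proj₂ (proj₂ (F.good i))) _)) (proj₁ (proj₂ (F.good i)))
    rgen : ∀ i {Δ} (ρ : Sub Δ (F.obj i)) → rM ((tm Θ A [ F.to i ]M , gen₁ i) [ ρ ]PM) ≡ F.gen i [ Lσ (size Θ) ρ ]
    rgen i ρ = trans (rM-[] (tm Θ A [ F.to i ]M) (gen₁ i) ρ (size-sub Θ (F.to i))) (cong (_[ Lσ (size Θ) ρ ]) (rgen₁ i))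
    fac₁ : ∀ {Δ} (σ : Sub Δ Γ) t → Σ F.I (λ i → Σ (Sub Δ (F.obj i)) (λ ρ → F.to i ∘ ρ ≡ σ × F.gen i [ Lσ (size Θ) ρ ] ≡ rP (A [ up Θ σ ]T , t))) →
           Σ F.I (λ i → Σ (Sub Δ (F.obj i)) (λ ρ → F.to i ∘ ρ ≡ σ × _≡_ {A = PMel Δ} ((tm Θ A [ F.to i ]M , gen₁ i) [ ρ ]PM) (tm Θ A [ σ ]M , t)))
    fac₁ σ t (i , ρ , refl , e) = i , ρ , refl , sameTm {Θ = Θ} (sym (subTel-∘ Θ (F.to i) ρ)) _ (_ , t) (trans (rgen i ρ) e)

-- Monomial sorts of a slice

module SliceMonomials (C : CwF) (Γ₀ : CwF.Con C) where
  private
    S : CwF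
    S = Slice C Γ₀
    module S where
      open Kit S public
      open Telescopes S public
      open Monomials S public
    module C where
      open Kit C public
      open Telescopes C public
      open Monomials C public

  -- Telescopes, types and terms over (Δ , ρ) in the slice are those over Δ in C, but
  -- the two kinds of iterated extension agree only propositionally.
  tel° : ∀ {X} → S.Tel X → C.Tel (proj₁ X)
  tel° S.[]      = C.[]
  tel° (A S.∷ Θ) = A C.∷ tel° Θ

  ty° : ∀ {X} (Θ : S.Tel X) → S.Ty (X S.▹▹ Θ) → C.Ty (proj₁ X C.▹▹ tel° Θ)
  ty° S.[]      B = B
  ty° (A S.∷ Θ) B = ty° Θ B

  tm° : ∀ {X} (Θ : S.Tel X) {A} → S.Tm (X S.▹▹ Θ) A → C.Tm (proj₁ X C.▹▹ tel° Θ) (ty° Θ A)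
  tm° S.[]      t = t
  tm° (A S.∷ Θ) t = tm° Θ t

  ty• : ∀ {X} (Θ : S.Tel X) (B : C.Ty (proj₁ X C.▹▹ tel° Θ)) → Σ (S.Ty (X S.▹▹ Θ)) (λ B' → ty° Θ B' ≡ B)
  ty• S.[]      B = B , refl
  ty• (A S.∷ Θ) B = ty• Θ B

  ty°-inj : ∀ {X} (Θ : S.Tel X) {B B'} → ty° Θ B ≡ ty° Θ B' → B ≡ B'
  ty°-inj S.[]      e = e
  ty°-inj (A S.∷ Θ) e = ty°-inj Θ e

  tm• : ∀ {X} (Θ : S.Tel X) {A} (t : C.Tm (proj₁ X C.▹▹ tel° Θ) (ty° Θ A)) → Σ (S.Tm (X S.▹▹ Θ) A) (λ t' → tm° Θ t' ≡ t)
  tm• S.[]      t = t , refl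
  tm• (A S.∷ Θ) t = tm• Θ t

  tm°-inj : ∀ {X} (Θ : S.Tel X) {A} {t t' : S.Tm (X S.▹▹ Θ) A} → tm° Θ t ≡ tm° Θ t' → t ≡ t'
  tm°-inj S.[]      e = e
  tm°-inj (A S.∷ Θ) e = tm°-inj Θ e

  tel°-sub : ∀ {X Y} (Θ : S.Tel X) (σ : S.Sub Y X) → tel° (proj₁ (S.subTel Θ σ)) ≡ proj₁ (C.subTel (tel° Θ) (proj₁ σ))
  tel°-sub S.[]      σ = refl
  tel°-sub (A S.∷ Θ) σ = cong (_ C.∷_) (tel°-sub Θ (σ S.↑ A))

  ty°-sub : ∀ {X Y} (Θ : S.Tel X) (B : S.Ty (X S.▹▹ Θ)) (σ : S.Sub Y X) →
            _≡_ {A = Σ (C.Tel (proj₁ Y)) (λ Θ → C.Ty (proj₁ Y C.▹▹ Θ))}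
              (tel° (proj₁ (S.subTel Θ σ)) , ty° (proj₁ (S.subTel Θ σ)) (B S.[ S.up Θ σ ]T))
              (proj₁ (C.subTel (tel° Θ) (proj₁ σ)) , ty° Θ B C.[ C.up (tel° Θ) (proj₁ σ) ]T)
  ty°-sub S.[]      B σ = refl
  ty°-sub (A S.∷ Θ) B σ = cong (λ { (Θ , B) → _ C.∷ Θ , B }) (ty°-sub Θ B (σ S.↑ A))

  tm°-sub : ∀ {X Y} (Θ : S.Tel X) {A} (t : S.Tm (X S.▹▹ Θ) A) (σ : S.Sub Y X) →
            _≡_ {A = Σ (C.Tel (proj₁ Y)) (λ Θ → C.PTm (proj₁ Y C.▹▹ Θ))}
              (tel° (proj₁ (S.subTel Θ σ)) , _ , tm° (proj₁ (S.subTel Θ σ)) (t S.[ S.up Θ σ ]t))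
              (proj₁ (C.subTel (tel° Θ) (proj₁ σ)) , _ , tm° Θ t C.[ C.up (tel° Θ) (proj₁ σ) ]t)
  tm°-sub S.[]      t σ = refl
  tm°-sub (A S.∷ Θ) t σ = cong (λ { (Θ , P) → _ C.∷ Θ , P }) (tm°-sub Θ t (σ S.↑ A))

  mono° : ∀ {X} → S.Mono X → C.Mono (proj₁ X)
  mono° (S.ty Θ)   = C.ty (tel° Θ)
  mono° (S.tm Θ A) = C.tm (tel° Θ) (ty° Θ A)

  mel° : ∀ {X} (M : S.Mono X) → S.MEl M → C.MEl (mono° M)
  mel° (S.ty Θ)   B = ty° Θ B
  mel° (S.tm Θ A) t = tm° Θ t

  mel• : ∀ {X} (M : S.Mono X) (m : C.MEl (mono° M)) → Σ (S.MEl M) (λ m' → mel° M m' ≡ m)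
  mel• (S.ty Θ)   B = ty• Θ B
  mel• (S.tm Θ A) t = tm• Θ t

  mel°-inj : ∀ {X} (M : S.Mono X) {m m' : S.MEl M} → mel° M m ≡ mel° M m' → m ≡ m'
  mel°-inj (S.ty Θ)   e = ty°-inj Θ e
  mel°-inj (S.tm Θ A) e = tm°-inj Θ e

  mono°-sub : ∀ {X Y} (M : S.Mono X) (σ : S.Sub Y X) → mono° (M S.[ σ ]M) ≡ mono° M C.[ proj₁ σ ]M
  mono°-sub (S.ty Θ)   σ = cong C.ty (tel°-sub Θ σ)
  mono°-sub (S.tm Θ A) σ = cong (λ { (Θ , A) → C.tm Θ A }) (ty°-sub Θ A σ)

  pm° : ∀ {X} → S.PMel X → C.PMel (proj₁ X)
  pm° (M , m) = mono° M , mel° M m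

  pm°-sub : ∀ {X Y} (x : S.PMel X) (σ : S.Sub Y X) → pm° (x S.[ σ ]PM) ≡ pm° x C.[ proj₁ σ ]PM
  pm°-sub (S.ty Θ , B)   σ = cong (λ { (Θ , B) → C.ty Θ , B }) (ty°-sub Θ B σ)
  pm°-sub (S.tm Θ A , t) σ = cong (λ { (Θ , A , t) → C.tm Θ A , t }) (tm°-sub Θ t σ)

  pm°-inj : ∀ {X} (x y : S.PMel X) → proj₁ x ≡ proj₁ y → pm° x ≡ pm° y → x ≡ y
  pm°-inj (M , m) (.M , m') refl e = cong (M ,_) (mel°-inj M (pair-inj e))

  -- The slice of `C/Γ₀` over `(Δ , π)` is `C/Δ`, and a monomial sort over `(Δ , π)` amounts to one
  -- over `Δ`. The representing objects are those of `C`, with structure maps obtained by composing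
  -- with `π`.
  sliceRep : (∀ Γ M → C.MonoRep Γ M) → ∀ X M → S.MonoRep X M
  sliceRep rep (Δ , π) M = record
    { I = R.I
    ; obj = λ i → R.obj i , π C.∘ R.to i
    ; to = to
    ; gen = gen
    ; fac = fac
    ; uniq = λ {_} {i} {i'} ρ ρ' e h → lem (R.uniq (proj₁ ρ) (proj₁ ρ') (cong proj₁ e)
        (trans (sym (pm-gen-[] i ρ)) (trans (cong pm° h) (pm-gen-[] i' ρ')))) }
    where
    module R = C.MonoRep (rep Δ (mono° M))
    to : ∀ i → S.Sub (R.obj i , π C.∘ R.to i) (Δ , π)
    to i = R.to i , refl
    type : ∀ i → mono° M C.[ R.to i ]M ≡ mono° (M S.[ to i ]M)
    type i = sym (mono°-sub M (to i))
    gen : ∀ i → S.MEl (M S.[ to i ]M)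
    gen i = proj₁ (mel• (M S.[ to i ]M) (subst C.MEl (type i) (R.gen i)))
    pm-gen : ∀ i → pm° (M S.[ to i ]M , gen i) ≡ (mono° M C.[ R.to i ]M , R.gen i)
    pm-gen i = trans (cong (mono° (M S.[ to i ]M) ,_) (proj₂ (mel• (M S.[ to i ]M) (subst C.MEl (type i) (R.gen i))))) (subst-pair (type i) _)
    pm-gen-[] : ∀ i {Y} (ρ : S.Sub Y (R.obj i , π C.∘ R.to i)) → pm° ((M S.[ to i ]M , gen i) S.[ ρ ]PM) ≡ (mono° M C.[ R.to i ]M , R.gen i) C.[ proj₁ ρ ]PM
    pm-gen-[] i ρ = trans (pm°-sub (M S.[ to i ]M , gen i) ρ) (cong (C._[ proj₁ ρ ]PM) (pm-gen i))
    fac : ∀ {Y} (σ : S.Sub Y (Δ , π)) (m : S.MEl (M S.[ σ ]M)) →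
          Σ R.I (λ i → Σ (S.Sub Y (R.obj i , π C.∘ R.to i)) (λ ρ → to i S.∘ ρ ≡ σ × _≡_ {A = S.PMel Y} ((M S.[ to i ]M , gen i) S.[ ρ ]PM) (M S.[ σ ]M , m)))
    fac {Y} (σ , e) m with R.fac σ (subst C.MEl (mono°-sub M (σ , e)) (mel° (M S.[ σ , e ]M) m))
    ... | i , ρ , h , k = i , ρ⁺ , eq , pm°-inj _ _ (trans (sym (S.[∘]M M (to i) ρ⁺)) (cong (λ σ → M S.[ σ ]M) eq))
                                          (trans (pm-gen-[] i ρ⁺) (trans k (subst-pair (mono°-sub M (σ , e)) _)))
      where
      ρ⁺ : S.Sub Y (R.obj i , π C.∘ R.to i)
      ρ⁺ = ρ , trans (C.ass π (R.to i) ρ) (trans (cong (π C.∘_) h) e)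
      eq : to i S.∘ ρ⁺ ≡ (σ , e)
      eq = Σ≡ (λ _ → uip) h
    lem : ∀ {Y i i'} {ρ : S.Sub Y (R.obj i , π C.∘ R.to i)} {ρ' : S.Sub Y (R.obj i' , π C.∘ R.to i')} →
          _≡_ {A = Σ R.I (λ i → C.Sub (proj₁ Y) (R.obj i))} (i , proj₁ ρ) (i' , proj₁ ρ') →
          _≡_ {A = Σ R.I (λ i → S.Sub Y (R.obj i , π C.∘ R.to i))} (i , ρ) (i' , ρ')
    lem {ρ = _ , e} {_ , e'} refl = cong (λ e → _ , _ , e) (uip e e')

theorem2 : (C : CwF) → IsCellularCwF C →
    ((Γ : CwF.Con C) (P : Sorts.Poly (Slice C Γ)) → Sorts.FamRep (Slice C Γ) P)
    × ((P : Sorts.Poly C) → Sorts.FamRep C P)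
theorem2 C cell =
  (λ Γ → Monomials.famRep (Slice C Γ) (SliceMonomials.sliceRep C Γ monoRep)) , Monomials.famRep C monoRep
  where open CellularMonomials cell
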